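{- The theories $T_{\log}$ and $T_0$ (defined in the context) have NIP, i.e. neither of them has the independence property.
   Context: An asymptotic couple is a pair $(\Gamma,\psi)$ with $\Gamma$ an ordered abelian group and $\psi:\Gamma^{\neq}\to\Gamma$ (where $\Gamma^{\neq}=\Gamma\setminus\{0\}$) such that for all $\alpha,\beta\in\Gamma^{\neq}$: (AC1) $\alpha+\beta\neq 0\Rightarrow \psi(\alpha+\beta)\ge\min(\psi(\alpha),\psi(\beta))$; (AC2) $\psi(r\alpha)=\psi(\alpha)$ for all $r\in\mathbb{Z}\setminus\{0\}$; (AC3) $\alpha>0\Rightarrow \alpha+\psi(\alpha)>\psi(\beta)$. It is of $H$-type if moreover (HC) $0<\alpha\le\beta\Rightarrow\psi(\alpha)\ge\psi(\beta)$. Put $\psi(0):=\infty$, $\alpha':=\alpha+\psi(\alpha)$ for $\alpha\neq 0$, $\Psi:=\psi(\Gamma^{\neq})$. The couple has asymptotic integration if every element of $\Gamma$ equals $\beta'$ for some $\beta\in\Gamma^{\neq}$; this $\beta$ is then unique and is denoted $\int\alpha$, and one defines the successor function $s(\alpha):=\psi(\int\alpha)$. Let $L_{AC}=\{0,+,-,<,\psi,\infty\}$, with an asymptotic couple viewed as a structure on $\Gamma\cup\{\infty\}$ ($\infty$ above $\Gamma$, and $-\infty=\gamma+\infty=\infty+\gamma=\infty+\infty=\psi(0)=\psi(\infty)=\infty$). $T_0$ is the $L_{AC}$-theory whose models are the divisible $H$-type asymptotic couples with asymptotic integration such that: $\Psi$ has a least element $s0$; $s0>0$; every element of $\Psi$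 has an immediate successor in $\Psi$, and for $\alpha\in\Psi$ this immediate successor is $s\alpha$; and $\gamma\mapsto s\gamma$ is a bijection $\Psi\to\Psi^{>s0}$. Let $L_{\log}=L_{AC}\cup\{s,p,\delta_1,\delta_2,\dots\}$ (unary function symbols); a model of $T_0$ is viewed as an $L_{\log}$-structure with $s$ the successor function, $p$ the inverse of $s:\Psi\to\Psi^{>s0}$ extended by $p(x)=\infty$ for $x\notin\Psi^{>s0}$, and $\delta_n$ division by $n$ (all with value $\infty$ at $\infty$). $T_{\log}$ is the $L_{\log}$-theory whose models are exactly these expansions of models of $T_0$. $T_0$ is complete; it is the theory of $(\Gamma_{\log},\psi)$ where $\Gamma_{\log}=\bigoplus_n\mathbb{R}e_n$ ordered lexicographically and $\psi(\sum_{i\ge n} r_ie_i)=e_0+\dots+e_n$ when $r_n\neq0$. A formula $\phi(x,y)$ (with parameters from a monster model $\mathbb{M}$) has the independence property if there are tuples $(a_i)_{i\in\mathbb{N}}$ and $(b_I)_{I\subseteq\mathbb{N}}$ in $\mathbb{M}$ with $\mathbb{M}\models\phi(a_i,b_I)\iff i\in I$; a theory has NIP if no formula has the independence property. -}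

module Defs where

open import Level using (Level; _⊔_) renaming (suc to lsuc)
open import Data.Nat using (ℕ; zero; suc)
open import Data.Integer using (ℤ; +_; -[1+_]) renaming (0ℤ to 0ℤ)
open import Data.Fin using (Fin)
open import Data.Bool using (Bool; true)
open import Data.Maybe using (Maybe; just; nothing)
open import Data.Product using (Σ; _×_; _,_; proj₁)
open import Data.Sum using (_⊎_)
open import Data.Unit.Polymorphic using (⊤; tt)
open import Data.Empty.Polymorphic using (⊥)
open import Data.Vec.Functional using (Vector; _++_)
open import Relation.Nullary using (¬_; yes; no)
open import Relation.Binary.PropositionalEquality using (_≡_; _≢_)
open import Algebra.Structures using (IsAbelianGroup)
open import Relation.Binary.Structures using (IsStrictTotalOrder)
open import Function.Bundles using (_⇔_)

module _ {ℓ : Level} {Γ : Set ℓ} where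

  Le : (Γ → Γ → Set ℓ) → Γ → Γ → Set ℓ
  Le _<_ x y = (x < y) ⊎ (x ≡ y)

  nmul : Γ → (Γ → Γ → Γ) → ℕ → Γ → Γ
  nmul 0# _+_ zero    x = 0#
  nmul 0# _+_ (suc n) x = x + nmul 0# _+_ n x

  zmul : Γ → (Γ → Γ → Γ) → (Γ → Γ) → ℤ → Γ → Γ
  zmul 0# _+_ -_ (+ n)      x = nmul 0# _+_ n x
  zmul 0# _+_ -_ (-[1+ n ]) x = - (nmul 0# _+_ (suc n) x)

-- Divisible H-type asymptotic couples with asymptotic integration.
-- ψ is given as a total function Γ → Γ; its value at 0 is irrelevant
-- (never used): the map ψ : Γ^≠ → Γ of the paper is its restriction,
-- and ψ(0) := ∞ is implemented in ψ∞ below.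

record HAC (ℓ : Level) : Set (lsuc ℓ) where
  infixl 6 _+_
  infix 4 _<_
  field
    Γ   : Set ℓ
    0#  : Γ
    _+_ : Γ → Γ → Γ
    -_  : Γ → Γ
    _<_ : Γ → Γ → Set ℓ
    ψ   : Γ → Γ
    isAbelianGroup     : IsAbelianGroup _≡_ _+_ 0# -_
    isStrictTotalOrder : IsStrictTotalOrder _≡_ _<_
    +-mono-<           : ∀ {x y} z → x < y → x + z < y + z
    AC1 : ∀ α β → α ≢ 0# → β ≢ 0# → α + β ≢ 0# →
          Le _<_ (ψ α) (ψ (α + β)) ⊎ Le _<_ (ψ β) (ψ (α + β))
    AC2 : ∀ α (r : ℤ) → α ≢ 0# → r ≢ 0ℤ → ψ (zmul 0# _+_ -_ r α) ≡ ψ α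
    AC3 : ∀ α β → α ≢ 0# → β ≢ 0# → 0# < α → ψ β < α + ψ α
    HC  : ∀ α β → 0# < α → Le _<_ α β → Le _<_ (ψ β) (ψ α)
    divisible : ∀ α (n : ℕ) → Σ Γ λ β → nmul 0# _+_ (suc n) β ≡ α
    asympInt  : ∀ α → Σ Γ λ β → (β ≢ 0#) × (β + ψ β ≡ α)

  _≤_ : Γ → Γ → Set ℓ
  _≤_ = Le _<_

  InΨ : Γ → Set ℓ
  InΨ x = Σ Γ λ α → (α ≢ 0#) × (ψ α ≡ x)

  -- ∫ α (unique by the axioms, so this choice is the paper's ∫)
  ∫ : Γ → Γ
  ∫ α = proj₁ (asympInt α)

  s : Γ → Γ
  s α = ψ (∫ α)

record T0Model (ℓ : Level) : Set (lsuc ℓ) where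
  field
    hac : HAC ℓ
  open HAC hac public
  field
    s0∈Ψ     : InΨ (s 0#)
    s0-least : ∀ x → InΨ x → s 0# ≤ x
    s0>0     : 0# < s 0#
    sα∈Ψ     : ∀ α → InΨ α → InΨ (s α)
    α<sα     : ∀ α → InΨ α → α < s α
    sα-imm   : ∀ α γ → InΨ α → InΨ γ → α < γ → s α ≤ γ
    s-into   : ∀ α → InΨ α → s 0# < s α
    s-inj    : ∀ α β → InΨ α → InΨ β → s α ≡ s β → α ≡ β
    s-onto   : ∀ γ → InΨ γ → s 0# < γ → Σ Γ λ α → InΨ α × (s α ≡ γ)

-- The extra L_log symbols p and δ_{n+1} on a model of T₀ (uniquely
-- determined by the specifications).  Models of T_log = pairs (M , E).

record LogExp {ℓ : Level} (M : T0Model ℓ) : Set ℓ where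
  open T0Model M
  field
    p : Γ → Maybe Γ
    -- δ n is division by (suc n), i.e. the symbol δ_{n+1}
    δ : ℕ → Γ → Γ
    p-in  : ∀ x → InΨ x → s 0# < x →
            Σ Γ λ α → (p x ≡ just α) × InΨ α × (s α ≡ x)
    p-out : ∀ x → ¬ (InΨ x × (s 0# < x)) → p x ≡ nothing
    δ-spec : ∀ n x → nmul 0# _+_ (suc n) (δ n x) ≡ x

data Lang : Set where
  AC Log : Lang

data Term : Lang → ℕ → Set where
  var  : ∀ {L n} → Fin n → Term L n
  0ₜ   : ∀ {L n} → Term L n
  ∞ₜ   : ∀ {L n} → Term L n
  _+ₜ_ : ∀ {L n} → Term L n → Term L n → Term L n
  -ₜ_  : ∀ {L n} → Term L n → Term L n
  ψₜ   : ∀ {L n} → Term L n → Term L n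
  sₜ   : ∀ {n} → Term Log n → Term Log n
  pₜ   : ∀ {n} → Term Log n → Term Log n
  δₜ   : ∀ {n} → ℕ → Term Log n → Term Log n   -- δₜ k = δ_{k+1}

data Formula (L : Lang) : ℕ → Set where
  ⊤ᶠ ⊥ᶠ : ∀ {n} → Formula L n
  _≐_   : ∀ {n} → Term L n → Term L n → Formula L n
  _<ᶠ_  : ∀ {n} → Term L n → Term L n → Formula L n
  ¬ᶠ_   : ∀ {n} → Formula L n → Formula L n
  _∧ᶠ_ _∨ᶠ_ _⇒ᶠ_ : ∀ {n} → Formula L n → Formula L n → Formula L n
  ∃ᶠ ∀ᶠ : ∀ {n} → Formula L (suc n) → Formula L n

-- Semantics on Γ ∪ {∞}, represented as Maybe Γ (nothing = ∞)

Ops : ∀ {ℓ} → Lang → T0Model ℓ → Set ℓ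
Ops AC  M = ⊤
Ops Log M = LogExp M

module Semantics {ℓ : Level} (M : T0Model ℓ) where
  open T0Model M

  Γ∞ : Set ℓ
  Γ∞ = Maybe Γ

  _<∞_ : Γ∞ → Γ∞ → Set ℓ
  just a  <∞ just b  = a < b
  just a  <∞ nothing = ⊤
  nothing <∞ _       = ⊥

  add∞ : Γ∞ → Γ∞ → Γ∞
  add∞ (just a) (just b) = just (a + b)
  add∞ _        _        = nothing

  neg∞ : Γ∞ → Γ∞
  neg∞ (just a) = just (- a)
  neg∞ nothing  = nothing

  ψ∞ : Γ∞ → Γ∞
  ψ∞ nothing = nothing
  ψ∞ (just a) with IsStrictTotalOrder._≟_ isStrictTotalOrder a 0#
  ... | yes _ = nothing
  ... | no  _ = just (ψ a)

  s∞ : Γ∞ → Γ∞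
  s∞ nothing  = nothing
  s∞ (just a) = just (s a)

  eval : ∀ {L n} → Ops L M → (Fin n → Γ∞) → Term L n → Γ∞
  eval o ρ (var i)    = ρ i
  eval o ρ 0ₜ         = just 0#
  eval o ρ ∞ₜ         = nothing
  eval o ρ (t +ₜ u)   = add∞ (eval o ρ t) (eval o ρ u)
  eval o ρ (-ₜ t)     = neg∞ (eval o ρ t)
  eval o ρ (ψₜ t)     = ψ∞ (eval o ρ t)
  eval o ρ (sₜ t)     = s∞ (eval o ρ t)
  eval o ρ (pₜ t) with eval o ρ t
  ... | nothing = nothing
  ... | just a  = LogExp.p o a
  eval o ρ (δₜ k t) with eval o ρ t
  ... | nothing = nothing
  ... | just a  = just (LogExp.δ o k a)

  extend : ∀ {n} → Γ∞ → (Fin n → Γ∞) → Fin (suc n) → Γ∞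
  extend x ρ Fin.zero    = x
  extend x ρ (Fin.suc i) = ρ i

  Sat : ∀ {L n} → Ops L M → (Fin n → Γ∞) → Formula L n → Set ℓ
  Sat o ρ ⊤ᶠ        = ⊤
  Sat o ρ ⊥ᶠ        = ⊥
  Sat o ρ (t ≐ u)   = eval o ρ t ≡ eval o ρ u
  Sat o ρ (t <ᶠ u)  = eval o ρ t <∞ eval o ρ u
  Sat o ρ (¬ᶠ φ)    = ¬ Sat o ρ φ
  Sat o ρ (φ ∧ᶠ ψ′) = Sat o ρ φ × Sat o ρ ψ′
  Sat o ρ (φ ∨ᶠ ψ′) = Sat o ρ φ ⊎ Sat o ρ ψ′
  Sat o ρ (φ ⇒ᶠ ψ′) = Sat o ρ φ → Sat o ρ ψ′
  Sat o ρ (∃ᶠ φ)    = Σ Γ∞ λ x → Sat o (extend x ρ) φ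
  Sat o ρ (∀ᶠ φ)    = ∀ x → Sat o (extend x ρ) φ

  -- φ(x ; y ; c) with |x| = k, |y| = m, parameters c of length q from M.
  -- Independence property: (a_i)_{i∈ℕ}, (b_I)_{I⊆ℕ} with
  --   M ⊨ φ(a_i, b_I, c)  ⇔  i ∈ I.
  HasIP : ∀ {L k m q} → Ops L M → Formula L (k Data.Nat.+ (m Data.Nat.+ q))
          → Vector Γ∞ q → Set ℓ
  HasIP {k = k} {m} o φ c =
    Σ (ℕ → Vector Γ∞ k) λ a →
    Σ ((ℕ → Bool) → Vector Γ∞ m) λ b →
    ∀ (i : ℕ) (I : ℕ → Bool) → Sat o (a i ++ (b I ++ c)) φ ⇔ (I i ≡ true)

NIP-T0 : (ℓ : Level) → Set (lsuc ℓ)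
NIP-T0 ℓ = ∀ (M : T0Model ℓ) {k m q : ℕ}
  (φ : Formula AC (k Data.Nat.+ (m Data.Nat.+ q)))
  (c : Vector (Maybe (T0Model.Γ M)) q) →
  ¬ Semantics.HasIP M {AC} {k} {m} {q} tt φ c

NIP-Tlog : (ℓ : Level) → Set (lsuc ℓ)
NIP-Tlog ℓ = ∀ (M : T0Model ℓ) (E : LogExp M) {k m q : ℕ}
  (φ : Formula Log (k Data.Nat.+ (m Data.Nat.+ q)))
  (c : Vector (Maybe (T0Model.Γ M)) q) →
  ¬ Semantics.HasIP M {Log} {k} {m} {q} E φ c

{-# OPTIONS --safe #-}
module Submission where

-- Read ψ as a convex valuation v on the ordered ℚ-vector space Γ.  Then s is
-- a ↦ v (a − λ) for an ideal element λ, the limit of the chain Ψ (in Γ_log,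
-- λ = e₀ + e₁ + …).  Membership in Ψ is decidable, as x ∈ Ψ iff x = p (s x), so p
-- and δₙ are canonical and formulas of T₀ are special formulas of T_log.
--
-- Quantifiers are eliminated in Herbrand form: given finitely many terms
-- T (x , y), finitely many terms t (y) suffice to replace every x without
-- changing the signs of T.  If x ∈ Ψ, then away from finitely many points
-- v (a (y) + q λ) all terms have the form a (y) + Σ rᵢ sⁱ(x), and their signs do
-- not change when x is moved down to the next such point.  For arbitrary x, once
-- the values of ψ, s and p occurring in T are named, everything is linear in x,
-- and x can be moved inside the gap between the closest points; the names lie in
-- Ψ and are eliminated by the first case.
--
-- For NIP fix a₀ , … , aₙ₋₁.  By the ultrametric inequality v (X + Yᵢ) is either
-- v (Yⱼ − Yᵢ) or the constant v (X + Yⱼ), where j maximises v (X + Yⱼ).  Hence,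
-- inductively, a term t (aᵢ , b) is, on boundedly many pieces of the index set,
-- an unknown constant plus a function of i, with only polynomially many
-- possibilities for the pieces and functions when b varies.  So finitely many
-- terms have fewer than 2ⁿ sign patterns on a₀ , … , aₙ₋₁ for large n.

open import Defs
open import Level using (Level; _⊔_) renaming (suc to lsuc)
open import Data.Nat as ℕ using (ℕ; zero; suc; z≤n; s≤s)
import Data.Nat.Properties as ℕₚ
import Data.Nat.Solver as ℕSolver
open import Data.Integer as ℤ using (ℤ; -[1+_]) renaming (+_ to pos)
import Data.Integer.Properties as ℤₚ
open import Data.Bool using (Bool; true; false)
open import Data.Fin as Fin using (Fin; combine; remQuot; finToFun; funToFin)
import Data.Fin.Properties as Finₚ
open import Data.Maybe as Maybe using (Maybe; just; nothing; fromMaybe)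
open import Data.Maybe.Properties using (just-injective)
open import Data.Product using (Σ; ∃; _×_; _,_; proj₁; proj₂)
open import Data.Sum using (_⊎_; inj₁; inj₂; [_,_]′)
open import Data.Empty using (⊥; ⊥-elim)
open import Data.Unit using (⊤; tt)
import Data.Unit.Polymorphic as ⊤ₚ
open import Data.List using (List; []; _∷_; _++_; map; concatMap; length; lookup; upTo)
open import Data.List.Relation.Unary.Any as Any using (here; there)
open import Data.List.Relation.Unary.Any.Properties using (lookup-index)
open import Data.List.Membership.Propositional using (_∈_)
open import Data.List.Membership.Propositional.Properties
  using (∈-map⁺; ∈-map⁻; ∈-concatMap⁺; ∈-++⁺ˡ; ∈-++⁺ʳ; ∈-++⁻; ∈-lookup; ∈-upTo⁺)
open import Data.Vec as Vec using (Vec; []; _∷_)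
open import Data.Vec.Functional as Vector using (Vector)
open import Function using (_∘_; const)
open import Function.Bundles using (Equivalence)
open import Relation.Nullary using (¬_; yes; no; Dec)
open import Relation.Nullary.Decidable using (_×-dec_)
open import Relation.Binary.PropositionalEquality
open import Relation.Binary.Structures using (IsStrictTotalOrder)
open import Relation.Binary.Definitions using (Tri; tri<; tri≈; tri>; Trichotomous)
open import Algebra.Bundles using (AbelianGroup)
import Algebra.Properties.AbelianGroup as AbelianGroupProperties
import Relation.Binary.Reflection as Reflection

-- The whole argument stays in one given model, and the truth of a formula is never decided.
-- Elimination is only used to carry truth from one assignment to another with the same signs; this
-- relation is symmetric, so negation and implication cause no trouble and no quantifier-free
-- formula has to be written down. The list of witness terms depends on the given terms alone, which
-- allows one replacement to be used at two assignments. The primitive operations are chosen to fit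
-- the valuation. By itself `p` involves a membership test, but `pᵍ ∘ s` factors through `s` and so
-- sees its argument only through its distance to λ. What remains of `p` is the test χ, which is
-- read from a sign. The obstacle in eliminating `x` is that the names given to values of ψ, `s` and
-- `p` depend on `x` themselves. The conditions on a move of `x` are therefore stated with the old
-- names and chosen so that the names survive the move.

-- Strict total orders.

module Chain {a} {A : Set a} {_<_ : A → A → Set a} (isSTO : IsStrictTotalOrder _≡_ _<_) where

  open IsStrictTotalOrder isSTO public
    using (compare; _≟_) renaming (trans to <-trans; irrefl to <-irrefl; asym to <-asym)

  infix 4 _≼_
  _≼_ : A → A → Set a
  _≼_ = Le _<_

  <-≤-trans : ∀ {x y z} → x < y → y ≼ z → x < z
  <-≤-trans p (inj₁ q)    = <-trans p q
  <-≤-trans p (inj₂ refl) = p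

  ≤-<-trans : ∀ {x y z} → x ≼ y → y < z → x < z
  ≤-<-trans (inj₁ p)    q = <-trans p q
  ≤-<-trans (inj₂ refl) q = q

  ≤-trans : ∀ {x y z} → x ≼ y → y ≼ z → x ≼ z
  ≤-trans p (inj₁ q)    = inj₁ (≤-<-trans p q)
  ≤-trans p (inj₂ refl) = p

  ≤⇒≯ : ∀ {x y} → x ≼ y → ¬ (y < x)
  ≤⇒≯ p q = <-irrefl refl (≤-<-trans p q)

  ≤-antisym : ∀ {x y} → x ≼ y → y ≼ x → x ≡ y
  ≤-antisym (inj₂ e) _ = e
  ≤-antisym (inj₁ p) q = ⊥-elim (≤⇒≯ q p)

  _<⊎≥_ : ∀ x y → x < y ⊎ y ≼ x
  x <⊎≥ y with compare x y
  ... | tri< p _ _ = inj₁ p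
  ... | tri≈ _ p _ = inj₂ (inj₂ (sym p))
  ... | tri> _ _ p = inj₂ (inj₁ p)

  ≮⇒≥ : ∀ {x y} → ¬ (x < y) → y ≼ x
  ≮⇒≥ {x} {y} n with x <⊎≥ y
  ... | inj₁ p = ⊥-elim (n p)
  ... | inj₂ p = p

-- The rational num / (1 + den); the choice of representative never matters,
-- since scalars are only used through their action.
record Scalar : Set where
  constructor _/1+_
  field
    num : ℤ
    den : ℕ

open Scalar public

infixl 6 _+ˢ_
infixl 7 _*ˢ_

_+ˢ_ : Scalar → Scalar → Scalar
(m /1+ a) +ˢ (n /1+ b) = (m ℤ.* pos (suc b) ℤ.+ n ℤ.* pos (suc a)) /1+ (b ℕ.+ a ℕ.* suc b)

_*ˢ_ : Scalar → Scalar → Scalar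
(m /1+ a) *ˢ (n /1+ b) = (m ℤ.* n) /1+ (b ℕ.+ a ℕ.* suc b)

-ˢ_ : Scalar → Scalar
-ˢ (m /1+ a) = (ℤ.- m) /1+ a

-- Junk value: the inverse of 0 is 0.
invˢ : Scalar → Scalar
invˢ (pos zero /1+ a) = pos 0 /1+ 0
invˢ (pos (suc n) /1+ a) = pos (suc a) /1+ n
invˢ (-[1+ n ]  /1+ a) = -[1+ a ] /1+ n

0ˢ 1ˢ ½ˢ : Scalar
0ˢ = pos 0 /1+ 0
1ˢ = pos 1 /1+ 0
½ˢ = pos 1 /1+ 1

IsZero : Scalar → Set
IsZero q = num q ≡ pos 0

isZero? : ∀ q → Dec (IsZero q)
isZero? q = num q ℤ.≟ pos 0

isZero-neg : ∀ q → IsZero (-ˢ q) → IsZero q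
isZero-neg (pos zero /1+ _) refl = refl

isZero-inv : ∀ q → IsZero (invˢ q) → IsZero q
isZero-inv (pos zero /1+ _) _ = refl

-- Divisible ordered abelian groups as ordered vector spaces over the rationals.

module Group {ℓ} (M : T0Model ℓ) where

  open T0Model M public hiding (_≤_)

  infix 4 _≤_
  _≤_ : Γ → Γ → Set ℓ
  _≤_ = Le _<_

  module O = Chain isStrictTotalOrder

  Γ-group : AbelianGroup ℓ ℓ
  Γ-group = record { isAbelianGroup = isAbelianGroup }

  open AbelianGroup Γ-group public using ()
    renaming (assoc to +-assoc; comm to +-comm; identityˡ to +-identityˡ; identityʳ to +-identityʳ;
              inverseˡ to +-inverseˡ; inverseʳ to +-inverseʳ)
  open AbelianGroupProperties Γ-group public using (⁻¹-∙-comm)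
    renaming (⁻¹-involutive to neg-involutive; ε⁻¹≈ε to neg-0)

  infixl 6 _-_
  _-_ : Γ → Γ → Γ
  x - y = x + (- y)

  infixr 7 _·ⁿ_ _·ᶻ_ _·_

  _·ⁿ_ : ℕ → Γ → Γ
  n ·ⁿ x = nmul 0# _+_ n x

  _·ᶻ_ : ℤ → Γ → Γ
  k ·ᶻ x = zmul 0# _+_ -_ k x

  interchange : ∀ a b c d → (a + b) + (c + d) ≡ (a + c) + (b + d)
  interchange a b c d = begin
    (a + b) + (c + d) ≡⟨ +-assoc a b (c + d) ⟩
    a + (b + (c + d)) ≡⟨ cong (a +_) (+-assoc b c d) ⟨
    a + ((b + c) + d) ≡⟨ cong (λ z → a + (z + d)) (+-comm b c) ⟩
    a + ((c + b) + d) ≡⟨ cong (a +_) (+-assoc c b d) ⟩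
    a + (c + (b + d)) ≡⟨ +-assoc a c (b + d) ⟨
    (a + c) + (b + d) ∎
    where open ≡-Reasoning

  neg-+ : ∀ a b → - (a + b) ≡ - a + - b
  neg-+ a b = sym (⁻¹-∙-comm a b)

  ·ⁿ-+ : ∀ m n x → (m ℕ.+ n) ·ⁿ x ≡ m ·ⁿ x + n ·ⁿ x
  ·ⁿ-+ zero n x = sym (+-identityˡ _)
  ·ⁿ-+ (suc m) n x = trans (cong (x +_) (·ⁿ-+ m n x)) (sym (+-assoc x _ _))

  ·ⁿ-distrib : ∀ n x y → n ·ⁿ (x + y) ≡ n ·ⁿ x + n ·ⁿ y
  ·ⁿ-distrib zero x y = sym (+-identityˡ _)
  ·ⁿ-distrib (suc n) x y = trans (cong ((x + y) +_) (·ⁿ-distrib n x y)) (interchange x y _ _)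

  ·ⁿ-neg : ∀ n x → n ·ⁿ (- x) ≡ - (n ·ⁿ x)
  ·ⁿ-neg zero x = sym neg-0
  ·ⁿ-neg (suc n) x = trans (cong (- x +_) (·ⁿ-neg n x)) (sym (neg-+ x _))

  ·ⁿ-0 : ∀ n → n ·ⁿ 0# ≡ 0#
  ·ⁿ-0 zero = refl
  ·ⁿ-0 (suc n) = trans (+-identityˡ _) (·ⁿ-0 n)

  ⊖-· : ∀ m n x → (m ℤ.⊖ n) ·ᶻ x ≡ m ·ⁿ x - n ·ⁿ x
  ⊖-· m zero x = sym (trans (cong (m ·ⁿ x +_) neg-0) (+-identityʳ _))
  ⊖-· zero (suc n) x = sym (+-identityˡ _)
  ⊖-· (suc m) (suc n) x = begin
    (suc m ℤ.⊖ suc n) ·ᶻ x               ≡⟨ cong (_·ᶻ x) (ℤₚ.[1+m]⊖[1+n]≡m⊖n m n) ⟩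
    (m ℤ.⊖ n) ·ᶻ x                       ≡⟨ ⊖-· m n x ⟩
    m ·ⁿ x - n ·ⁿ x                      ≡⟨ +-identityˡ _ ⟨
    0# + (m ·ⁿ x - n ·ⁿ x)               ≡⟨ cong (_+ (m ·ⁿ x - n ·ⁿ x)) (+-inverseʳ x) ⟨
    (x - x) + (m ·ⁿ x - n ·ⁿ x)          ≡⟨ interchange x (- x) _ _ ⟩
    (x + m ·ⁿ x) + (- x + - (n ·ⁿ x))    ≡⟨ cong ((x + m ·ⁿ x) +_) (neg-+ x _) ⟨
    (x + m ·ⁿ x) - (x + n ·ⁿ x)          ∎
    where open ≡-Reasoning

  ·ᶻ-neg : ∀ k x → (ℤ.- k) ·ᶻ x ≡ - (k ·ᶻ x)
  ·ᶻ-neg (pos zero) x = sym neg-0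
  ·ᶻ-neg (pos (suc n)) x = refl
  ·ᶻ-neg -[1+ n ] x = sym (neg-involutive _)

  ·ᶻ-+ : ∀ j k x → (j ℤ.+ k) ·ᶻ x ≡ j ·ᶻ x + k ·ᶻ x
  ·ᶻ-+ (pos m) (pos n) x = ·ⁿ-+ m n x
  ·ᶻ-+ (pos m) -[1+ n ] x = ⊖-· m (suc n) x
  ·ᶻ-+ -[1+ m ] (pos n) x = trans (⊖-· n (suc m) x) (+-comm _ _)
  ·ᶻ-+ -[1+ m ] -[1+ n ] x = begin
    - (suc (suc (m ℕ.+ n)) ·ⁿ x)           ≡⟨ cong (λ z → - (z ·ⁿ x)) (ℕₚ.+-suc (suc m) n) ⟨
    - ((suc m ℕ.+ suc n) ·ⁿ x)             ≡⟨ cong -_ (·ⁿ-+ (suc m) (suc n) x) ⟩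
    - (suc m ·ⁿ x + suc n ·ⁿ x)            ≡⟨ neg-+ _ _ ⟩
    - (suc m ·ⁿ x) + - (suc n ·ⁿ x)        ∎
    where open ≡-Reasoning

  ·ᶻ-distrib : ∀ k x y → k ·ᶻ (x + y) ≡ k ·ᶻ x + k ·ᶻ y
  ·ᶻ-distrib (pos n) x y = ·ⁿ-distrib n x y
  ·ᶻ-distrib -[1+ n ] x y = trans (cong -_ (·ⁿ-distrib (suc n) x y)) (neg-+ _ _)

  ·ᶻ-negʳ : ∀ k x → k ·ᶻ (- x) ≡ - (k ·ᶻ x)
  ·ᶻ-negʳ (pos n) x = ·ⁿ-neg n x
  ·ᶻ-negʳ -[1+ n ] x = cong -_ (·ⁿ-neg (suc n) x)

  ·ᶻ-0 : ∀ k → k ·ᶻ 0# ≡ 0#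
  ·ᶻ-0 (pos n) = ·ⁿ-0 n
  ·ᶻ-0 -[1+ n ] = trans (cong -_ (·ⁿ-0 (suc n))) neg-0

  ·ⁿᶻ-assoc : ∀ m k x → (pos m ℤ.* k) ·ᶻ x ≡ m ·ⁿ (k ·ᶻ x)
  ·ⁿᶻ-assoc zero k x = refl
  ·ⁿᶻ-assoc (suc m) k x = begin
    (pos (suc m) ℤ.* k) ·ᶻ x          ≡⟨ cong (_·ᶻ x) (ℤₚ.suc-* (pos m) k) ⟩
    (k ℤ.+ pos m ℤ.* k) ·ᶻ x        ≡⟨ ·ᶻ-+ k (pos m ℤ.* k) x ⟩
    k ·ᶻ x + (pos m ℤ.* k) ·ᶻ x     ≡⟨ cong (k ·ᶻ x +_) (·ⁿᶻ-assoc m k x) ⟩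
    k ·ᶻ x + m ·ⁿ (k ·ᶻ x)        ∎
    where open ≡-Reasoning

  ·ᶻ-assoc : ∀ j k x → (j ℤ.* k) ·ᶻ x ≡ j ·ᶻ (k ·ᶻ x)
  ·ᶻ-assoc (pos m) k x = ·ⁿᶻ-assoc m k x
  ·ᶻ-assoc -[1+ m ] k x = begin
    (-[1+ m ] ℤ.* k) ·ᶻ x         ≡⟨ cong (_·ᶻ x) (ℤₚ.neg-distribˡ-* (pos (suc m)) k) ⟨
    (ℤ.- (pos (suc m) ℤ.* k)) ·ᶻ x    ≡⟨ ·ᶻ-neg (pos (suc m) ℤ.* k) x ⟩
    - ((pos (suc m) ℤ.* k) ·ᶻ x)      ≡⟨ cong -_ (·ⁿᶻ-assoc (suc m) k x) ⟩
    - (suc m ·ⁿ (k ·ᶻ x))         ∎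
    where open ≡-Reasoning

  ·ᶻ-swap : ∀ j k x → j ·ᶻ (k ·ᶻ x) ≡ k ·ᶻ (j ·ᶻ x)
  ·ᶻ-swap j k x = trans (sym (·ᶻ-assoc j k x)) (trans (cong (_·ᶻ x) (ℤₚ.*-comm j k)) (·ᶻ-assoc k j x))

  infixl 6 _⊹_
  infix  8 ⊟_
  -- Syntax of a reflection solver. An expression is normalised to its vector of integer
  -- coefficients, so an identity holds by `refl` as soon as the coefficients agree; rational
  -- multiples enter as atoms.
  data GroupExpr (n : ℕ) : Set where
    gvar : Fin n → GroupExpr n
    𝟎    : GroupExpr n
    _⊹_  : GroupExpr n → GroupExpr n → GroupExpr n
    ⊟_   : GroupExpr n → GroupExpr n

  module _ where
    gval : ∀ {n} → GroupExpr n → Vec Γ n → Γ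
    gval (gvar i) ρ = Vec.lookup ρ i
    gval 𝟎 ρ = 0#
    gval (e ⊹ f) ρ = gval e ρ + gval f ρ
    gval (⊟ e) ρ = - gval e ρ

    unitVec : ∀ {n} → Fin n → Vec ℤ n
    unitVec Fin.zero = pos 1 ∷ Vec.replicate _ (pos 0)
    unitVec (Fin.suc i) = pos 0 ∷ unitVec i

    coeffs : ∀ {n} → GroupExpr n → Vec ℤ n
    coeffs (gvar i) = unitVec i
    coeffs 𝟎 = Vec.replicate _ (pos 0)
    coeffs (e ⊹ f) = Vec.zipWith ℤ._+_ (coeffs e) (coeffs f)
    coeffs (⊟ e) = Vec.map ℤ.-_ (coeffs e)

    linear : ∀ {n} → Vec ℤ n → Vec Γ n → Γ
    linear [] [] = 0#
    linear (k ∷ ks) (x ∷ xs) = k ·ᶻ x + linear ks xs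

    linear-0 : ∀ {n} (ρ : Vec Γ n) → linear (Vec.replicate n (pos 0)) ρ ≡ 0#
    linear-0 [] = refl
    linear-0 (x ∷ ρ) = trans (+-identityˡ _) (linear-0 ρ)

    linear-unit : ∀ {n} (i : Fin n) ρ → linear (unitVec i) ρ ≡ Vec.lookup ρ i
    linear-unit Fin.zero (x ∷ ρ) = trans (cong₂ _+_ (+-identityʳ x) (linear-0 ρ)) (+-identityʳ x)
    linear-unit (Fin.suc i) (x ∷ ρ) = trans (+-identityˡ _) (linear-unit i ρ)

    linear-+ : ∀ {n} (ks js : Vec ℤ n) ρ → linear (Vec.zipWith ℤ._+_ ks js) ρ ≡ linear ks ρ + linear js ρ
    linear-+ [] [] [] = sym (+-identityˡ _)
    linear-+ (k ∷ ks) (j ∷ js) (x ∷ ρ) =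
      trans (cong₂ _+_ (·ᶻ-+ k j x) (linear-+ ks js ρ)) (interchange _ _ _ _)

    linear-neg : ∀ {n} (ks : Vec ℤ n) ρ → linear (Vec.map ℤ.-_ ks) ρ ≡ - linear ks ρ
    linear-neg [] [] = sym neg-0
    linear-neg (k ∷ ks) (x ∷ ρ) = trans (cong₂ _+_ (·ᶻ-neg k x) (linear-neg ks ρ)) (sym (neg-+ _ _))

    gnorm : ∀ {n} → GroupExpr n → Vec Γ n → Γ
    gnorm e ρ = linear (coeffs e) ρ

    gnorm-correct : ∀ {n} (e : GroupExpr n) ρ → gnorm e ρ ≡ gval e ρ
    gnorm-correct (gvar i) ρ = linear-unit i ρ
    gnorm-correct 𝟎 ρ = linear-0 ρ
    gnorm-correct (e ⊹ f) ρ =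
      trans (linear-+ (coeffs e) (coeffs f) ρ) (cong₂ _+_ (gnorm-correct e ρ) (gnorm-correct f ρ))
    gnorm-correct (⊟ e) ρ = trans (linear-neg (coeffs e) ρ) (cong -_ (gnorm-correct e ρ))

  open Reflection (setoid Γ) gvar gval gnorm gnorm-correct public using (solve) renaming (_⊜_ to _≗ᵍ_)

  +-cancelˡ : ∀ z {x y} → z + x ≡ z + y → x ≡ y
  +-cancelˡ z {x} {y} e = begin
    x            ≡⟨ solve 2 (λ z x → x ≗ᵍ (⊟ z ⊹ (z ⊹ x))) refl z x ⟩
    - z + (z + x) ≡⟨ cong (- z +_) e ⟩
    - z + (z + y) ≡⟨ solve 2 (λ z x → (⊟ z ⊹ (z ⊹ x)) ≗ᵍ x) refl z y ⟩
    y            ∎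
    where open ≡-Reasoning

  x-y≡0⇒x≡y : ∀ {x y} → x - y ≡ 0# → x ≡ y
  x-y≡0⇒x≡y {x} {y} e = trans (solve 2 (λ x y → x ≗ᵍ ((x ⊹ ⊟ y) ⊹ y)) refl x y)
    (trans (cong (_+ y) e) (+-identityˡ y))

  neg≡0⇒≡0 : ∀ {x} → - x ≡ 0# → x ≡ 0#
  neg≡0⇒≡0 {x} e = trans (sym (neg-involutive x)) (trans (cong -_ e) neg-0)

  <-cong : ∀ {a b c d} → a ≡ b → c ≡ d → a < c → b < d
  <-cong refl refl p = p

  +-mono-<ˡ : ∀ {x y} z → x < y → z + x < z + y
  +-mono-<ˡ z p = <-cong (+-comm _ _) (+-comm _ _) (+-mono-< z p)

  +-mono-<-< : ∀ {a b c d} → a < b → c < d → a + c < b + d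
  +-mono-<-< {b = b} {c} p q = O.<-trans (+-mono-< c p) (+-mono-<ˡ b q)

  +-mono-≤-< : ∀ {a b c d} → a ≤ b → c < d → a + c < b + d
  +-mono-≤-< (inj₁ p) q = +-mono-<-< p q
  +-mono-≤-< {b = b} (inj₂ refl) q = +-mono-<ˡ b q

  <⇒0<- : ∀ {x y} → x < y → 0# < y - x
  <⇒0<- {x} {y} p = <-cong (+-inverseʳ x) refl (+-mono-< (- x) p)

  0<-⇒< : ∀ {x y} → 0# < y - x → x < y
  0<-⇒< {x} {y} p = <-cong (+-identityˡ x)
    (solve 2 (λ x y → ((y ⊹ ⊟ x) ⊹ x) ≗ᵍ y) refl x y) (+-mono-< x p)

  neg-mono-< : ∀ {x y} → x < y → - y < - x
  neg-mono-< {x} {y} p = <-cong (solve 2 (λ x y → (x ⊹ (⊟ x ⊹ ⊟ y)) ≗ᵍ (⊟ y)) refl x y)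
    (solve 2 (λ x y → (y ⊹ (⊟ x ⊹ ⊟ y)) ≗ᵍ (⊟ x)) refl x y) (+-mono-< (- x + - y) p)

  neg-pos : ∀ {x} → 0# < x → - x < 0#
  neg-pos p = <-cong refl neg-0 (neg-mono-< p)

  neg-neg : ∀ {x} → x < 0# → 0# < - x
  neg-neg p = <-cong neg-0 refl (neg-mono-< p)

  +-pos-≥ : ∀ {x y} → 0# ≤ x → 0# < y → 0# < x + y
  +-pos-≥ p q = <-cong (+-identityˡ _) refl (+-mono-≤-< p q)

  +-monoʳ-≤ : ∀ z {x y} → x ≤ y → z + x ≤ z + y
  +-monoʳ-≤ z (inj₁ p) = inj₁ (+-mono-<ˡ z p)
  +-monoʳ-≤ z (inj₂ refl) = inj₂ refl

  +-monoˡ-≤ : ∀ z {x y} → x ≤ y → x + z ≤ y + z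
  +-monoˡ-≤ z (inj₁ p) = inj₁ (+-mono-< z p)
  +-monoˡ-≤ z (inj₂ refl) = inj₂ refl

  neg-mono-≤ : ∀ {x y} → x ≤ y → - y ≤ - x
  neg-mono-≤ (inj₁ p) = inj₁ (neg-mono-< p)
  neg-mono-≤ (inj₂ refl) = inj₂ refl

  neg-cancel-≤ : ∀ {x y} → - x ≤ - y → y ≤ x
  neg-cancel-≤ {x} {y} p = subst₂ _≤_ (neg-involutive y) (neg-involutive x) (neg-mono-≤ p)

  ·ⁿ-pos : ∀ n {x} → 0# < x → 0# < suc n ·ⁿ x
  ·ⁿ-pos zero p = <-cong refl (sym (+-identityʳ _)) p
  ·ⁿ-pos (suc n) p = +-pos-≥ (inj₁ p) (·ⁿ-pos n p)

  ·ⁿ-negative : ∀ n {x} → x < 0# → suc n ·ⁿ x < 0#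
  ·ⁿ-negative n {x} p = <-cong (trans (cong -_ (·ⁿ-neg (suc n) x)) (neg-involutive _)) refl
    (neg-pos (·ⁿ-pos n (neg-neg p)))

  ·ⁿ-torsion : ∀ n {x} → suc n ·ⁿ x ≡ 0# → x ≡ 0#
  ·ⁿ-torsion n {x} e with O.compare x 0#
  ... | tri< p _ _ = ⊥-elim (O.<-irrefl e (·ⁿ-negative n p))
  ... | tri≈ _ p _ = p
  ... | tri> _ _ p = ⊥-elim (O.<-irrefl (sym e) (·ⁿ-pos n p))

  ·ⁿ-cancel : ∀ n {x y} → suc n ·ⁿ x ≡ suc n ·ⁿ y → x ≡ y
  ·ⁿ-cancel n {x} {y} e = x-y≡0⇒x≡y (·ⁿ-torsion n (begin
    suc n ·ⁿ (x - y)               ≡⟨ ·ⁿ-distrib (suc n) x (- y) ⟩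
    suc n ·ⁿ x + suc n ·ⁿ (- y)    ≡⟨ cong₂ _+_ e (·ⁿ-neg (suc n) y) ⟩
    suc n ·ⁿ y - suc n ·ⁿ y        ≡⟨ +-inverseʳ _ ⟩
    0#                             ∎))
    where open ≡-Reasoning

  div : ℕ → Γ → Γ
  div n x = proj₁ (divisible x n)

  div-spec : ∀ n x → suc n ·ⁿ div n x ≡ x
  div-spec n x = proj₂ (divisible x n)

  opaque
    _·_ : Scalar → Γ → Γ
    q · x = num q ·ᶻ div (den q) x

    ·-unfold : ∀ q x → q · x ≡ num q ·ᶻ div (den q) x
    ·-unfold q x = refl

  ·-spec : ∀ q x → suc (den q) ·ⁿ (q · x) ≡ num q ·ᶻ x
  ·-spec q x = trans (cong (suc (den q) ·ⁿ_) (·-unfold q x))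
    (trans (·ᶻ-swap (pos (suc (den q))) (num q) (div (den q) x))
      (cong (num q ·ᶻ_) (div-spec (den q) x)))

  -- Torsion-freeness makes quotients unique, so the choice made by `div` never matters: most laws
  -- of scalars below are checked after clearing denominators.
  ·-unique : ∀ q x z → suc (den q) ·ⁿ z ≡ num q ·ᶻ x → z ≡ q · x
  ·-unique q x z e = ·ⁿ-cancel (den q) (trans e (sym (·-spec q x)))

  ·-distrib : ∀ q x y → q · (x + y) ≡ q · x + q · y
  ·-distrib q x y = sym (·-unique q (x + y) _ (begin
    d ·ⁿ (q · x + q · y)        ≡⟨ ·ⁿ-distrib d (q · x) (q · y) ⟩
    d ·ⁿ (q · x) + d ·ⁿ (q · y) ≡⟨ cong₂ _+_ (·-spec q x) (·-spec q y) ⟩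
    num q ·ᶻ x + num q ·ᶻ y     ≡⟨ ·ᶻ-distrib (num q) x y ⟨
    num q ·ᶻ (x + y)            ∎))
    where open ≡-Reasoning
          d : ℕ
          d = suc (den q)

  ·-+ : ∀ q r x → (q +ˢ r) · x ≡ q · x + r · x
  ·-+ q@(m /1+ a) r@(n /1+ b) x = sym (·-unique (q +ˢ r) x _ (begin
    (A ℕ.* B) ·ⁿ (q · x + r · x)                          ≡⟨ ·ⁿ-distrib (A ℕ.* B) (q · x) (r · x) ⟩
    (A ℕ.* B) ·ⁿ (q · x) + (A ℕ.* B) ·ⁿ (r · x)           ≡⟨ cong₂ _+_ left right ⟩
    (m ℤ.* pos B) ·ᶻ x + (n ℤ.* pos A) ·ᶻ x                   ≡⟨ ·ᶻ-+ (m ℤ.* pos B) (n ℤ.* pos A) x ⟨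
    (m ℤ.* pos B ℤ.+ n ℤ.* pos A) ·ᶻ x                        ∎))
    where
    open ≡-Reasoning
    A B : ℕ
    A = suc a
    B = suc b
    assoc′ : ∀ y → (A ℕ.* B) ·ⁿ y ≡ A ·ⁿ (B ·ⁿ y)
    assoc′ y = trans (cong (_·ᶻ y) (ℤₚ.pos-* A B)) (·ᶻ-assoc (pos A) (pos B) y)
    left : (A ℕ.* B) ·ⁿ (q · x) ≡ (m ℤ.* pos B) ·ᶻ x
    left = begin
      (A ℕ.* B) ·ⁿ (q · x)  ≡⟨ assoc′ (q · x) ⟩
      A ·ⁿ (B ·ⁿ (q · x))   ≡⟨ ·ᶻ-swap (pos A) (pos B) (q · x) ⟩
      B ·ⁿ (A ·ⁿ (q · x))   ≡⟨ cong (B ·ⁿ_) (·-spec q x) ⟩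
      B ·ⁿ (m ·ᶻ x)         ≡⟨ ·ᶻ-swap (pos B) m x ⟩
      m ·ᶻ (B ·ⁿ x)         ≡⟨ ·ᶻ-assoc m (pos B) x ⟨
      (m ℤ.* pos B) ·ᶻ x      ∎
    right : (A ℕ.* B) ·ⁿ (r · x) ≡ (n ℤ.* pos A) ·ᶻ x
    right = begin
      (A ℕ.* B) ·ⁿ (r · x)  ≡⟨ assoc′ (r · x) ⟩
      A ·ⁿ (B ·ⁿ (r · x))   ≡⟨ cong (A ·ⁿ_) (·-spec r x) ⟩
      A ·ⁿ (n ·ᶻ x)         ≡⟨ ·ᶻ-swap (pos A) n x ⟩
      n ·ᶻ (A ·ⁿ x)         ≡⟨ ·ᶻ-assoc n (pos A) x ⟨
      (n ℤ.* pos A) ·ᶻ x      ∎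

  ·-* : ∀ q r x → (q *ˢ r) · x ≡ q · (r · x)
  ·-* q@(m /1+ a) r@(n /1+ b) x = sym (·-unique (q *ˢ r) x _ (begin
    (A ℕ.* B) ·ⁿ (q · (r · x))  ≡⟨ cong (_·ᶻ (q · (r · x))) (trans (ℤₚ.pos-* A B) (ℤₚ.*-comm (pos A) (pos B))) ⟩
    (pos B ℤ.* pos A) ·ᶻ (q · (r · x)) ≡⟨ ·ᶻ-assoc (pos B) (pos A) _ ⟩
    B ·ⁿ (A ·ⁿ (q · (r · x)))   ≡⟨ cong (B ·ⁿ_) (·-spec q (r · x)) ⟩
    B ·ⁿ (m ·ᶻ (r · x))         ≡⟨ ·ᶻ-swap (pos B) m (r · x) ⟩
    m ·ᶻ (B ·ⁿ (r · x))         ≡⟨ cong (m ·ᶻ_) (·-spec r x) ⟩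
    m ·ᶻ (n ·ᶻ x)               ≡⟨ ·ᶻ-assoc m n x ⟨
    (m ℤ.* n) ·ᶻ x              ∎))
    where
    open ≡-Reasoning
    A B : ℕ
    A = suc a
    B = suc b

  ·-1 : ∀ x → 1ˢ · x ≡ x
  ·-1 x = sym (·-unique 1ˢ x x refl)

  ·-zero : ∀ q x → IsZero q → q · x ≡ 0#
  ·-zero q@(_ /1+ a) x refl = ·-unfold q x

  ·-0 : ∀ q → q · 0# ≡ 0#
  ·-0 q = sym (·-unique q 0# 0# (trans (·ⁿ-0 (suc (den q))) (sym (·ᶻ-0 (num q)))))

  ·-neg : ∀ q x → (-ˢ q) · x ≡ - (q · x)
  ·-neg q@(m /1+ a) x = trans (·-unfold (-ˢ q) x) (trans (·ᶻ-neg m (div a x)) (cong -_ (sym (·-unfold q x))))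

  ·-negʳ : ∀ q x → q · (- x) ≡ - (q · x)
  ·-negʳ q x = sym (·-unique q (- x) _ (trans (·ⁿ-neg (suc (den q)) _)
    (trans (cong -_ (·-spec q x)) (sym (·ᶻ-negʳ (num q) x)))))

  ·-minus : ∀ q x y → q · (x - y) ≡ q · x - q · y
  ·-minus q x y = trans (·-distrib q x (- y)) (cong (q · x +_) (·-negʳ q y))

  inv-* : ∀ q x → ¬ IsZero q → invˢ q · (q · x) ≡ x
  inv-* (pos zero /1+ a) x nz = ⊥-elim (nz refl)
  inv-* q@(pos (suc n) /1+ a) x nz = trans (sym (·-* (invˢ q) q x)) (sym (·-unique (invˢ q *ˢ q) x x
    (cong (_·ⁿ x) (ℕₚ.*-comm (suc n) (suc a)))))
  inv-* q@(-[1+ n ] /1+ a) x nz = trans (sym (·-* (invˢ q) q x)) (sym (·-unique (invˢ q *ˢ q) x x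
    (cong (_·ⁿ x) (ℕₚ.*-comm (suc n) (suc a)))))

  *-inv : ∀ q x → ¬ IsZero q → q · (invˢ q · x) ≡ x
  *-inv q x nz = trans (sym (·-* q (invˢ q) x)) (trans (comm* q (invˢ q) x)
    (trans (·-* (invˢ q) q x) (inv-* q x nz)))
    where
    comm* : ∀ q r x → (q *ˢ r) · x ≡ (r *ˢ q) · x
    comm* q@(m /1+ a) r@(n /1+ b) x = ·-unique (r *ˢ q) x _
      (trans (cong (_·ⁿ ((q *ˢ r) · x)) (ℕₚ.*-comm (suc b) (suc a)))
        (trans (·-spec (q *ˢ r) x) (cong (_·ᶻ x) (ℤₚ.*-comm m n))))

  ·-nonzero : ∀ q {x} → ¬ IsZero q → x ≢ 0# → q · x ≢ 0#
  ·-nonzero q {x} nz x≢0 e = x≢0 (trans (sym (inv-* q x nz)) (trans (cong (invˢ q ·_) e) (·-0 (invˢ q))))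

  half-+-half : ∀ x → ½ˢ · x + ½ˢ · x ≡ x
  half-+-half x = trans (solve 1 (λ h → (h ⊹ h) ≗ᵍ (h ⊹ (h ⊹ 𝟎))) refl (½ˢ · x))
    (trans (·-spec ½ˢ x) (+-identityʳ x))

-- Asymptotic couples as valued vector spaces

data Sign : Set where
  neg zer pos inf : Sign

module Valuation {ℓ} (M : T0Model ℓ) where

  open Group M public
  open Semantics M public using (Γ∞; _<∞_; add∞; ψ∞; s∞)

  <∞-compare : Trichotomous _≡_ _<∞_
  <∞-compare (just x) (just y) with O.compare x y
  ... | tri< p q r = tri< p (λ e → q (just-injective e)) r
  ... | tri≈ p q r = tri≈ p (cong just q) r
  ... | tri> p q r = tri> p (λ e → q (just-injective e)) r
  <∞-compare (just x) nothing = tri< ⊤ₚ.tt (λ ()) (λ ())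
  <∞-compare nothing (just x) = tri> (λ ()) (λ ()) ⊤ₚ.tt
  <∞-compare nothing nothing = tri≈ (λ ()) refl (λ ())

  <∞-trans : ∀ {x y z} → x <∞ y → y <∞ z → x <∞ z
  <∞-trans {just x} {just y} {just z} p q = O.<-trans p q
  <∞-trans {just x} {just y} {nothing} p q = ⊤ₚ.tt

  <∞-isStrictTotalOrder : IsStrictTotalOrder _≡_ _<∞_
  <∞-isStrictTotalOrder = record
    { isStrictPartialOrder = record
      { isEquivalence = isEquivalence
      ; irrefl = λ { {just x} refl → O.<-irrefl refl }
      ; trans = λ {x} {y} {z} → <∞-trans {x} {y} {z}
      ; <-resp-≈ = (λ { refl p → p }) , (λ { refl p → p })
      }
    ; compare = <∞-compare
    }

  module O∞ = Chain <∞-isStrictTotalOrder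
  open O∞ public using () renaming (_≼_ to _≤∞_)

  ≤∞-nothing : ∀ {x} → x ≤∞ nothing
  ≤∞-nothing {just x} = inj₁ ⊤ₚ.tt
  ≤∞-nothing {nothing} = inj₂ refl

  just-≤ : ∀ {x y} → x ≤ y → just x ≤∞ just y
  just-≤ (inj₁ p) = inj₁ p
  just-≤ (inj₂ refl) = inj₂ refl

  ≤-just : ∀ {x y} → just x ≤∞ just y → x ≤ y
  ≤-just (inj₁ p) = inj₁ p
  ≤-just (inj₂ refl) = inj₂ refl

  data SignView (x : Γ) : Sign → Set ℓ where
    is-neg : x < 0# → SignView x neg
    is-zer : x ≡ 0# → SignView x zer
    is-pos : 0# < x → SignView x pos

  opaque
    sign : Γ → Sign
    sign x with O.compare x 0#
    ... | tri< _ _ _ = neg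
    ... | tri≈ _ _ _ = zer
    ... | tri> _ _ _ = pos

    sign-neg : ∀ {x} → x < 0# → sign x ≡ neg
    sign-neg {x} p with O.compare x 0#
    ... | tri< _ _ _ = refl
    ... | tri≈ q _ _ = ⊥-elim (q p)
    ... | tri> q _ _ = ⊥-elim (q p)

    sign-pos : ∀ {x} → 0# < x → sign x ≡ pos
    sign-pos {x} p with O.compare x 0#
    ... | tri< _ _ q = ⊥-elim (q p)
    ... | tri≈ _ _ q = ⊥-elim (q p)
    ... | tri> _ _ _ = refl

    sign-zer : ∀ {x} → x ≡ 0# → sign x ≡ zer
    sign-zer {x} p with O.compare x 0#
    ... | tri< _ q _ = ⊥-elim (q p)
    ... | tri≈ _ _ _ = refl
    ... | tri> _ q _ = ⊥-elim (q p)

    signView : ∀ x → SignView x (sign x)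
    signView x with O.compare x 0#
    ... | tri< p _ _ = is-neg p
    ... | tri≈ _ p _ = is-zer p
    ... | tri> _ _ p = is-pos p

  sgn : Γ∞ → Sign
  sgn (just x) = sign x
  sgn nothing = inf

  sign-view : ∀ {x σ} → sign x ≡ σ → SignView x σ
  sign-view {x} refl = signView x

  sign-·ᶻ : ∀ k {x y} → sign x ≡ sign y → sign (k ·ᶻ x) ≡ sign (k ·ᶻ y)
  sign-·ᶻ (pos zero) e = refl
  sign-·ᶻ (pos (suc n)) {x} {y} e with sign x | signView x | sign-view {y} (sym e)
  ... | _ | is-neg p | is-neg q = trans (sign-neg (·ⁿ-negative n p)) (sym (sign-neg (·ⁿ-negative n q)))
  ... | _ | is-zer refl | is-zer refl = refl
  ... | _ | is-pos p | is-pos q = trans (sign-pos (·ⁿ-pos n p)) (sym (sign-pos (·ⁿ-pos n q)))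
  sign-·ᶻ -[1+ n ] {x} {y} e with sign x | signView x | sign-view {y} (sym e)
  ... | _ | is-neg p | is-neg q =
    trans (sign-pos (neg-neg (·ⁿ-negative n p))) (sym (sign-pos (neg-neg (·ⁿ-negative n q))))
  ... | _ | is-zer refl | is-zer refl = refl
  ... | _ | is-pos p | is-pos q =
    trans (sign-neg (neg-pos (·ⁿ-pos n p))) (sym (sign-neg (neg-pos (·ⁿ-pos n q))))

  sign-div : ∀ d x → sign (div d x) ≡ sign x
  sign-div d x with sign (div d x) | signView (div d x)
  ... | _ | is-neg p = sym (sign-neg (<-cong (div-spec d x) refl (·ⁿ-negative d p)))
  ... | _ | is-zer p = sym (sign-zer (trans (sym (div-spec d x)) (trans (cong (suc d ·ⁿ_) p) (·ⁿ-0 (suc d)))))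
  ... | _ | is-pos p = sym (sign-pos (<-cong refl (div-spec d x) (·ⁿ-pos d p)))

  sign-· : ∀ q {x y} → sign x ≡ sign y → sign (q · x) ≡ sign (q · y)
  sign-· q {x} {y} e = subst₂ (λ a b → sign a ≡ sign b) (sym (·-unfold q x)) (sym (·-unfold q y)) (sign-·ᶻ (num q) (trans (sign-div (den q) x) (trans e (sym (sign-div (den q) y)))))

  half-pos : ∀ {x} → 0# < x → 0# < ½ˢ · x
  half-pos {x} p with sign (½ˢ · x) | signView (½ˢ · x)
    | trans (cong sign (·-unfold ½ˢ x))
        (trans (sign-·ᶻ (pos 1) {div 1 x} {x} (sign-div 1 x)) (sign-pos (·ⁿ-pos 0 p)))
  ... | _ | is-pos q | refl = q

  half-< : ∀ {x} → 0# < x → ½ˢ · x < x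
  half-< {x} p = <-cong (+-identityˡ _) (half-+-half x) (+-mono-< (½ˢ · x) (half-pos p))

  opaque
    v : Γ → Γ∞
    v a = ψ∞ (just a)

    ψ∞≡v : ∀ a → ψ∞ (just a) ≡ v a
    ψ∞≡v a = refl

    v-0 : v 0# ≡ nothing
    v-0 with 0# O.≟ 0#
    ... | yes _ = refl
    ... | no n = ⊥-elim (n refl)

    v-≢0 : ∀ {a} → a ≢ 0# → v a ≡ just (ψ a)
    v-≢0 {a} n with a O.≟ 0#
    ... | yes e = ⊥-elim (n e)
    ... | no _ = refl

    v-nothing : ∀ {a} → v a ≡ nothing → a ≡ 0#
    v-nothing {a} e with a O.≟ 0#
    ... | yes p = p

  v-≡0 : ∀ {a} → a ≡ 0# → v a ≡ nothing
  v-≡0 refl = v-0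

  v-·ᶻ : ∀ k a → k ≢ pos 0 → v (k ·ᶻ a) ≡ v a
  v-·ᶻ k a k≢0 with a O.≟ 0#
  ... | yes refl = trans (v-≡0 (·ᶻ-0 k)) (sym v-0)
  ... | no a≢0 = trans (v-≢0 (nz k k≢0)) (trans (cong just (AC2 a k a≢0 k≢0)) (sym (v-≢0 a≢0)))
    where
    nz : ∀ k → k ≢ pos 0 → k ·ᶻ a ≢ 0#
    nz (pos zero) p e = p refl
    nz (pos (suc n)) p e = a≢0 (·ⁿ-torsion n e)
    nz -[1+ n ] p e = a≢0 (·ⁿ-torsion n (neg≡0⇒≡0 e))

  v-neg : ∀ a → v (- a) ≡ v a
  v-neg a = trans (cong v (cong -_ (sym (+-identityʳ a)))) (v-·ᶻ -[1+ 0 ] a (λ ()))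

  v-minus-comm : ∀ a b → v (a - b) ≡ v (b - a)
  v-minus-comm a b = trans (cong v (solve 2 (λ a b → (a ⊹ ⊟ b) ≗ᵍ (⊟ (b ⊹ ⊟ a))) refl a b)) (v-neg (b - a))

  v-· : ∀ q a → ¬ IsZero q → v (q · a) ≡ v a
  v-· q a nz = trans (cong v (·-unfold q a)) (trans (v-·ᶻ (num q) _ nz)
    (trans (sym (v-·ᶻ (pos (suc (den q))) _ (λ ()))) (cong v (div-spec (den q) a))))

  v-conv : ∀ {a b} → 0# < a → a ≤ b → v b ≤∞ v a
  v-conv {a} {b} p q = subst₂ _≤∞_ (sym (v-≢0 {b} λ e → O.<-irrefl (sym e) (O.<-≤-trans p q)))
    (sym (v-≢0 {a} λ e → O.<-irrefl (sym e) p)) (just-≤ (HC a b p q))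

  v-conv⁻ : ∀ {a b} → a < 0# → b ≤ a → v b ≤∞ v a
  v-conv⁻ {a} {b} p q = subst₂ _≤∞_ (v-neg b) (v-neg a) (v-conv (neg-neg p) (neg-mono-≤ q))

  v-ultra : ∀ {c} a b → c ≤∞ v a → c ≤∞ v b → c ≤∞ v (a + b)
  v-ultra {c} a b p q with a O.≟ 0# | b O.≟ 0# | (a + b) O.≟ 0#
  ... | _ | _ | yes e = subst (c ≤∞_) (sym (v-≡0 e)) ≤∞-nothing
  ... | yes refl | yes refl | no n = ⊥-elim (n (+-identityˡ 0#))
  ... | yes refl | no b≢0 | no n = O∞.≤-trans q (inj₂ (cong v (sym (+-identityˡ b))))
  ... | no a≢0 | yes refl | no n = O∞.≤-trans p (inj₂ (cong v (sym (+-identityʳ a))))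
  ... | no a≢0 | no b≢0 | no n with AC1 a b a≢0 b≢0 n
  ...   | inj₁ r = O∞.≤-trans p (subst₂ _≤∞_ (sym (v-≢0 a≢0)) (sym (v-≢0 n)) (just-≤ r))
  ...   | inj₂ r = O∞.≤-trans q (subst₂ _≤∞_ (sym (v-≢0 b≢0)) (sym (v-≢0 n)) (just-≤ r))

  v-ultra- : ∀ {c} a b → c ≤∞ v a → c ≤∞ v b → c ≤∞ v (a - b)
  v-ultra- a b p q = v-ultra a (- b) p (subst (_ ≤∞_) (sym (v-neg b)) q)

  -- If `a + b` had larger valuation than `a`, then so would `(a + b) - b`, which is `a`.
  v-<ˡ : ∀ a b → v a <∞ v b → v (a + b) ≡ v a
  v-<ˡ a b p with O∞._<⊎≥_ (v a) (v (a + b))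
  ... | inj₂ q = O∞.≤-antisym q (v-ultra a b (inj₂ refl) (inj₁ p))
  ... | inj₁ q = ⊥-elim (O∞.≤⇒≯ {va+b⊓} {v a} lower upper)
    where
    va+b⊓ : Γ∞
    va+b⊓ = v ((a + b) - b)
    lower : va+b⊓ ≤∞ v a
    lower = inj₂ (cong v (solve 2 (λ a b → ((a ⊹ b) ⊹ ⊟ b) ≗ᵍ a) refl a b))
    upper : v a <∞ va+b⊓
    upper with O∞._<⊎≥_ (v (a + b)) (v b)
    ... | inj₁ r = O∞.<-≤-trans {v a} q (v-ultra- (a + b) b (inj₂ refl) (inj₁ r))
    ... | inj₂ r = O∞.<-≤-trans {v a} p (v-ultra- (a + b) b r (inj₂ refl))

  v-<ʳ : ∀ a b → v b <∞ v a → v (a + b) ≡ v b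
  v-<ʳ a b p = trans (cong v (+-comm a b)) (v-<ˡ b a p)

  -- By convexity: if adding `b` changed the sign of `a`, then `- b` would lie on the side of `a`
  -- and at least as far from 0, which forces `v b ≤ v a`.
  sign-dom : ∀ a b → v a <∞ v b → sign (a + b) ≡ sign a
  sign-dom a b p with sign a | signView a
  ... | _ | is-zer refl = ⊥-elim (O∞.≤⇒≯ {v b} ≤∞-nothing (subst (_<∞ v b) v-0 p))
  ... | _ | is-pos q with O._<⊎≥_ 0# (a + b)
  ...   | inj₁ r = sign-pos r
  ...   | inj₂ r = ⊥-elim (O∞.≤⇒≯ (subst (_≤∞ v a) (v-neg b) (v-conv q a≤-b)) p)
    where
    a≤-b : a ≤ - b
    a≤-b with O._<⊎≥_ (- b) a
    ... | inj₂ t = t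
    ... | inj₁ t = ⊥-elim (O.≤⇒≯ r (<-cong (+-inverseˡ b) refl (+-mono-< b t)))
  sign-dom a b p | _ | is-neg q with O._<⊎≥_ (a + b) 0#
  ...   | inj₁ r = sign-neg r
  ...   | inj₂ r = ⊥-elim (O∞.≤⇒≯ (subst (_≤∞ v a) (v-neg b) (v-conv⁻ q -b≤a)) p)
    where
    -b≤a : - b ≤ a
    -b≤a with O._<⊎≥_ a (- b)
    ... | inj₂ t = t
    ... | inj₁ t = ⊥-elim (O.≤⇒≯ r (<-cong refl (+-inverseˡ b) (+-mono-< b t)))

  -- The successor function as a distance to the limit of Ψ.

  s∈Ψ : ∀ a → InΨ (s a)
  s∈Ψ a = ∫ a , proj₁ (proj₂ (asympInt a)) , refl

  a-sa : ∀ a → a - s a ≡ ∫ a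
  a-sa a = trans (cong (_- s a) (sym (proj₂ (proj₂ (asympInt a)))))
    (solve 2 (λ x y → ((x ⊹ y) ⊹ ⊟ y) ≗ᵍ x) refl (∫ a) (s a))

  -- This identity makes `s` behave like a valuation: `s a` is closer to λ than `a` is, so
  -- `v (a - s a)` is the distance from `a` to λ.
  v-a-sa : ∀ a → v (a - s a) ≡ just (s a)
  v-a-sa a = trans (cong v (a-sa a)) (v-≢0 (proj₁ (proj₂ (asympInt a))))

  v-InΨ : ∀ {a u} → v a ≡ just u → InΨ u
  v-InΨ {a} e with a O.≟ 0#
  ... | yes a≡0 with () ← trans (sym e) (v-≡0 a≡0)
  ... | no n = a , n , just-injective (trans (sym (v-≢0 n)) e)

  -- The upper bound is convexity, because `w` is at least the successor of `u`. A valuation below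
  -- `s u` would be at most `u`, since successors are immediate; then AC3 at half of `w - u` gives
  -- `w < h + u < w`.
  v-Ψ-minus : ∀ {u w} → InΨ u → InΨ w → u < w → v (w - u) ≡ just (s u)
  v-Ψ-minus {u} {w} u∈ w∈@(β , β≢0 , refl) u<w = O∞.≤-antisym upper lower
    where
    γ = w - u
    0<γ : 0# < γ
    0<γ = <⇒0<- u<w
    γ≢0 : γ ≢ 0#
    γ≢0 e = O.<-irrefl (sym e) 0<γ
    upper : v γ ≤∞ just (s u)
    upper = O∞.≤-trans (v-conv (<⇒0<- (α<sα u u∈)) (+-monoˡ-≤ (- u) (sα-imm u w u∈ w∈ u<w)))
      (inj₂ (trans (v-minus-comm (s u) u) (v-a-sa u)))
    lower : just (s u) ≤∞ v γ
    lower with O∞._<⊎≥_ (v γ) (just (s u))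
    ... | inj₂ p = p
    ... | inj₁ p = ⊥-elim (O.<-irrefl refl (O.<-trans w<h+u h+u<w))
      where
      h = ½ˢ · γ
      0<h : 0# < h
      0<h = half-pos 0<γ
      ψγ≤u : ψ γ ≤ u
      ψγ≤u with O._<⊎≥_ u (ψ γ)
      ... | inj₂ q = q
      ... | inj₁ q = ⊥-elim (O∞.≤⇒≯ (O∞.≤-trans (just-≤ (sα-imm u (ψ γ) u∈ (γ , γ≢0 , refl) q))
                       (inj₂ (sym (v-≢0 γ≢0)))) p)
      ψh≡ψγ : ψ h ≡ ψ γ
      ψh≡ψγ = just-injective (trans (sym (v-≢0 (λ e → O.<-irrefl (sym e) 0<h)))
                (trans (v-· ½ˢ γ (λ ())) (v-≢0 γ≢0)))
      w<h+u : w < h + u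
      w<h+u = O.<-≤-trans (AC3 h β (λ e → O.<-irrefl (sym e) 0<h) β≢0 0<h)
        (+-monoʳ-≤ h (subst (_≤ u) (sym ψh≡ψγ) ψγ≤u))
      h+u<w : h + u < w
      h+u<w = <-cong refl (solve 2 (λ w u → ((w ⊹ ⊟ u) ⊹ u) ≗ᵍ w) refl w u) (+-mono-< u (half-< 0<γ))

  -- The parts `a - s a`, `b - s b` and `s a - s b` of the splitting have valuations `s a`, `s b`
  -- and `s (s a)`, and `s a` is the strict minimum.
  s-< : ∀ a b → s a < s b → v (a - b) ≡ just (s a)
  s-< a b p = trans (cong v split) (trans (v-<ˡ _ _ (subst₂ _<∞_ (sym e₁) (sym e₂) (α<sα (s a) (s∈Ψ a)))) e₁)
    where
    split : a - b ≡ ((a - s a) - (b - s b)) + (s a - s b)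
    split = solve 4 (λ a b x y → (a ⊹ ⊟ b) ≗ᵍ (((a ⊹ ⊟ x) ⊹ ⊟ (b ⊹ ⊟ y)) ⊹ (x ⊹ ⊟ y))) refl a b (s a) (s b)
    e₁ : v ((a - s a) - (b - s b)) ≡ just (s a)
    e₁ = trans (v-<ˡ _ _ (subst₂ _<∞_ (sym (v-a-sa a)) (sym (trans (v-neg _) (v-a-sa b))) p)) (v-a-sa a)
    e₂ : v (s a - s b) ≡ just (s (s a))
    e₂ = trans (v-minus-comm (s a) (s b)) (v-Ψ-minus (s∈Ψ a) (s∈Ψ b) p)

  s-≡ : ∀ a b → s a ≡ s b → just (s a) ≤∞ v (a - b)
  s-≡ a b e = subst (just (s a) ≤∞_) (cong v (sym split))
    (v-ultra- (a - s a) (b - s b) (inj₂ (sym (v-a-sa a))) (inj₂ (trans (cong just e) (sym (v-a-sa b)))))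
    where
    split : a - b ≡ (a - s a) - (b - s b)
    split = trans (solve 3 (λ a b x → (a ⊹ ⊟ b) ≗ᵍ ((a ⊹ ⊟ x) ⊹ ⊟ (b ⊹ ⊟ x))) refl a b (s a))
      (cong (λ z → (a - s a) - (b - z)) e)

  s-> : ∀ a b → s b < s a → v (a - b) ≡ just (s b)
  s-> a b p = trans (v-minus-comm a b) (s-< b a p)

  -- The ultrametric inequality for the triangle `a`, `b`, λ: if `a` is farther from `b` than λ is,
  -- then `a` is equally far from `b` and from λ.
  v-minus-<s : ∀ a b → v (a - b) <∞ just (s b) → v (a - b) ≡ just (s a)
  v-minus-<s a b p with O.compare (s a) (s b)
  ... | tri< q _ _ = s-< a b q
  ... | tri≈ _ q _ = ⊥-elim (O∞.≤⇒≯ (s-≡ a b q) (subst (λ z → v (a - b) <∞ just z) (sym q) p))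
  ... | tri> _ _ q = ⊥-elim (O∞.<-irrefl (s-> a b q) p)

  -- V q a is the valuation of a + q λ for an ideal element λ that lies
  -- infinitely close to all large elements of Ψ, so that s a = v (a − λ).

  opaque
    V : Scalar → Γ → Γ∞
    V q a with isZero? q
    ... | yes _ = v a
    ... | no _ = just (s ((-ˢ invˢ q) · a))

    V-zero : ∀ q a → IsZero q → V q a ≡ v a
    V-zero q a z with isZero? q
    ... | yes _ = refl
    ... | no n = ⊥-elim (n z)

    V-nonzero : ∀ q a → ¬ IsZero q → V q a ≡ just (s ((-ˢ invˢ q) · a))
    V-nonzero q a n with isZero? q
    ... | yes z = ⊥-elim (n z)
    ... | no _ = refl

  private
    -- Multiplying by `-ˢ q` preserves `v`. With λ in place of `u`, the left side is `V q a` as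
    -- defined and the right side is `v (a + q λ)` as intended.
    rescale : ∀ q a u → ¬ IsZero q → v ((-ˢ invˢ q) · a - u) ≡ v (a + q · u)
    rescale q a u n = trans (sym (v-· (-ˢ q) _ (λ z → n (isZero-neg q z)))) (cong v (begin
      (-ˢ q) · ((-ˢ invˢ q) · a - u)            ≡⟨ ·-neg q _ ⟩
      - (q · ((-ˢ invˢ q) · a - u))             ≡⟨ cong -_ (·-minus q _ u) ⟩
      - (q · ((-ˢ invˢ q) · a) - q · u)         ≡⟨ cong (λ z → - (q · z - q · u)) (·-neg (invˢ q) a) ⟩
      - (q · (- (invˢ q · a)) - q · u)          ≡⟨ cong (λ z → - (z - q · u)) (·-negʳ q _) ⟩
      - (- (q · (invˢ q · a)) - q · u)          ≡⟨ cong (λ z → - (- z - q · u)) (*-inv q a n) ⟩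
      - (- a - q · u)                           ≡⟨ solve 2 (λ a b → ⊟ (⊟ a ⊹ ⊟ b) ≗ᵍ (a ⊹ b)) refl a (q · u) ⟩
      a + q · u                                 ∎))
      where open ≡-Reasoning

  -- u is large enough to play the role of λ in V q a.
  Dominates : Γ → Scalar → Γ → Set ℓ
  Dominates u q a = IsZero q ⊎ V q a ≤∞ just u

  -- The difference of λ and `u` has valuation `s u`, which exceeds `u`, so replacing λ by `u` does
  -- not affect a value of at most `u`.
  V⇒v : ∀ {u} q a → InΨ u → Dominates u q a → v (a + q · u) ≡ V q a
  V⇒v {u} q a u∈ (inj₁ z) = trans (cong v (trans (cong (a +_) (·-zero q u z)) (+-identityʳ a))) (sym (V-zero q a z))
  V⇒v {u} q a u∈ (inj₂ p) with isZero? q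
  ... | yes z = V⇒v q a u∈ (inj₁ z)
  ... | no n = trans (sym (rescale q a u n)) (trans
    (s-< _ u (O.≤-<-trans (≤-just (subst (_≤∞ just u) (V-nonzero q a n) p)) (α<sα u u∈)))
    (sym (V-nonzero q a n)))

  -- The same comparison read backwards, with the bound on the side of `u` instead of λ.
  v⇒V : ∀ {u} q a → InΨ u → v (a + q · u) ≤∞ just u → V q a ≡ v (a + q · u)
  v⇒V {u} q a u∈ p with isZero? q
  ... | yes z = sym (V⇒v q a u∈ (inj₁ z))
  ... | no n = trans (V-nonzero q a n) (sym (trans (sym (rescale q a u n)) (v-minus-<s _ u
    (O∞.≤-<-trans (subst (_≤∞ just u) (sym (rescale q a u n)) p) (α<sα u u∈)))))

  Dominates-mono : ∀ {u w} q a → u ≤ w → Dominates u q a → Dominates w q a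
  Dominates-mono q a p (inj₁ z) = inj₁ z
  Dominates-mono q a p (inj₂ r) = inj₂ (O∞.≤-trans r (just-≤ p))

  dominating : ∀ q a → Σ Γ λ u → InΨ u × Dominates u q a
  dominating q a with isZero? q
  ... | yes z = s 0# , s0∈Ψ , inj₁ z
  ... | no n = _ , s∈Ψ _ , inj₂ (inj₂ (V-nonzero q a n))

  Ψ-sup : ∀ u w → InΨ u → InΨ w → Σ Γ λ z → InΨ z × u ≤ z × w ≤ z
  Ψ-sup u w u∈ w∈ with O._<⊎≥_ u w
  ... | inj₁ p = w , w∈ , inj₁ p , inj₂ refl
  ... | inj₂ p = u , u∈ , inj₂ refl , p

  inΨ? : ∀ x → Dec (InΨ x)
  inΨ? x with O.compare (s 0#) (s x)
  ... | tri≈ _ e _ = no λ x∈ → O.<-irrefl e (s-into x x∈)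
  ... | tri> _ _ p = ⊥-elim (O.≤⇒≯ (s0-least (s x) (s∈Ψ x)) p)
  ... | tri< p _ _ with s-onto (s x) (s∈Ψ x) p
  ...   | α , α∈ , e with x O.≟ α
  ...     | yes refl = yes α∈
  ...     | no n = no λ x∈ → n (s-inj x α x∈ α∈ (sym e))

  Ψ⁺? : ∀ x → Dec (InΨ x × s 0# < x)
  Ψ⁺? x with inΨ? x
  ... | no n = no λ p → n (proj₁ p)
  ... | yes x∈ with O.compare (s 0#) x
  ...   | tri< p _ _ = yes (x∈ , p)
  ...   | tri≈ n _ _ = no λ p → n (proj₂ p)
  ...   | tri> n _ _ = no λ p → n (proj₂ p)

  opaque
    pred : Γ∞ → Γ∞
    pred nothing = nothing
    pred (just x) with Ψ⁺? x
    ... | yes (x∈ , p) = just (proj₁ (s-onto x x∈ p))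
    ... | no _ = nothing

    pred-∞ : pred nothing ≡ nothing
    pred-∞ = refl

    pred-s : ∀ {u} → InΨ u → pred (just (s u)) ≡ just u
    pred-s {u} u∈ with Ψ⁺? (s u)
    ... | yes (x∈ , p) = cong just (s-inj _ u (proj₁ (proj₂ (s-onto (s u) x∈ p))) u∈
                                (proj₂ (proj₂ (s-onto (s u) x∈ p))))
    ... | no n = ⊥-elim (n (s∈Ψ u , s-into u u∈))

    pred-just : ∀ {x u} → pred (just x) ≡ just u → InΨ u × s u ≡ x
    pred-just {x} e with Ψ⁺? x
    pred-just {x} refl | yes (x∈ , p) = proj₂ (s-onto x x∈ p)

    pred-out : ∀ {x} → ¬ (InΨ x × s 0# < x) → pred (just x) ≡ nothing
    pred-out {x} n with Ψ⁺? x
    ... | yes p = ⊥-elim (n p)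
    ... | no _ = refl

  InΨ∞ : Γ∞ → Set ℓ
  InΨ∞ nothing = ⊤ₚ.⊤
  InΨ∞ (just u) = InΨ u

  pred-InΨ∞ : ∀ x → InΨ∞ (pred x)
  pred-InΨ∞ nothing rewrite pred-∞ = ⊤ₚ.tt
  pred-InΨ∞ (just x) with pred (just x) in e
  ... | just u = proj₁ (pred-just e)
  ... | nothing = ⊤ₚ.tt

  -- With `v-u-pred` this gives an explicit element of each valuation `w` in `Ψ`: `s 0#` for the
  -- least `w`, and otherwise `w` minus its predecessor.
  v-s0 : v (s 0#) ≡ just (s 0#)
  v-s0 = trans (trans (sym (v-neg (s 0#))) (cong v (sym (+-identityˡ _)))) (v-a-sa 0#)

  v-u-pred : ∀ {u} → InΨ u → v (s u - u) ≡ just (s u)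
  v-u-pred {u} u∈ = trans (v-minus-comm (s u) u) (v-a-sa u)

-- Terms and formulas

-- sᵒ g stands for x ↦ pᵍ (s x) and χᵒ for the function that is 0 at 0 and ∞
-- elsewhere; in terms of these p x = χ (x − p (s x)) + p (p (s x)).
data Op : Set where
  ψᵒ χᵒ : Op
  sᵒ    : ℕ → Op

infixl 6 _⊕_
infixr 7 _⊙_

data Tm (V : Set) : Set where
  var   : V → Tm V
  0ᵗ ∞ᵗ : Tm V
  _⊕_   : Tm V → Tm V → Tm V
  _⊙_   : Scalar → Tm V → Tm V
  op    : Op → Tm V → Tm V

sub : ∀ {V W} → (V → Tm W) → Tm V → Tm W
sub f (var x) = f x
sub f 0ᵗ = 0ᵗ
sub f ∞ᵗ = ∞ᵗ
sub f (t ⊕ u) = sub f t ⊕ sub f u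
sub f (q ⊙ t) = q ⊙ sub f t
sub f (op o t) = op o (sub f t)

ren : ∀ {V W} → (V → W) → Tm V → Tm W
ren f = sub (var ∘ f)

infixl 6 _⊖_
_⊖_ : ∀ {V} → Tm V → Tm V → Tm V
t ⊖ u = t ⊕ (-ˢ 1ˢ) ⊙ u

predᵗ : ∀ {V} → Tm V → Tm V
predᵗ t = op χᵒ (t ⊖ op (sᵒ 1) t) ⊕ op (sᵒ 2) t

translate : ∀ {L n} → Term L n → Tm (Fin n)
translate (var i) = var i
translate 0ₜ = 0ᵗ
translate ∞ₜ = ∞ᵗ
translate (t +ₜ u) = translate t ⊕ translate u
translate (-ₜ t) = (-ˢ 1ˢ) ⊙ translate t
translate (ψₜ t) = op ψᵒ (translate t)
translate (sₜ t) = op (sᵒ 0) (translate t)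
translate (pₜ t) = predᵗ (translate t)
translate (δₜ k t) = (pos 1 /1+ k) ⊙ translate t

splitFin : ∀ {n} → Fin (suc n) → ⊤ ⊎ Fin n
splitFin Fin.zero = inj₁ tt
splitFin (Fin.suc i) = inj₂ i

module Evaluation {ℓ} (M : T0Model ℓ) where

  open Valuation M public

  infixr 7 _·∞_
  _·∞_ : Scalar → Γ∞ → Γ∞
  q ·∞ nothing = nothing
  q ·∞ just x = just (q · x)

  opaque
    χ∞ : Γ∞ → Γ∞
    χ∞ nothing = nothing
    χ∞ (just x) with x O.≟ 0#
    ... | yes _ = just 0#
    ... | no _ = nothing

    χ∞-∞ : χ∞ nothing ≡ nothing
    χ∞-∞ = refl

    χ∞-0 : ∀ {x} → x ≡ 0# → χ∞ (just x) ≡ just 0#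
    χ∞-0 {x} e with x O.≟ 0#
    ... | yes _ = refl
    ... | no n = ⊥-elim (n e)

    χ∞-≢0 : ∀ {x} → x ≢ 0# → χ∞ (just x) ≡ nothing
    χ∞-≢0 {x} e with x O.≟ 0#
    ... | yes p = ⊥-elim (e p)
    ... | no _ = refl

  v∞ : Γ∞ → Γ∞
  v∞ nothing = nothing
  v∞ (just x) = v x

  ψ∞≡v∞ : ∀ x → ψ∞ x ≡ v∞ x
  ψ∞≡v∞ nothing = refl
  ψ∞≡v∞ (just x) = ψ∞≡v x

  preds : ℕ → Γ∞ → Γ∞
  preds zero x = x
  preds (suc g) x = pred (preds g x)

  ⟦_⟧ : Op → Γ∞ → Γ∞
  ⟦ ψᵒ ⟧ = v∞
  ⟦ χᵒ ⟧ = χ∞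
  ⟦ sᵒ g ⟧ x = preds g (s∞ x)

  Env : Set → Set ℓ
  Env V = V → Γ∞

  eval : ∀ {V} → Tm V → Env V → Γ∞
  eval (var x) ρ = ρ x
  eval 0ᵗ ρ = just 0#
  eval ∞ᵗ ρ = nothing
  eval (t ⊕ u) ρ = add∞ (eval t ρ) (eval u ρ)
  eval (q ⊙ t) ρ = q ·∞ eval t ρ
  eval (op o t) ρ = ⟦ o ⟧ (eval t ρ)

  eval-cong : ∀ {V} (t : Tm V) {ρ ρ′} → (∀ i → ρ i ≡ ρ′ i) → eval t ρ ≡ eval t ρ′
  eval-cong (var x) e = e x
  eval-cong 0ᵗ e = refl
  eval-cong ∞ᵗ e = refl
  eval-cong (t ⊕ u) e = cong₂ add∞ (eval-cong t e) (eval-cong u e)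
  eval-cong (q ⊙ t) e = cong (q ·∞_) (eval-cong t e)
  eval-cong (op o t) e = cong ⟦ o ⟧ (eval-cong t e)

  eval-sub : ∀ {V W} (f : V → Tm W) t ρ → eval (sub f t) ρ ≡ eval t (λ i → eval (f i) ρ)
  eval-sub f (var x) ρ = refl
  eval-sub f 0ᵗ ρ = refl
  eval-sub f ∞ᵗ ρ = refl
  eval-sub f (t ⊕ u) ρ = cong₂ add∞ (eval-sub f t ρ) (eval-sub f u ρ)
  eval-sub f (q ⊙ t) ρ = cong (q ·∞_) (eval-sub f t ρ)
  eval-sub f (op o t) ρ = cong ⟦ o ⟧ (eval-sub f t ρ)

  -1· : ∀ x → (-ˢ 1ˢ) · x ≡ - x
  -1· x = trans (·-neg 1ˢ x) (cong -_ (·-1 x))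

  infixl 6 _-∞_
  _-∞_ : Γ∞ → Γ∞ → Γ∞
  x -∞ y = add∞ x ((-ˢ 1ˢ) ·∞ y)

  just-minus : ∀ x y → just x -∞ just y ≡ just (x - y)
  just-minus x y = cong (λ z → just (x + z)) (-1· y)

  -- For `x` in `Ψ`, `p (s x)` is `x`, so χ contributes 0. Otherwise `p (s x)` is ∞ or an element of
  -- `Ψ`, never `x`; then χ makes the sum ∞, and `p x` is ∞ too.
  pred-formula : ∀ x → add∞ (χ∞ (x -∞ pred (s∞ x))) (pred (pred (s∞ x))) ≡ pred x
  pred-formula nothing rewrite pred-∞ | χ∞-∞ = refl
  pred-formula (just x) = cases (inΨ? x) (pred (just (s x))) refl
    where
    add-0 : ∀ y → add∞ (just 0#) y ≡ y
    add-0 nothing = refl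
    add-0 (just y) = cong just (+-identityˡ y)
    cases : Dec (InΨ x) → ∀ y → pred (just (s x)) ≡ y → add∞ (χ∞ (just x -∞ y)) (pred y) ≡ pred (just x)
    cases (yes x∈) y e with refl ← trans (sym (pred-s x∈)) e =
      trans (cong (λ z → add∞ (χ∞ z) (pred (just x))) (just-minus x x))
        (trans (cong (λ z → add∞ z (pred (just x))) (χ∞-0 (+-inverseʳ x))) (add-0 _))
    cases (no x∉) nothing e = trans (cong₂ add∞ χ∞-∞ pred-∞) (sym (pred-out (x∉ ∘ proj₁)))
    cases (no x∉) (just y) e = trans (cong (λ z → add∞ (χ∞ z) (pred (just y))) (just-minus x y))
      (trans (cong (λ z → add∞ z (pred (just y)))
          (χ∞-≢0 λ x-y≡0 → x∉ (subst InΨ (sym (x-y≡0⇒x≡y x-y≡0)) (proj₁ (pred-just e)))))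
        (sym (pred-out (x∉ ∘ proj₁))))

  eval-pred : ∀ {V} (t : Tm V) ρ → eval (predᵗ t) ρ ≡ pred (eval t ρ)
  eval-pred t ρ = pred-formula (eval t ρ)

  module Sem = Semantics M

  p≡pred : ∀ (E : LogExp M) x → LogExp.p E x ≡ pred (just x)
  p≡pred E x with Ψ⁺? x
  ... | no n = trans (LogExp.p-out E x n) (sym (pred-out n))
  ... | yes (x∈ , q) with LogExp.p-in E x x∈ q
  ...   | α , e , α∈ , refl = trans e (sym (pred-s α∈))

  δ≡· : ∀ (E : LogExp M) k x → LogExp.δ E k x ≡ (pos 1 /1+ k) · x
  δ≡· E k x = ·-unique (pos 1 /1+ k) x _ (trans (LogExp.δ-spec E k x) (sym (+-identityʳ x)))

  eval-translate : ∀ {L n} (o : Ops L M) (ρ : Fin n → Γ∞) (t : Term L n) →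
                   Sem.eval o ρ t ≡ eval (translate t) ρ
  eval-translate o ρ (var i) = refl
  eval-translate o ρ 0ₜ = refl
  eval-translate o ρ ∞ₜ = refl
  eval-translate o ρ (t +ₜ u) = cong₂ add∞ (eval-translate o ρ t) (eval-translate o ρ u)
  eval-translate o ρ (-ₜ t) rewrite eval-translate o ρ t with eval (translate t) ρ
  ... | nothing = refl
  ... | just x = cong just (sym (-1· x))
  eval-translate o ρ (ψₜ t) = trans (cong ψ∞ (eval-translate o ρ t)) (ψ∞≡v∞ (eval (translate t) ρ))
  eval-translate o ρ (sₜ t) = cong s∞ (eval-translate o ρ t)
  eval-translate o ρ (pₜ t) = trans (step (eval-translate o ρ t)) (sym (eval-pred (translate t) ρ))
    where
    step : Sem.eval o ρ t ≡ eval (translate t) ρ → Sem.eval o ρ (pₜ t) ≡ pred (eval (translate t) ρ)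
    step e with Sem.eval o ρ t | eval (translate t) ρ
    step refl | nothing | _ = sym pred-∞
    step refl | just x | _ = p≡pred o x
  eval-translate o ρ (δₜ k t) = step (eval-translate o ρ t)
    where
    step : Sem.eval o ρ t ≡ eval (translate t) ρ →
           Sem.eval o ρ (δₜ k t) ≡ (pos 1 /1+ k) ·∞ eval (translate t) ρ
    step e with Sem.eval o ρ t | eval (translate t) ρ
    step refl | nothing | _ = refl
    step refl | just x | _ = cong just (δ≡· o k x)

  -- Truth is determined by the signs of finitely many terms.

  Agree : ∀ {V} → List (Tm V) → Env V → Env V → Set
  Agree T ρ ρ′ = ∀ {t} → t ∈ T → sgn (eval t ρ) ≡ sgn (eval t ρ′)

  Agree-sym : ∀ {V} {T : List (Tm V)} {ρ ρ′} → Agree T ρ ρ′ → Agree T ρ′ ρ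
  Agree-sym a i = sym (a i)

  sign≢inf : ∀ {x} → sign x ≢ inf
  sign≢inf {x} e with sign x | signView x
  sign≢inf () | _ | is-neg _
  sign≢inf () | _ | is-zer _
  sign≢inf () | _ | is-pos _

  -- The sign of the difference is not enough: when the difference is ∞, the signs of `a` and `b`
  -- tell which of them is ∞.
  sgn-minus : ∀ {a b a′ b′} → sgn (a -∞ b) ≡ sgn (a′ -∞ b′) → sgn a ≡ sgn a′ → sgn b ≡ sgn b′ →
              (a ≡ b → a′ ≡ b′) × (a <∞ b → a′ <∞ b′)
  sgn-minus {nothing} {nothing} {nothing} {nothing} _ _ _ = (λ _ → refl) , λ ()
  sgn-minus {nothing} {b} {just a′} _ q _ = ⊥-elim (sign≢inf (sym q))
  sgn-minus {a} {nothing} {b′ = just b′} _ _ r = ⊥-elim (sign≢inf (sym r))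
  sgn-minus {just a} {a′ = nothing} _ q _ = ⊥-elim (sign≢inf q)
  sgn-minus {b = just b} {b′ = nothing} _ _ r = ⊥-elim (sign≢inf r)
  sgn-minus {nothing} {just b} {nothing} {just b′} _ _ _ = (λ ()) , λ ()
  sgn-minus {just a} {nothing} {just a′} {nothing} _ _ _ = (λ ()) , λ _ → ⊤ₚ.tt
  sgn-minus {just a} {just b} {just a′} {just b′} p _ _
    with sign (a - b) | signView (a - b)
       | sign-view {a′ - b′} (sym (trans (cong sgn (sym (just-minus a b))) (trans p (cong sgn (just-minus a′ b′)))))
  ... | _ | is-zer e | is-zer e′ = (λ _ → cong just (x-y≡0⇒x≡y e′)) ,
          λ q → ⊥-elim (O.<-irrefl (x-y≡0⇒x≡y e) q)
  ... | _ | is-pos e | is-pos e′ = (λ { refl → ⊥-elim (O.<-irrefl refl (0<-⇒< e)) }) ,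
          λ q → ⊥-elim (O.<-asym q (0<-⇒< e))
  ... | _ | is-neg e | is-neg e′ = (λ { refl → ⊥-elim (O.<-irrefl (+-inverseʳ a) e) }) ,
          λ _ → 0<-⇒< (<-cong refl (solve 2 (λ x y → (⊟ (x ⊹ ⊟ y)) ≗ᵍ (y ⊹ ⊟ x)) refl a′ b′) (neg-neg e′))

  -- Herbrand elimination of a tuple of variables with values in `D`. The finite list is fixed
  -- before `ρ` and `w`, and the replacing tuple need not take values in `D`; only the signs of `T`
  -- count.
  Elim : (W : Set) → (Γ∞ → Set ℓ) → Set _
  Elim W D = ∀ {V} (T : List (Tm (W ⊎ V))) → Σ (List (W → Tm V)) λ Ws →
    ∀ (ρ : Env V) (w : Env W) → (∀ i → D (w i)) →
    ∃ λ w′ → w′ ∈ Ws × Agree T [ w , ρ ]′ [ (λ i → eval (w′ i) ρ) , ρ ]′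

  module Determined (elim : Elim ⊤ (λ _ → ⊤ₚ.⊤)) where

    Det : ∀ {L n} → Ops L M → Formula L n → Set ℓ
    Det {n = n} o φ = Σ (List (Tm (Fin n))) λ T →
      ∀ {ρ ρ′} → Agree T ρ ρ′ → Sem.Sat o ρ φ → Sem.Sat o ρ′ φ

    private
      ext-split : ∀ {n} x (ρ : Env (Fin n)) i → [ const x , ρ ]′ (splitFin i) ≡ Sem.extend x ρ i
      ext-split x ρ Fin.zero = refl
      ext-split x ρ (Fin.suc i) = refl

    -- A back-and-forth step. The witness term that replaces `x` at `ρ` is evaluated at `ρ′` to give
    -- `x′`; all witnesses put into all terms of `T` form the list on which `ρ` and `ρ′` must agree.
    pull : ∀ {n} (T : List (Tm (Fin (suc n)))) → Σ (List (Tm (Fin n))) λ T′ →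
           ∀ {ρ ρ′} → Agree T′ ρ ρ′ → ∀ x → ∃ λ x′ → Agree T (Sem.extend x ρ) (Sem.extend x′ ρ′)
    pull {n} T = concatMap (λ w → map (sub [ w , var ]′) T₁) Ws , extend-agree
      where
      T₁ : List (Tm (⊤ ⊎ Fin n))
      T₁ = map (ren splitFin) T
      Ws : List (⊤ → Tm (Fin n))
      Ws = proj₁ (elim T₁)
      at : ∀ ρ (w : ⊤ → Tm (Fin n)) t → eval (sub [ w , var ]′ (ren splitFin t)) ρ ≡
           eval t (Sem.extend (eval (w tt) ρ) ρ)
      at ρ w t = trans (eval-sub _ (ren splitFin t) ρ) (trans (eval-sub _ t _)
        (eval-cong t λ { Fin.zero → refl ; (Fin.suc i) → refl }))
      extend-agree : ∀ {ρ ρ′} → Agree (concatMap (λ w → map (sub [ w , var ]′) T₁) Ws) ρ ρ′ →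
                     ∀ x → ∃ λ x′ → Agree T (Sem.extend x ρ) (Sem.extend x′ ρ′)
      extend-agree {ρ} {ρ′} agree x with proj₂ (elim T₁) ρ (const x) (λ _ → ⊤ₚ.tt)
      ... | w , w∈ , a = eval (w tt) ρ′ , λ {t} t∈ → begin
        sgn (eval t (Sem.extend x ρ))
          ≡⟨ cong sgn (trans (eval-sub _ t _) (eval-cong t (ext-split x ρ))) ⟨
        sgn (eval (ren splitFin t) [ const x , ρ ]′)
          ≡⟨ a (∈-map⁺ (ren splitFin) t∈) ⟩
        sgn (eval (ren splitFin t) [ (λ i → eval (w i) ρ) , ρ ]′)
          ≡⟨ cong sgn (trans (eval-sub _ t _) (eval-cong t (ext-split _ ρ))) ⟩
        sgn (eval t (Sem.extend (eval (w tt) ρ) ρ))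
          ≡⟨ cong sgn (at ρ w t) ⟨
        sgn (eval (sub [ w , var ]′ (ren splitFin t)) ρ)
          ≡⟨ agree (∈-concatMap⁺ _ (Any.map (λ { refl → ∈-map⁺ _ (∈-map⁺ (ren splitFin) t∈) }) w∈)) ⟩
        sgn (eval (sub [ w , var ]′ (ren splitFin t)) ρ′)
          ≡⟨ cong sgn (at ρ′ w t) ⟩
        sgn (eval t (Sem.extend (eval (w tt) ρ′) ρ′)) ∎
        where open ≡-Reasoning

    private
      left : ∀ {V} (S : List (Tm V)) {T ρ ρ′} → Agree (S ++ T) ρ ρ′ → Agree S ρ ρ′
      left S a i = a (∈-++⁺ˡ i)
        where import Data.List.Membership.Propositional.Properties as Membership
      right : ∀ {V} (S : List (Tm V)) {T ρ ρ′} → Agree (S ++ T) ρ ρ′ → Agree T ρ ρ′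
      right S a i = a (∈-++⁺ʳ S i)
        where import Data.List.Membership.Propositional.Properties as Membership

      atom : ∀ {n} → Tm (Fin n) → Tm (Fin n) → List (Tm (Fin n))
      atom t u = (t ⊖ u) ∷ t ∷ u ∷ []

      atom-agree : ∀ {n} (t u : Tm (Fin n)) {ρ ρ′} → Agree (atom t u) ρ ρ′ →
        (eval t ρ ≡ eval u ρ → eval t ρ′ ≡ eval u ρ′) × (eval t ρ <∞ eval u ρ → eval t ρ′ <∞ eval u ρ′)
      atom-agree t u a = sgn-minus (a (here refl)) (a (there (here refl))) (a (there (there (here refl))))

    -- Agreement is symmetric, so negation and the premise of an implication use the induction
    -- hypothesis from `ρ′` to `ρ`.
    determined : ∀ {L n} (o : Ops L M) (φ : Formula L n) → Det o φ
    determined o ⊤ᶠ = [] , λ _ p → p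
    determined o ⊥ᶠ = [] , λ _ p → p
    determined o (t ≐ u) = atom (translate t) (translate u) , λ {ρ} {ρ′} a p →
      trans (eval-translate o ρ′ t) (trans (proj₁ (atom-agree (translate t) (translate u) a)
        (trans (sym (eval-translate o ρ t)) (trans p (eval-translate o ρ u)))) (sym (eval-translate o ρ′ u)))
    determined o (t <ᶠ u) = atom (translate t) (translate u) , λ {ρ} {ρ′} a p →
      subst₂ _<∞_ (sym (eval-translate o ρ′ t)) (sym (eval-translate o ρ′ u))
        (proj₂ (atom-agree (translate t) (translate u) a)
          (subst₂ _<∞_ (eval-translate o ρ t) (eval-translate o ρ u) p))
    determined o (¬ᶠ φ) with determined o φ
    ... | T , h = T , λ {ρ} {ρ′} a n p → n (h (Agree-sym {T = T} {ρ} {ρ′} a) p)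
    determined o (φ ∧ᶠ χ) with determined o φ | determined o χ
    ... | S , g | T , h = S ++ T , λ {ρ} {ρ′} a (p , q) →
      g (left S {T} {ρ} {ρ′} a) p , h (right S {T} {ρ} {ρ′} a) q
    determined o (φ ∨ᶠ χ) with determined o φ | determined o χ
    ... | S , g | T , h = S ++ T , λ {ρ} {ρ′} a → λ
      { (inj₁ p) → inj₁ (g (left S {T} {ρ} {ρ′} a) p)
      ; (inj₂ q) → inj₂ (h (right S {T} {ρ} {ρ′} a) q) }
    determined o (φ ⇒ᶠ χ) with determined o φ | determined o χ
    ... | S , g | T , h = S ++ T , λ {ρ} {ρ′} a f p →
      h (right S {T} {ρ} {ρ′} a) (f (g (Agree-sym {T = S} {ρ} {ρ′} (left S {T} {ρ} {ρ′} a)) p))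
    determined o (∃ᶠ φ) with determined o φ
    ... | T , h = proj₁ (pull T) , λ {ρ} {ρ′} a → λ where
      (x , p) → let x′ , b = proj₂ (pull T) {ρ} {ρ′} a x in x′ , h b p
    determined o (∀ᶠ φ) with determined o φ
    -- For a universal quantifier the given element lives at `ρ′` and is pulled back to `ρ`.
    ... | T , h = proj₁ (pull T) , λ {ρ} {ρ′} a f x →
      let x′ , b = proj₂ (pull T) {ρ′} {ρ} (Agree-sym {T = proj₁ (pull T)} {ρ} {ρ′} a) x
      in h (Agree-sym {T = T} {Sem.extend x ρ′} {Sem.extend x′ ρ} b) (f x′)

-- Counting sign patterns

-- Codes of size polynomial in n: a code consists of boundedly many choices
-- of at most one index below n.
data Code : Set where
  unit pick : Code
  _⊗_       : Code → Code → Code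

Codes : Code → ℕ → Set
Codes unit n = ⊤
Codes pick n = Maybe (Fin n)
Codes (c ⊗ d) n = Codes c n × Codes d n

size degree : Code → ℕ → ℕ
size unit n = 1
size pick n = suc n
size (c ⊗ d) n = size c n ℕ.* size d n
degree unit _ = 0
degree pick _ = 1
degree (c ⊗ d) n = degree c n ℕ.+ degree d n

encode : ∀ c {n} → Codes c n → Fin (size c n)
encode unit _ = Fin.zero
encode pick nothing = Fin.zero
encode pick (just i) = Fin.suc i
encode (c ⊗ d) (κ , μ) = combine (encode c κ) (encode d μ)

encode-injective : ∀ c {n} {κ μ : Codes c n} → encode c κ ≡ encode c μ → κ ≡ μ
encode-injective unit _ = refl
encode-injective pick {κ = nothing} {nothing} _ = refl
encode-injective pick {κ = just i} {just .i} refl = refl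
encode-injective (c ⊗ d) {κ = κ , κ′} {μ , μ′} e
  with Finₚ.combine-injective (encode c κ) (encode d κ′) (encode c μ) (encode d μ′) e
... | p , q = cong₂ _,_ (encode-injective c p) (encode-injective d q)

size≤ : ∀ c n → size c n ℕ.≤ suc n ℕ.^ degree c n
size≤ unit n = ℕₚ.≤-refl
size≤ pick n = ℕₚ.≤-reflexive (sym (ℕₚ.*-identityʳ (suc n)))
size≤ (c ⊗ d) n = ℕₚ.≤-trans (ℕₚ.*-mono-≤ (size≤ c n) (size≤ d n))
  (ℕₚ.≤-reflexive (sym (ℕₚ.^-distribˡ-+-* (suc n) (degree c n) (degree d n))))

degree-const : ∀ c m n → degree c m ≡ degree c n
degree-const unit m n = refl
degree-const pick m n = refl
degree-const (c ⊗ d) m n = cong₂ ℕ._+_ (degree-const c m n) (degree-const d m n)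

n<2^n : ∀ n → suc n ℕ.≤ 2 ℕ.^ n
n<2^n zero = ℕₚ.≤-refl
n<2^n (suc n) = ℕₚ.+-mono-≤ (ℕₚ.≤-trans (s≤s z≤n) (n<2^n n))
  (ℕₚ.≤-trans (n<2^n n) (ℕₚ.≤-reflexive (sym (ℕₚ.+-identityʳ (2 ℕ.^ n)))))

-- With N + 1 = 2 ^ k for k = 2 d + 2 the claim becomes k d < 2 ^ k − 1.
power<exponential : ∀ d → ∃ λ N → suc N ℕ.^ d ℕ.< 2 ℕ.^ N
power<exponential d with 2 ℕ.^ (d ℕ.+ d ℕ.+ 2) in e
... | zero = ⊥-elim (ℕₚ.1+n≢0 (ℕₚ.m^n≡0⇒m≡0 2 (d ℕ.+ d ℕ.+ 2) e))
... | suc N = N , (begin-strict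
  suc N ℕ.^ d                        ≡⟨ cong (ℕ._^ d) e ⟨
  (2 ℕ.^ (d ℕ.+ d ℕ.+ 2)) ℕ.^ d      ≡⟨ ℕₚ.^-*-assoc 2 (d ℕ.+ d ℕ.+ 2) d ⟩
  2 ℕ.^ ((d ℕ.+ d ℕ.+ 2) ℕ.* d)      <⟨ ℕₚ.^-monoʳ-< 2 (s≤s (s≤s z≤n)) (ℕₚ.≤-pred bound) ⟩
  2 ℕ.^ N                            ∎)
  where
  open ℕₚ.≤-Reasoning
  open ℕSolver.+-*-Solver
  bound : suc (suc ((d ℕ.+ d ℕ.+ 2) ℕ.* d)) ℕ.≤ suc N
  bound = begin
    2 ℕ.+ (d ℕ.+ d ℕ.+ 2) ℕ.* d            ≤⟨ ℕₚ.m≤m+n _ (2 ℕ.+ 6 ℕ.* d ℕ.+ 2 ℕ.* d ℕ.* d) ⟩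
    2 ℕ.+ (d ℕ.+ d ℕ.+ 2) ℕ.* d ℕ.+ (2 ℕ.+ 6 ℕ.* d ℕ.+ 2 ℕ.* d ℕ.* d)
      ≡⟨ solve 1 (λ d → con 2 :+ (d :+ d :+ con 2) :* d :+ (con 2 :+ con 6 :* d :+ con 2 :* d :* d)
                      := (con 1 :+ d) :* (con 1 :+ d) :* con 4) refl d ⟩
    suc d ℕ.* suc d ℕ.* 4                  ≤⟨ ℕₚ.*-monoˡ-≤ 4 (ℕₚ.*-mono-≤ (n<2^n d) (n<2^n d)) ⟩
    2 ℕ.^ d ℕ.* 2 ℕ.^ d ℕ.* 4              ≡⟨ cong (ℕ._* 4) (ℕₚ.^-distribˡ-+-* 2 d d) ⟨
    2 ℕ.^ (d ℕ.+ d) ℕ.* 2 ℕ.^ 2            ≡⟨ ℕₚ.^-distribˡ-+-* 2 (d ℕ.+ d) 2 ⟨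
    2 ℕ.^ (d ℕ.+ d ℕ.+ 2)                  ≡⟨ e ⟩
    suc N                                  ∎

_↑_ : Code → ℕ → Code
c ↑ zero = unit
c ↑ suc e = c ⊗ (c ↑ e)

nth : ∀ c {e n} → Codes (c ↑ e) n → Fin e → Codes c n
nth c {suc e} (κ , κs) Fin.zero = κ
nth c {suc e} (κ , κs) (Fin.suc j) = nth c κs j

choose : ∀ c {e n} → (Fin e → Codes c n) → Codes (c ↑ e) n
choose c {zero} f = tt
choose c {suc e} f = f Fin.zero , choose c (λ j → f (Fin.suc j))

nth-choose : ∀ c {e n} (f : Fin e → Codes c n) j → nth c {e} (choose c f) j ≡ f j
nth-choose c f Fin.zero = refl
nth-choose c f (Fin.suc j) = nth-choose c (λ j → f (Fin.suc j)) j

funToFin-cong : ∀ {m n} {f g : Fin m → Fin n} → (∀ i → f i ≡ g i) → funToFin f ≡ funToFin g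
funToFin-cong {zero} e = refl
funToFin-cong {suc m} e = cong₂ combine (e Fin.zero) (funToFin-cong (λ i → e (Fin.suc i)))

bit : Fin 2 → Bool
bit Fin.zero = false
bit (Fin.suc _) = true

bit-injective : ∀ {a b} → bit a ≡ bit b → a ≡ b
bit-injective {Fin.zero} {Fin.zero} _ = refl
bit-injective {Fin.suc Fin.zero} {Fin.suc Fin.zero} _ = refl

no-polynomial-shattering : ∀ c → ¬ (∀ n → Σ ((Fin n → Bool) → Codes c n) λ code →
                             ∀ I J → code I ≡ code J → ∀ i → I i ≡ J i)
no-polynomial-shattering c shatter with power<exponential (degree c 0)
... | N , bound with proj₁ (shatter N) | proj₂ (shatter N)
...   | code | inj with Finₚ.pigeonhole size<2^N (λ k → encode c (code (subset k)))
  where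
  subset : Fin (2 ℕ.^ N) → Fin N → Bool
  subset k i = bit (finToFun {2} {N} k i)
  size<2^N : size c N ℕ.< 2 ℕ.^ N
  size<2^N = ℕₚ.≤-<-trans (size≤ c N)
    (subst (λ d → suc N ℕ.^ d ℕ.< 2 ℕ.^ N) (degree-const c 0 N) bound)
...     | k , l , k<l , e = Finₚ.<-irrefl k≡l k<l
  where
  k≡l : k ≡ l
  -- Equal codes only give pointwise equal subsets; `funToFin` turns this into equality of their
  -- numbers.
  k≡l = trans (sym (Finₚ.funToFin-finToFin {N} {2} k)) (trans
    (funToFin-cong (λ i → bit-injective (inj _ _ (encode-injective c e) i)))
    (Finₚ.funToFin-finToFin {N} {2} l))

-- The dependence of a term on the index of a row.

module Coding {ℓ} (M : T0Model ℓ) where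

  open Evaluation M public

  maximal : ∀ {n p} {P : Fin n → Set p} (P? : ∀ i → Dec (P i)) (key : Fin n → Γ∞) →
            (∀ i → ¬ P i) ⊎ ∃ λ j → P j × (∀ i → P i → key i ≤∞ key j)
  maximal {zero} P? key = inj₁ λ ()
  maximal {suc n} {P = P} P? key with P? Fin.zero | maximal (λ i → P? (Fin.suc i)) (λ i → key (Fin.suc i))
  ... | no n₀ | inj₁ ns = inj₁ λ { Fin.zero → n₀ ; (Fin.suc i) → ns i }
  ... | no n₀ | inj₂ (j , pj , m) = inj₂ (Fin.suc j , pj ,
          λ { Fin.zero p → ⊥-elim (n₀ p) ; (Fin.suc i) → m i })
  ... | yes p₀ | inj₁ ns = inj₂ (Fin.zero , p₀ ,
          λ { Fin.zero _ → inj₂ refl ; (Fin.suc i) p → ⊥-elim (ns i p) })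
  ... | yes p₀ | inj₂ (j , pj , m) with O∞._<⊎≥_ (key Fin.zero) (key (Fin.suc j))
  ...   | inj₁ lt = inj₂ (Fin.suc j , pj , λ { Fin.zero _ → inj₁ lt ; (Fin.suc i) → m i })
  ...   | inj₂ ge = inj₂ (Fin.zero , p₀ ,
            λ { Fin.zero _ → inj₂ refl ; (Fin.suc i) p → O∞.≤-trans (m i p) ge })

  just≢nothing : ∀ {x : Γ} → just x ≢ nothing
  just≢nothing ()

  finite? : ∀ (x : Γ∞) → Dec (x ≢ nothing)
  finite? nothing = no λ n → n refl
  finite? (just x) = yes just≢nothing

  ¬finite : ∀ (x : Γ∞) → ¬ (x ≢ nothing) → x ≡ nothing
  ¬finite nothing _ = refl
  ¬finite (just x) n = ⊥-elim (n just≢nothing)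

  add∞-assoc : ∀ x y z → add∞ (add∞ x y) z ≡ add∞ x (add∞ y z)
  add∞-assoc (just x) (just y) (just z) = cong just (+-assoc x y z)
  add∞-assoc (just x) (just y) nothing = refl
  add∞-assoc (just x) nothing z = refl
  add∞-assoc nothing y z = refl

  add∞-comm : ∀ x y → add∞ x y ≡ add∞ y x
  add∞-comm (just x) (just y) = cong just (+-comm x y)
  add∞-comm (just x) nothing = refl
  add∞-comm nothing (just y) = refl
  add∞-comm nothing nothing = refl

  add∞-identityˡ : ∀ x → add∞ (just 0#) x ≡ x
  add∞-identityˡ (just x) = cong just (+-identityˡ x)
  add∞-identityˡ nothing = refl

  add∞-identityʳ : ∀ x → add∞ x (just 0#) ≡ x
  add∞-identityʳ x = trans (add∞-comm x _) (add∞-identityˡ x)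

  add∞-∞ : ∀ x → add∞ x nothing ≡ nothing
  add∞-∞ x = add∞-comm x nothing

  add∞-interchange : ∀ a b c d → add∞ (add∞ a b) (add∞ c d) ≡ add∞ (add∞ a c) (add∞ b d)
  add∞-interchange a b c d = begin
    add∞ (add∞ a b) (add∞ c d) ≡⟨ add∞-assoc a b (add∞ c d) ⟩
    add∞ a (add∞ b (add∞ c d)) ≡⟨ cong (add∞ a) (add∞-assoc b c d) ⟨
    add∞ a (add∞ (add∞ b c) d) ≡⟨ cong (λ z → add∞ a (add∞ z d)) (add∞-comm b c) ⟩
    add∞ a (add∞ (add∞ c b) d) ≡⟨ cong (add∞ a) (add∞-assoc c b d) ⟩
    add∞ a (add∞ c (add∞ b d)) ≡⟨ add∞-assoc a c (add∞ b d) ⟨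
    add∞ (add∞ a c) (add∞ b d) ∎
    where open ≡-Reasoning

  ·∞-distrib : ∀ q x y → q ·∞ add∞ x y ≡ add∞ (q ·∞ x) (q ·∞ y)
  ·∞-distrib q (just x) (just y) = cong just (·-distrib q x y)
  ·∞-distrib q (just x) nothing = refl
  ·∞-distrib q nothing y = refl

  -- If f X is not larger than f Y, then it is determined by f Y and v (Y − X)
  -- as for the function v (· − c).
  record Ultrametric (f : Γ∞ → Γ∞) : Set ℓ where
    field
      f-∞  : f nothing ≡ nothing
      f-lt : ∀ a b → f (just a) ≤∞ f (just b) → v (b - a) <∞ f (just b) → f (just a) ≡ v (b - a)
      f-ge : ∀ a b → f (just a) ≤∞ f (just b) → f (just b) ≤∞ v (b - a) → f (just a) ≡ f (just b)

  v-ultrametric : Ultrametric v∞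
  v-ultrametric = record
    { f-∞ = refl
    ; f-lt = λ a b _ p → trans (cong v (eq a b)) (trans (v-<ʳ b (- (b - a)) (subst (_<∞ v b) (sym (v-neg (b - a))) p)) (v-neg (b - a)))
    ; f-ge = λ a b p q → O∞.≤-antisym p
        (subst (λ z → v b ≤∞ v z) (sym (eq a b)) (v-ultra- b (b - a) (inj₂ refl) q))
    }
    where
    eq : ∀ a b → a ≡ b - (b - a)
    eq = solve 2 (λ a b → a ≗ᵍ (b ⊹ ⊟ (b ⊹ ⊟ a))) refl

  -- The case of the center λ, since `s a` is `v (a - λ)`.
  s-ultrametric : Ultrametric s∞
  s-ultrametric = record
    { f-∞ = refl
    ; f-lt = λ a b _ p → trans (sym (v-minus-<s a b (subst (_<∞ just (s b)) (v-minus-comm b a) p))) (v-minus-comm a b)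
    ; f-ge = ge
    }
    where
    ge : ∀ a b → just (s a) ≤∞ just (s b) → just (s b) ≤∞ v (b - a) → just (s a) ≡ just (s b)
    ge a b (inj₂ e) _ = e
    ge a b (inj₁ p) q = ⊥-elim (O∞.≤⇒≯ q (subst (_<∞ just (s b)) (sym (trans (v-minus-comm b a) (s-< a b p))) p))

  -- For fixed Y and varying X, the values f (X + Y i) depend on a code and one
  -- unknown w.
  OnePiece : (Γ∞ → Γ∞) → Set ℓ
  OnePiece f = Σ Code λ c → ∀ {n} (Y : Fin n → Γ∞) → Σ (Codes c n → Fin n → Maybe Γ∞) λ shape →
    ∀ X → ∃ λ κ → ∃ λ w → ∀ i → f (add∞ X (Y i)) ≡ fromMaybe w (shape κ i)

  -- The code consists of the index `j` at which `f (X + Y j)` is largest, with value `w`, and the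
  -- index `c` at which `D j c` is largest among the distances below `w`. For finite `Y i`,
  -- `D j i < w` then means `D j i ≤ D j c`, so an index replaces the unknown threshold `w`: on one
  -- side of it the value is `D j i`, on the other it is `w`.
  ultrametric-OnePiece : ∀ {f} → Ultrametric f → OnePiece f
  ultrametric-OnePiece {f} U = pick ⊗ pick , λ {n} Y → shape Y , code Y
    where
    open Ultrametric U
    module _ {n} (Y : Fin n → Γ∞) where

      D : Fin n → Fin n → Γ∞
      D j i = v∞ (Y j -∞ Y i)

      far : Fin n → Fin n → Fin n → Γ∞ → Maybe Γ∞
      far j c i nothing = just nothing
      far j c i (just y) with O∞._<⊎≥_ (D j c) (D j i)
      ... | inj₁ _ = nothing
      ... | inj₂ _ = just (D j i)

      finite : Γ∞ → Maybe Γ∞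
      finite nothing = just nothing
      finite (just y) = nothing

      shape : Codes (pick ⊗ pick) n → Fin n → Maybe Γ∞
      shape (nothing , _) i = just nothing
      shape (just j , nothing) i = finite (Y i)
      shape (just j , just c) i = far j c i (Y i)

      code : ∀ X → ∃ λ κ → ∃ λ w → ∀ i → f (add∞ X (Y i)) ≡ fromMaybe w (shape κ i)
      code nothing = (nothing , nothing) , nothing , λ i → f-∞
      code (just x) with maximal (λ i → finite? (Y i)) (λ i → f (add∞ (just x) (Y i)))
      ... | inj₁ none = (nothing , nothing) , nothing , λ i →
            trans (cong (λ y → f (add∞ (just x) y)) (¬finite (Y i) (none i))) f-∞
      ... | inj₂ (j , j-finite , j-max) with Y j in eⱼ
      ...   | nothing = ⊥-elim (j-finite refl)
      ...   | just yⱼ = cut (maximal {P = λ i → Y i ≢ nothing × D j i <∞ w}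
                (λ i → finite? (Y i) ×-dec lt? (D j i)) (D j))
        where
        w : Γ∞
        w = f (just (x + yⱼ))

        lt? : ∀ d → Dec (d <∞ w)
        lt? d with O∞._<⊎≥_ d w
        ... | inj₁ p = yes p
        ... | inj₂ p = no (O∞.≤⇒≯ p)

        D-just : ∀ {i y} → Y i ≡ just y → D j i ≡ v ((x + yⱼ) - (x + y))
        D-just {i} {y} e rewrite eⱼ | e = trans (cong v∞ (just-minus yⱼ y))
          (cong v (solve 3 (λ a b c → (a ⊹ ⊟ b) ≗ᵍ ((c ⊹ a) ⊹ ⊟ (c ⊹ b))) refl yⱼ y x))

        below : ∀ {i y} → Y i ≡ just y → f (just (x + y)) ≤∞ w
        below {i} e = subst (λ z → f (add∞ (just x) z) ≤∞ w) e
          (j-max i λ e′ → just≢nothing (trans (sym e) e′))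

        small : ∀ {i y} → Y i ≡ just y → D j i <∞ w → f (just (x + y)) ≡ D j i
        small {i} {y} e p = trans (f-lt _ _ (below e) (subst (_<∞ w) (D-just e) p)) (sym (D-just e))

        large : ∀ {i y} → Y i ≡ just y → w ≤∞ D j i → f (just (x + y)) ≡ w
        large {i} {y} e p = f-ge _ _ (below e) (subst (w ≤∞_) (D-just e) p)

        cut : ((∀ i → ¬ (Y i ≢ nothing × D j i <∞ w)) ⊎ ∃ λ c → (Y c ≢ nothing × D j c <∞ w) ×
                 (∀ i → Y i ≢ nothing × D j i <∞ w → D j i ≤∞ D j c)) →
              ∃ λ κ → ∃ λ w → ∀ i → f (add∞ (just x) (Y i)) ≡ fromMaybe w (shape κ i)
        cut (inj₁ none) = (just j , nothing) , w , λ i → lemma i (Y i) refl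
          where
          lemma : ∀ i y → Y i ≡ y → f (add∞ (just x) y) ≡ fromMaybe w (finite y)
          lemma i nothing e = f-∞
          lemma i (just y) e = large e (O∞.≮⇒≥ λ p → none i ((λ e′ → just≢nothing (trans (sym e) e′)) , p))
        cut (inj₂ (c , (c-finite , Dc<w) , c-max)) = (just j , just c) , w , λ i → lemma i (Y i) refl
          where
          lemma : ∀ i y → Y i ≡ y → f (add∞ (just x) y) ≡ fromMaybe w (far j c i y)
          lemma i nothing e = f-∞
          lemma i (just y) e with O∞._<⊎≥_ (D j c) (D j i)
          ... | inj₂ p = small e (O∞.≤-<-trans p Dc<w)
          ... | inj₁ p = large e (O∞.≮⇒≥ λ q → O∞.≤⇒≯ (c-max i ((λ e′ → just≢nothing (trans (sym e) e′)) , q)) p)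

  OnePiece-∘ : ∀ {f} (h : Γ∞ → Γ∞) → OnePiece f → OnePiece (λ x → h (f x))
  OnePiece-∘ {f} h (c , P) = c , λ Y →
    (λ κ i → Maybe.map h (proj₁ (P Y) κ i)) , λ X →
      let κ , w , e = proj₂ (P Y) X in κ , h w , λ i → trans (cong h (e i)) (map-fromMaybe (proj₁ (P Y) κ i) w)
    where
    map-fromMaybe : ∀ (m : Maybe Γ∞) w → h (fromMaybe w m) ≡ fromMaybe (h w) (Maybe.map h m)
    map-fromMaybe nothing w = refl
    map-fromMaybe (just _) w = refl

  SignCode : Code
  SignCode = pick ⊗ (pick ⊗ pick)

  module _ {n} (Y : Fin n → Γ∞) where

    negative? : ∀ (m : Maybe (Fin n)) i → Dec (∃ λ j → m ≡ just j × Y i ≤∞ Y j)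
    negative? nothing i = no λ ()
    negative? (just j) i with O∞._<⊎≥_ (Y j) (Y i)
    ... | inj₁ p = no λ { (_ , refl , q) → O∞.≤⇒≯ q p }
    ... | inj₂ p = yes (j , refl , p)

    zero? : ∀ (m : Maybe (Fin n)) i → Dec (∃ λ j → m ≡ just j × Y i ≡ Y j)
    zero? nothing i = no λ ()
    zero? (just j) i with Y i O∞.≟ Y j
    ... | yes e = yes (j , refl , e)
    ... | no e = no λ { (_ , refl , e′) → e e′ }

    -- Used where the sign is neither negative nor zero. A positive entry shows that `X` is finite,
    -- so that `Y i` alone separates positive from ∞; without such an entry everything left is ∞.
    otherwise : Maybe (Fin n) → Γ∞ → Sign
    otherwise (just _) (just _) = pos
    otherwise (just _) nothing = inf
    otherwise nothing _ = inf

    signShape : Codes SignCode n → Fin n → Sign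
    signShape (a , z , b) i with negative? a i
    ... | yes _ = neg
    ... | no _ with zero? z i
    ...   | yes _ = zer
    ...   | no _ = otherwise b (Y i)

  sgn-below : ∀ X {y y′} → y ≤∞ y′ → sgn (add∞ X y′) ≡ neg → sgn (add∞ X y) ≡ neg
  sgn-below (just x) {just y} {just y′} p e with sign-view {x + y′} e
  ... | is-neg q = sign-neg (O.≤-<-trans (+-monoʳ-≤ x (≤-just p)) q)
  sgn-below (just x) {just y} {nothing} p ()
  sgn-below (just x) {nothing} {just y′} (inj₁ ()) e
  sgn-below (just x) {nothing} {nothing} p ()

  sgn-zero-unique : ∀ X {y y′} → sgn (add∞ X y) ≡ zer → sgn (add∞ X y′) ≡ zer → y ≡ y′
  sgn-zero-unique (just x) {just y} {just y′} e e′ with sign-view {x + y} e | sign-view {x + y′} e′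
  ... | is-zer p | is-zer q = cong just (+-cancelˡ x (trans p (sym q)))

  _≟ˢ_ : ∀ (σ τ : Sign) → Dec (σ ≡ τ)
  neg ≟ˢ neg = yes refl
  neg ≟ˢ zer = no λ ()
  neg ≟ˢ pos = no λ ()
  neg ≟ˢ inf = no λ ()
  zer ≟ˢ neg = no λ ()
  zer ≟ˢ zer = yes refl
  zer ≟ˢ pos = no λ ()
  zer ≟ˢ inf = no λ ()
  pos ≟ˢ neg = no λ ()
  pos ≟ˢ zer = no λ ()
  pos ≟ˢ pos = yes refl
  pos ≟ˢ inf = no λ ()
  inf ≟ˢ neg = no λ ()
  inf ≟ˢ zer = no λ ()
  inf ≟ˢ pos = no λ ()
  inf ≟ˢ inf = yes refl

  -- The code consists of the indices of the largest Y i for which X + Y i is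
  -- negative, zero and positive.
  signShape-code : ∀ {n} (Y : Fin n → Γ∞) X → ∃ λ κ → ∀ i → sgn (add∞ X (Y i)) ≡ signShape Y κ i
  signShape-code {n} Y X = (index (top neg) , index (top zer) , index (top pos)) ,
      correct (top neg) (top zer) (top pos)
    where
    Has : Sign → Fin n → Set
    Has σ i = sgn (add∞ X (Y i)) ≡ σ

    Top : Sign → Set ℓ
    Top σ = (∀ i → ¬ Has σ i) ⊎ ∃ λ j → Has σ j × (∀ i → Has σ i → Y i ≤∞ Y j)

    top : ∀ σ → Top σ
    top σ = maximal (λ i → sgn (add∞ X (Y i)) ≟ˢ σ) Y

    index : ∀ {σ} → Top σ → Maybe (Fin n)
    index (inj₁ _) = nothing
    index (inj₂ (j , _)) = just j

    index-has : ∀ {σ} (t : Top σ) {j} → index t ≡ just j → Has σ j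
    index-has (inj₂ (j , h , _)) refl = h

    found : ∀ {σ} (t : Top σ) {i} → Has σ i → ∃ λ j → index t ≡ just j × Has σ j × Y i ≤∞ Y j
    found (inj₁ none) {i} h = ⊥-elim (none i h)
    found (inj₂ (j , hj , m)) {i} h = j , refl , hj , m i h

    rest : ∀ (t : Top pos) {i} y → Y i ≡ y → ¬ Has neg i → ¬ Has zer i →
           sgn (add∞ X y) ≡ otherwise Y (index t) y
    rest (inj₁ _) nothing e _ _ = cong sgn (add∞-∞ X)
    rest (inj₂ _) nothing e _ _ = cong sgn (add∞-∞ X)
    rest t {i} (just y) refl′ n z = go X refl (sgn (add∞ X (just y))) refl t
      where
      go : ∀ X′ → X′ ≡ X → ∀ σ → sgn (add∞ X (just y)) ≡ σ → (t : Top pos) → σ ≡ otherwise Y (index t) (just y)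
      go X′ _ neg e _ = ⊥-elim (n (trans (cong (λ z → sgn (add∞ X z)) refl′) e))
      go X′ _ zer e _ = ⊥-elim (z (trans (cong (λ z → sgn (add∞ X z)) refl′) e))
      go X′ _ pos e (inj₂ _) = refl
      go X′ _ pos e (inj₁ none) = ⊥-elim (none i (trans (cong (λ z → sgn (add∞ X z)) refl′) e))
      go (just x) refl inf e _ = ⊥-elim (sign≢inf e)
      go nothing _ inf e (inj₁ _) = refl
      go nothing refl inf e (inj₂ (j , () , _))

    correct : (a : Top neg) (z : Top zer) (p : Top pos) →
              ∀ i → sgn (add∞ X (Y i)) ≡ signShape Y (index a , index z , index p) i
    correct a z p i with negative? Y (index a) i
    ... | yes (j , e , q) = sgn-below X q (index-has a e)
    ... | no ¬neg with zero? Y (index z) i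
    ...   | yes (j , e , q) = trans (cong (λ y → sgn (add∞ X y)) q) (index-has z e)
    ...   | no ¬zer = rest p (Y i) refl
      (λ h → let j , e , _ , q = found a h in ¬neg (j , e , q))
      (λ h → let j , e , hj , _ = found z h in ¬zer (j , e , sgn-zero-unique X h hj))

  -- `X + y` vanishes for at most one `y`, so an index carrying this `y` is enough of a code; both
  -- possible values are known constants.
  χ-OnePiece : OnePiece χ∞
  χ-OnePiece = pick , λ Y → shape Y , code Y
    where
    module _ {n} (Y : Fin n → Γ∞) where
      shape : Maybe (Fin n) → Fin n → Maybe Γ∞
      shape m i with zero? Y m i
      ... | yes _ = just (just 0#)
      ... | no _ = just nothing

      χ∞-sgn : ∀ x → (sgn x ≡ zer → χ∞ x ≡ just 0#) × (sgn x ≢ zer → χ∞ x ≡ nothing)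
      χ∞-sgn nothing = (λ ()) , λ _ → χ∞-∞
      χ∞-sgn (just x) with x O.≟ 0#
      ... | yes e = (λ _ → χ∞-0 e) , λ n → ⊥-elim (n (sign-zer e))
      ... | no n = (λ e → χ∞-0 (zer⇒0 e)) , λ _ → χ∞-≢0 n
        where
        zer⇒0 : ∀ {x} → sign x ≡ zer → x ≡ 0#
        zer⇒0 {x} e with sign-view {x} e
        ... | is-zer p = p

      code : ∀ X → ∃ λ κ → ∃ λ w → ∀ i → χ∞ (add∞ X (Y i)) ≡ fromMaybe w (shape κ i)
      code X with maximal (λ i → sgn (add∞ X (Y i)) ≟ˢ zer) Y
      ... | inj₁ none = nothing , nothing , λ i → proj₂ (χ∞-sgn _) (none i)
      ... | inj₂ (j , hj , _) = just j , nothing , correct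
        where
        correct : ∀ i → χ∞ (add∞ X (Y i)) ≡ fromMaybe nothing (shape (just j) i)
        correct i with zero? Y (just j) i
        ... | yes (_ , refl , e) = proj₁ (χ∞-sgn _) (trans (cong (λ y → sgn (add∞ X y)) e) hj)
        ... | no n = proj₂ (χ∞-sgn _) λ h → n (j , refl , sgn-zero-unique X h hj)

  op-OnePiece : ∀ o → OnePiece ⟦ o ⟧
  op-OnePiece ψᵒ = ultrametric-OnePiece v-ultrametric
  op-OnePiece χᵒ = χ-OnePiece
  op-OnePiece (sᵒ g) = OnePiece-∘ {s∞} (preds g) (ultrametric-OnePiece s-ultrametric)

  -- As a function of the row i, a term is a sum of an unknown depending only
  -- on the piece of i, and a value determined by the code.
  Coded : ∀ {A B} → Tm (A ⊎ B) → Set ℓ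
  Coded {A} {B} t = Σ Code λ c → Σ ℕ λ e → ∀ {n} (row : Fin n → Env A) →
    Σ (Codes c n → Fin n → Fin e × Γ∞) λ shape →
    ∀ (β : Env B) → ∃ λ κ → ∃ λ (X : Fin e → Γ∞) →
    ∀ i → eval t [ row i , β ]′ ≡ add∞ (X (proj₁ (shape κ i))) (proj₂ (shape κ i))

  -- The number of pieces grows with the term but not with `n`: a sum takes pairs of pieces, and an
  -- operation separates, in each piece, the indices with a known value from those sharing one
  -- unknown.
  coded : ∀ {A B} (t : Tm (A ⊎ B)) → Coded t
  coded (var (inj₁ a)) = unit , 1 , λ row → (λ _ i → Fin.zero , row i a) ,
    λ β → tt , (λ _ → just 0#) , λ i → sym (add∞-identityˡ _)
  coded (var (inj₂ b)) = unit , 1 , λ row → (λ _ i → Fin.zero , just 0#) ,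
    λ β → tt , (λ _ → β b) , λ i → sym (add∞-identityʳ _)
  coded 0ᵗ = unit , 1 , λ row → (λ _ i → Fin.zero , just 0#) ,
    λ β → tt , (λ _ → just 0#) , λ i → sym (add∞-identityʳ _)
  coded ∞ᵗ = unit , 1 , λ row → (λ _ i → Fin.zero , just 0#) ,
    λ β → tt , (λ _ → nothing) , λ i → refl
  coded (t ⊕ u) with coded t | coded u
  ... | c , e , T | d , f , U = c ⊗ d , e ℕ.* f , λ row →
    (λ (κ , μ) i → let j , y = proj₁ (T row) κ i ; k , z = proj₁ (U row) μ i in combine j k , add∞ y z) ,
    λ β → let κ , X , p = proj₂ (T row) β ; μ , Z , q = proj₂ (U row) β in
      (κ , μ) ,
      (λ l → let j , k = remQuot {e} f l in add∞ (X j) (Z k)) ,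
      λ i → let j , y = proj₁ (T row) κ i ; k , z = proj₁ (U row) μ i in
        trans (cong₂ add∞ (p i) (q i)) (trans (add∞-interchange (X j) y (Z k) z)
          (cong (λ (j , k) → add∞ (add∞ (X j) (Z k)) (add∞ y z)) (sym (Finₚ.remQuot-combine j k))))
  coded (q ⊙ t) with coded t
  ... | c , e , T = c , e , λ row →
    (λ κ i → let j , y = proj₁ (T row) κ i in j , q ·∞ y) ,
    λ β → let κ , X , p = proj₂ (T row) β in κ , (λ j → q ·∞ X j) ,
      λ i → trans (cong (q ·∞_) (p i)) (·∞-distrib q _ _)
  coded {A} {B} (op o t) with coded t | op-OnePiece o
  ... | c , e , T | d , P = c ⊗ (d ↑ e) , suc e , λ row → shape row , correct row
    where
    module _ {n} (row : Fin n → Env A) where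
      Y : Codes c n → Fin n → Γ∞
      Y κ i = proj₂ (proj₁ (T row) κ i)

      -- All indices with a known value are gathered in piece 0, whose unknown is 0; the others of
      -- the old piece `j` form the new piece `suc j`.
      place : Fin e → Maybe Γ∞ → Fin (suc e) × Γ∞
      place j nothing = Fin.suc j , just 0#
      place j (just y) = Fin.zero , y

      shape : Codes (c ⊗ (d ↑ e)) n → Fin n → Fin (suc e) × Γ∞
      -- For each piece `j` there is a code concerning all indices, but it is consulted only at the
      -- indices in that piece.
      shape (κ , μ) i = place j (proj₁ (P (Y κ)) (nth d μ j) i)
        where j = proj₁ (proj₁ (T row) κ i)

      correct : ∀ (β : Env B) → ∃ λ κ → ∃ λ (X : Fin (suc e) → Γ∞) →
        ∀ i → ⟦ o ⟧ (eval t [ row i , β ]′) ≡ add∞ (X (proj₁ (shape κ i))) (proj₂ (shape κ i))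
      correct β with proj₂ (T row) β
      ... | κ , X , p = (κ , choose d μ) , W , λ i → trans (cong ⟦ o ⟧ (p i)) (at i)
        where
        μ : Fin e → Codes d n
        μ j = proj₁ (proj₂ (P (Y κ)) (X j))
        W : Fin (suc e) → Γ∞
        W Fin.zero = just 0#
        W (Fin.suc j) = proj₁ (proj₂ (proj₂ (P (Y κ)) (X j)))
        place-correct : ∀ j m → fromMaybe (W (Fin.suc j)) m ≡ add∞ (W (proj₁ (place j m))) (proj₂ (place j m))
        place-correct j nothing = sym (add∞-identityʳ _)
        place-correct j (just y) = sym (add∞-identityˡ y)
        at : ∀ i → ⟦ o ⟧ (add∞ (X (proj₁ (proj₁ (T row) κ i))) (Y κ i)) ≡
             add∞ (W (proj₁ (shape (κ , choose d μ) i))) (proj₂ (shape (κ , choose d μ) i))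
        at i = trans (proj₂ (proj₂ (proj₂ (P (Y κ)) (X j))) i)
          (subst (λ ν → fromMaybe (W (Fin.suc j)) (proj₁ (P (Y κ)) (μ j) i) ≡
              add∞ (W (proj₁ (place j (proj₁ (P (Y κ)) ν i)))) (proj₂ (place j (proj₁ (P (Y κ)) ν i))))
            (sym (nth-choose d μ j)) (place-correct j (proj₁ (P (Y κ)) (μ j) i)))
          where j = proj₁ (proj₁ (T row) κ i)

  SignCoded : ∀ {A B} → List (Tm (A ⊎ B)) → Set ℓ
  SignCoded {A} {B} T = Σ Code λ c → ∀ {n} (row : Fin n → Env A) → Σ (Env B → Codes c n) λ code →
    ∀ β β′ → code β ≡ code β′ → ∀ i → Agree T [ row i , β ]′ [ row i , β′ ]′

  signCoded : ∀ {A B} (T : List (Tm (A ⊎ B))) → SignCoded T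
  signCoded [] = unit , λ row → (λ _ → tt) , λ β β′ _ i ()
  signCoded {A} {B} (t ∷ T) with coded t | signCoded T
  ... | c , e , P | d , Q = (c ⊗ (SignCode ↑ e)) ⊗ d , λ row → code row , λ β β′ eq i → λ
    { (here refl) → trans (correct row β i) (trans (cong (λ (κ , _) → pattern′ row κ i) eq) (sym (correct row β′ i)))
    ; (there t∈) → proj₂ (Q row) β β′ (cong proj₂ eq) i t∈ }
    where
    module _ {n} (row : Fin n → Env A) where
      Y : Codes c n → Fin n → Γ∞
      Y κ i = proj₂ (proj₁ (P row) κ i)

      signs : Env B → Codes (SignCode ↑ e) n
      signs β = let κ , X , _ = proj₂ (P row) β in choose SignCode (λ j → proj₁ (signShape-code (Y κ) (X j)))

      code : Env B → Codes ((c ⊗ (SignCode ↑ e)) ⊗ d) n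
      code β = (proj₁ (proj₂ (P row) β) , signs β) , proj₁ (Q row) β

      pattern′ : Codes (c ⊗ (SignCode ↑ e)) n → Fin n → Sign
      pattern′ (κ , μ) i = signShape (Y κ) (nth SignCode μ (proj₁ (proj₁ (P row) κ i))) i

      correct : ∀ β i → sgn (eval t [ row i , β ]′) ≡ pattern′ (proj₁ (code β)) i
      correct β i with proj₂ (P row) β
      ... | κ , X , p = trans (cong sgn (p i)) (trans (proj₂ (signShape-code (Y κ) (X j)) i)
        (cong (λ μ → signShape (Y κ) μ i) (sym (nth-choose SignCode _ j))))
        where j = proj₁ (proj₁ (P row) κ i)

  module _ (elim : Elim ⊤ (λ _ → ⊤ₚ.⊤)) where
    open Determined elim

    extendSubset : ∀ {n} → (Fin n → Bool) → ℕ → Bool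
    extendSubset {n} I i with i ℕ.<? n
    ... | yes p = I (Fin.fromℕ< p)
    ... | no _ = false

    extendSubset-toℕ : ∀ {n} (I : Fin n → Bool) i → extendSubset I (Fin.toℕ i) ≡ I i
    extendSubset-toℕ {n} I i with Fin.toℕ i ℕ.<? n
    ... | yes p = cong I (Finₚ.fromℕ<-toℕ i p)
    ... | no ¬p = ⊥-elim (¬p (Finₚ.toℕ<n i))

    -- The parameters `c` are kept with the columns. Equal codes for `I` and `J` give equal signs,
    -- in the first `n` rows, of the terms that determine `φ`, so `I` and `J` coincide there.
    no-IP : ∀ {L k m q} (o : Ops L M) (φ : Formula L (k ℕ.+ (m ℕ.+ q))) (c : Vector Γ∞ q) →
            ¬ Sem.HasIP {L} {k} {m} {q} o φ c
    no-IP {k = k} {m} {q} o φ c (a , b , ip) with determined o φ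
    ... | T , det with signCoded (map (ren (Fin.splitAt k)) T)
    ...   | C , code = no-polynomial-shattering C λ n → codeOf n , distinguishes n
      where
      row : ∀ n → Fin n → Env (Fin k)
      row n i = a (Fin.toℕ i)

      col : ∀ n → (Fin n → Bool) → Env (Fin (m ℕ.+ q))
      col n I = b (extendSubset I) Vector.++ c

      codeOf : ∀ n → (Fin n → Bool) → Codes C n
      codeOf n I = proj₁ (code (row n)) (col n I)

      transfer : ∀ n I J → codeOf n I ≡ codeOf n J → ∀ i →
                 Sem.Sat o (row n i Vector.++ col n I) φ → Sem.Sat o (row n i Vector.++ col n J) φ
      transfer n I J e i = det λ {t} t∈ → trans (cong sgn (sym (at I t)))
        (trans (proj₂ (code (row n)) (col n I) (col n J) e i (∈-map⁺ (ren (Fin.splitAt k)) t∈))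
          (cong sgn (at J t)))
        where
        at : ∀ I t → eval (ren (Fin.splitAt k) t) [ row n i , col n I ]′ ≡ eval t (row n i Vector.++ col n I)
        at I t = eval-sub _ t _

      implies : ∀ n I J → codeOf n I ≡ codeOf n J → ∀ i → I i ≡ true → J i ≡ true
      implies n I J e i p = trans (sym (extendSubset-toℕ J i))
        (Equivalence.to (ip (Fin.toℕ i) (extendSubset J))
          (transfer n I J e i (Equivalence.from (ip (Fin.toℕ i) (extendSubset I))
            (trans (extendSubset-toℕ I i) p))))

      distinguishes : ∀ n I J → codeOf n I ≡ codeOf n J → ∀ i → I i ≡ J i
      distinguishes n I J e i with I i in p | J i in q
      ... | true  | true  = refl
      ... | false | false = refl
      ... | true  | false = trans (sym (implies n I J e i p)) q
      ... | false | true  = trans (sym p) (implies n J I (sym e) i q)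

-- Elimination of a variable ranging over Ψ

module PsiElimination {ℓ} (M : T0Model ℓ) where

  open Coding M public

  ∈-concatMap : ∀ {A B : Set} (f : A → List B) {xs x y} → x ∈ xs → y ∈ f x → y ∈ concatMap f xs
  ∈-concatMap f x∈ y∈ = ∈-concatMap⁺ f (Any.map (λ { refl → y∈ }) x∈)

  ∈-skip : ∀ {A : Set} {x y z : A} {xs} → x ∈ y ∷ xs → x ∈ y ∷ z ∷ xs
  ∈-skip (here p) = here p
  ∈-skip (there p) = there (there p)

  ≤-<∞ : ∀ {x y} z → x ≤ y → just y <∞ z → just x <∞ z
  ≤-<∞ z p q = O∞.≤-<-trans {z = z} (just-≤ p) q

  sⁿ : ℕ → Γ → Γ
  sⁿ zero b = b
  sⁿ (suc n) b = sⁿ n (s b)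

  sⁿ-+ : ∀ m n b → sⁿ (m ℕ.+ n) b ≡ sⁿ n (sⁿ m b)
  sⁿ-+ zero n b = refl
  sⁿ-+ (suc m) n b = sⁿ-+ m n (s b)

  sⁿ-suc : ∀ n b → sⁿ (suc n) b ≡ s (sⁿ n b)
  sⁿ-suc n b = trans (cong (λ k → sⁿ k b) (sym (ℕₚ.+-comm n 1))) (sⁿ-+ n 1 b)

  sⁿ∈Ψ : ∀ n {b} → InΨ b → InΨ (sⁿ n b)
  sⁿ∈Ψ zero b∈ = b∈
  sⁿ∈Ψ (suc n) b∈ = sⁿ∈Ψ n (s∈Ψ _)

  ≤-sⁿ : ∀ n {b} → InΨ b → b ≤ sⁿ n b
  ≤-sⁿ zero b∈ = inj₂ refl
  ≤-sⁿ (suc n) b∈ = O.≤-trans (inj₁ (α<sα _ b∈)) (≤-sⁿ n (s∈Ψ _))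

  sⁿ-monoˡ : ∀ {m n b} → InΨ b → m ℕ.≤ n → sⁿ m b ≤ sⁿ n b
  sⁿ-monoˡ {n = n} b∈ z≤n = ≤-sⁿ n b∈
  sⁿ-monoˡ b∈ (s≤s p) = sⁿ-monoˡ (s∈Ψ _) p

  s-mono : ∀ {u w} → InΨ u → InΨ w → u ≤ w → s u ≤ s w
  s-mono u∈ w∈ (inj₂ refl) = inj₂ refl
  s-mono u∈ w∈ (inj₁ p) = O.≤-trans (sα-imm _ _ u∈ w∈ p) (inj₁ (α<sα _ w∈))

  sⁿ-mono : ∀ n {u w} → InΨ u → InΨ w → u ≤ w → sⁿ n u ≤ sⁿ n w
  sⁿ-mono zero u∈ w∈ p = p
  sⁿ-mono (suc n) u∈ w∈ p = sⁿ-mono n (s∈Ψ _) (s∈Ψ _) (s-mono u∈ w∈ p)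

  preds-sⁿ : ∀ g j {b} → InΨ b → preds g (just (sⁿ (g ℕ.+ j) b)) ≡ just (sⁿ j b)
  preds-sⁿ zero j b∈ = refl
  preds-sⁿ (suc g) j {b} b∈ = begin
    pred (preds g (just (sⁿ (suc g ℕ.+ j) b)))   ≡⟨ cong (λ k → pred (preds g (just (sⁿ k b)))) (ℕₚ.+-suc g j) ⟨
    pred (preds g (just (sⁿ (g ℕ.+ suc j) b)))   ≡⟨ cong pred (preds-sⁿ g (suc j) b∈) ⟩
    pred (just (sⁿ (suc j) b))                   ≡⟨ cong (pred ∘ just) (sⁿ-suc j b) ⟩
    pred (just (s (sⁿ j b)))                     ≡⟨ pred-s (sⁿ∈Ψ j b∈) ⟩
    just (sⁿ j b)                                ∎
    where open ≡-Reasoning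

  -- Sums of iterated successors.

  comb : List Scalar → Γ → Γ
  comb [] b = 0#
  comb (r ∷ rs) b = r · b + comb rs (s b)

  total : List Scalar → Scalar
  total [] = 0ˢ
  total (r ∷ rs) = r +ˢ total rs

  local : List Scalar → Γ → Γ → Γ
  local [] b u = 0#
  local (r ∷ rs) b u = r · (b - u) + local rs (s b) u

  -- With a large `u` in the role of λ, this separates a multiple of λ, which does not involve `b`,
  -- from differences between iterates of `b` and `u`, whose valuations are the next iterates.
  comb-local : ∀ rs b u → comb rs b ≡ total rs · u + local rs b u
  comb-local [] b u = sym (trans (cong (_+ 0#) (·-zero 0ˢ u refl)) (+-identityˡ 0#))
  comb-local (r ∷ rs) b u = begin
    r · b + comb rs (s b)
      ≡⟨ cong (r · b +_) (comb-local rs (s b) u) ⟩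
    r · b + (total rs · u + local rs (s b) u)
      ≡⟨ solve 4 (λ x y z t → (x ⊹ (y ⊹ z)) ≗ᵍ ((t ⊹ y) ⊹ ((x ⊹ ⊟ t) ⊹ z))) refl
          (r · b) (total rs · u) (local rs (s b) u) (r · u) ⟩
    (r · u + total rs · u) + ((r · b - r · u) + local rs (s b) u)
      ≡⟨ cong₂ (λ x y → x + (y + local rs (s b) u)) (·-+ r (total rs) u) (·-minus r b u) ⟨
    (r +ˢ total rs) · u + (r · (b - u) + local rs (s b) u) ∎
    where open ≡-Reasoning

  -- The first nonzero coefficient, counted from 1 because the difference of `sⁿ i b` and `u` has
  -- valuation `sⁿ (suc i) b`.
  lead : List Scalar → Maybe ℕ
  lead [] = nothing
  lead (r ∷ rs) with isZero? r
  ... | yes _ = Maybe.map suc (lead rs)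
  ... | no _ = just 1

  lead-bounds : ∀ rs {j} → lead rs ≡ just j → 1 ℕ.≤ j × j ℕ.≤ length rs
  lead-bounds (r ∷ rs) e with isZero? r
  lead-bounds (r ∷ rs) refl | no _ = s≤s z≤n , s≤s z≤n
  lead-bounds (r ∷ rs) e | yes _ with lead rs in e′
  lead-bounds (r ∷ rs) refl | yes _ | just j = s≤s z≤n , s≤s (proj₂ (lead-bounds rs e′))

  comb-none : ∀ rs b → lead rs ≡ nothing → comb rs b ≡ 0#
  comb-none [] b e = refl
  comb-none (r ∷ rs) b e with isZero? r
  ... | yes z with lead rs in e′
  ...   | nothing = trans (cong₂ _+_ (·-zero r b z) (comb-none rs (s b) e′)) (+-identityˡ 0#)

  total-none : ∀ rs u → lead rs ≡ nothing → total rs · u ≡ 0#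
  total-none [] u e = ·-zero 0ˢ u refl
  total-none (r ∷ rs) u e with isZero? r
  ... | yes z with lead rs in e′
  ...   | nothing = trans (·-+ r (total rs) u)
            (trans (cong₂ _+_ (·-zero r u z) (total-none rs u e′)) (+-identityˡ 0#))

  local-none : ∀ rs b u → lead rs ≡ nothing → local rs b u ≡ 0#
  local-none [] b u e = refl
  local-none (r ∷ rs) b u e with isZero? r
  ... | yes z with lead rs in e′
  ...   | nothing = trans (cong₂ _+_ (·-zero r _ z) (local-none rs (s b) u e′)) (+-identityˡ 0#)

  Above : ℕ → Γ → Γ → Set ℓ
  Above n b u = InΨ b × InΨ u × sⁿ n b ≤ u

  above-suc : ∀ n {b u} → Above (suc n) b u → Above n (s b) u
  above-suc n (_ , u∈ , p) = s∈Ψ _ , u∈ , p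

  above-< : ∀ n {b u} → Above (suc n) b u → b < u
  above-< n (b∈ , _ , p) = O.<-≤-trans (α<sα _ b∈) (O.≤-trans (≤-sⁿ n (s∈Ψ _)) p)

  v-head : ∀ n {b u} r → ¬ IsZero r → Above (suc n) b u → v (r · (b - u)) ≡ just (s b)
  v-head n {b} {u} r nz a@(b∈ , u∈ , _) = trans (v-· r _ nz)
    (trans (v-minus-comm b u) (v-Ψ-minus b∈ u∈ (above-< n a)))

  local-skip : ∀ r rs b u → IsZero r → local (r ∷ rs) b u ≡ local rs (s b) u
  local-skip r rs b u z = trans (cong (_+ local rs (s b) u) (·-zero r _ z)) (+-identityˡ _)

  mutual
    -- The valuations of the nonzero summands increase strictly with the position, so the first
    -- nonzero coefficient dominates.
    local-v : ∀ rs {b u j} → lead rs ≡ just j → Above (length rs) b u → v (local rs b u) ≡ just (sⁿ j b)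
    local-v (r ∷ rs) {b} {u} e a with isZero? r
    local-v (r ∷ rs) {b} {u} refl a | no nz = trans (v-<ˡ _ _ (local-dom r rs nz a)) (v-head (length rs) r nz a)
    local-v (r ∷ rs) {b} {u} e a | yes z with lead rs in e′
    local-v (r ∷ rs) {b} {u} refl a | yes z | just j =
      trans (cong v (local-skip r rs b u z)) (local-v rs e′ (above-suc (length rs) a))

    local-dom : ∀ r rs {b u} → ¬ IsZero r → Above (suc (length rs)) b u →
                v (r · (b - u)) <∞ v (local rs (s b) u)
    local-dom r rs {b} {u} nz a = subst (_<∞ v (local rs (s b) u)) (sym (v-head (length rs) r nz a))
      (local-> rs (above-suc (length rs) a))

    local-> : ∀ rs {b u} → Above (length rs) b u → just b <∞ v (local rs b u)
    local-> rs {b} {u} a with lead rs in e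
    ... | nothing = subst (just b <∞_) (sym (v-≡0 (local-none rs b u e))) ⊤ₚ.tt
    ... | just j = subst (just b <∞_) (sym (local-v rs e a))
          (O.<-≤-trans (α<sα b (proj₁ a)) (sⁿ-monoˡ (proj₁ a) (proj₁ (lead-bounds rs e))))

  -- The dominating summand is a fixed nonzero scalar times a negative difference, whatever `b` and
  -- `u` are.
  local-sign : ∀ rs {b u b′ u′ j} → lead rs ≡ just j → Above (length rs) b u → Above (length rs) b′ u′ →
               sign (local rs b u) ≡ sign (local rs b′ u′)
  local-sign (r ∷ rs) {b} {u} {b′} {u′} e a a′ with isZero? r
  local-sign (r ∷ rs) {b} {u} {b′} {u′} e a a′ | no nz = begin
    sign (r · (b - u) + local rs (s b) u)       ≡⟨ sign-dom _ _ (local-dom r rs nz a) ⟩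
    sign (r · (b - u))                          ≡⟨ sign-· r (trans (neg-minus (above-< (length rs) a)) (sym (neg-minus (above-< (length rs) a′)))) ⟩
    sign (r · (b′ - u′))                        ≡⟨ sign-dom _ _ (local-dom r rs nz a′) ⟨
    sign (r · (b′ - u′) + local rs (s b′) u′)   ∎
    where
    open ≡-Reasoning
    neg-minus : ∀ {x y} → x < y → sign (x - y) ≡ neg
    neg-minus {x} {y} p = sign-neg (<-cong refl (+-inverseʳ y) (+-mono-< (- y) p))
  local-sign (r ∷ rs) {b} {u} {b′} {u′} e a a′ | yes z with lead rs in e′
  local-sign (r ∷ rs) {b} {u} {b′} {u′} refl a a′ | yes z | just j =
    trans (cong sign (local-skip r rs b u z)) (trans
      (local-sign rs e′ (above-suc (length rs) a) (above-suc (length rs) a′))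
      (cong sign (sym (local-skip r rs b′ u′ z))))

  split : ∀ a q rs b u → (a + comb rs b) + q · u ≡ (a + (q +ˢ total rs) · u) + local rs b u
  split a q rs b u = begin
    (a + comb rs b) + q · u
      ≡⟨ cong (λ z → (a + z) + q · u) (comb-local rs b u) ⟩
    (a + (total rs · u + local rs b u)) + q · u
      ≡⟨ solve 4 (λ a t l q → ((a ⊹ (t ⊹ l)) ⊹ q) ≗ᵍ ((a ⊹ (q ⊹ t)) ⊹ l)) refl a (total rs · u) (local rs b u) (q · u) ⟩
    (a + (q · u + total rs · u)) + local rs b u
      ≡⟨ cong (λ z → (a + z) + local rs b u) (·-+ q (total rs) u) ⟨
    (a + (q +ˢ total rs) · u) + local rs b u ∎
    where open ≡-Reasoning

  aboveAndDominating : ∀ n q a {b} → InΨ b → Σ Γ λ u → Above n b u × Dominates u q a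
  aboveAndDominating n q a {b} b∈ with dominating q a
  ... | u , u∈ , d with Ψ-sup u (sⁿ n b) u∈ (sⁿ∈Ψ n b∈)
  ...   | w , w∈ , p , p′ = w , (b∈ , w∈ , p′) , Dominates-mono q a p d

  -- With λ for `u` in `split`, the argument is `a + (q +ˢ total rs) λ` plus a local part of
  -- valuation above `b`, so the first part dominates.
  V-low : ∀ a q rs {b} → InΨ b → V (q +ˢ total rs) a ≤∞ just b → V q (a + comb rs b) ≡ V (q +ˢ total rs) a
  V-low a q rs {b} b∈ p with aboveAndDominating (length rs) (q +ˢ total rs) a b∈
  ... | u , ab@(_ , u∈ , ≤u) , d = trans (v⇒V q _ u∈ (subst (_≤∞ just u) (sym value)
      (O∞.≤-trans p (just-≤ (O.≤-trans (≤-sⁿ (length rs) b∈) ≤u))))) value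
    where
    value : v ((a + comb rs b) + q · u) ≡ V (q +ˢ total rs) a
    value = trans (cong v (split a q rs b u)) (trans
      (v-<ˡ _ _ (subst (_<∞ v (local rs b u)) (sym (V⇒v (q +ˢ total rs) a u∈ d)) (O∞.≤-<-trans p (local-> rs ab))))
      (V⇒v (q +ˢ total rs) a u∈ d))

  -- Here the local part dominates, its valuation being at most `sⁿ (length rs) b`.
  V-high : ∀ a q rs {b j} → InΨ b → lead rs ≡ just j → just (sⁿ (length rs) b) <∞ V (q +ˢ total rs) a →
           V q (a + comb rs b) ≡ just (sⁿ j b)
  V-high a q rs {b} {j} b∈ e p with aboveAndDominating (length rs) (q +ˢ total rs) a b∈
  ... | u , ab@(_ , u∈ , ≤u) , d = trans (v⇒V q _ u∈ (subst (_≤∞ just u) (sym value)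
      (just-≤ (O.≤-trans j≤ ≤u)))) value
    where
    j≤ : sⁿ j b ≤ sⁿ (length rs) b
    j≤ = sⁿ-monoˡ b∈ (proj₂ (lead-bounds rs e))
    value : v ((a + comb rs b) + q · u) ≡ just (sⁿ j b)
    value = trans (cong v (split a q rs b u)) (trans
      (v-<ʳ _ _ (subst₂ _<∞_ (sym (local-v rs e ab)) (sym (V⇒v (q +ˢ total rs) a u∈ d))
        (≤-<∞ (V (q +ˢ total rs) a) j≤ p)))
      (local-v rs e ab))

  V-none : ∀ a q rs b → lead rs ≡ nothing → V q (a + comb rs b) ≡ V (q +ˢ total rs) a
  V-none a q rs b e with dominating q a | dominating (q +ˢ total rs) a
  ... | u , u∈ , d | w , w∈ , d′ with Ψ-sup u w u∈ w∈
  ...   | z , z∈ , p , p′ = begin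
    V q (a + comb rs b)            ≡⟨ cong (V q) (trans (cong (a +_) (comb-none rs b e)) (+-identityʳ a)) ⟩
    V q a                          ≡⟨ V⇒v q a z∈ (Dominates-mono q a p d) ⟨
    v (a + q · z)                  ≡⟨ cong (λ y → v (a + y)) (trans (·-+ q (total rs) z)
                                        (trans (cong (q · z +_) (total-none rs z e)) (+-identityʳ _))) ⟨
    v (a + (q +ˢ total rs) · z)    ≡⟨ V⇒v (q +ˢ total rs) a z∈ (Dominates-mono (q +ˢ total rs) a p′ d′) ⟩
    V (q +ˢ total rs) a            ∎
    where open ≡-Reasoning

  -- A center (q , a , n) stands for the value D = V q a; two elements of Ψ are
  -- on the same side of it if both are ≥ D or both lie more than n below D.

  V∞ : Scalar → Γ∞ → Γ∞
  V∞ q nothing = nothing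
  V∞ q (just a) = V q a

  V-InΨ∞ : ∀ q a → InΨ∞ (V q a)
  V-InΨ∞ q a with isZero? q
  ... | no n rewrite V-nonzero q a n = s∈Ψ _
  ... | yes z rewrite V-zero q a z with v a in e
  ...   | nothing = ⊤ₚ.tt
  ...   | just u = v-InΨ e

  V∞-InΨ∞ : ∀ q x → InΨ∞ (V∞ q x)
  V∞-InΨ∞ q nothing = ⊤ₚ.tt
  V∞-InΨ∞ q (just a) = V-InΨ∞ q a

  SameSide : Γ∞ → ℕ → Γ → Γ → Set ℓ
  SameSide D n b b′ = (D ≤∞ just b × D ≤∞ just b′) ⊎ (just (sⁿ n b) <∞ D × just (sⁿ n b′) <∞ D)

  -- A `w` that is large for both `b` and `b′` gives both sums the same first part `c`. Either `c`
  -- dominates in both, or the local parts do and `local-sign` applies; if all coefficients vanish,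
  -- both sums are `a`.
  sign-comb : ∀ a rs {b b′} → InΨ b → InΨ b′ → SameSide (V (total rs) a) (length rs) b b′ →
              sign (a + comb rs b) ≡ sign (a + comb rs b′)
  sign-comb a rs {b} {b′} b∈ b′∈ side
    with aboveAndDominating (length rs) (total rs) a b∈ | aboveAndDominating (length rs) (total rs) a b′∈
  ... | u , (_ , u∈ , p) , d | u′ , (_ , u′∈ , p′) , _ with Ψ-sup u u′ u∈ u′∈
  ...   | w , w∈ , q , q′ = go side
    where
    above : Above (length rs) b w
    above = b∈ , w∈ , O.≤-trans p q
    above′ : Above (length rs) b′ w
    above′ = b′∈ , w∈ , O.≤-trans p′ q′
    c : Γ
    c = a + total rs · w
    vc : v c ≡ V (total rs) a
    vc = V⇒v (total rs) a w∈ (Dominates-mono (total rs) a q d)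
    shift : ∀ b → a + comb rs b ≡ c + local rs b w
    shift b = trans (cong (a +_) (comb-local rs b w)) (sym (+-assoc a _ _))
    go : SameSide (V (total rs) a) (length rs) b b′ → sign (a + comb rs b) ≡ sign (a + comb rs b′)
    go (inj₁ (r , r′)) = trans (at above r) (sym (at above′ r′))
      where
      at : ∀ {b} → Above (length rs) b w → V (total rs) a ≤∞ just b → sign (a + comb rs b) ≡ sign c
      at {b} ab r = trans (cong sign (shift b)) (sign-dom _ _
        (subst (_<∞ v (local rs b w)) (sym vc) (O∞.≤-<-trans r (local-> rs ab))))
    go (inj₂ (r , r′)) with lead rs in e
    ... | nothing = cong (λ z → sign (a + z)) (trans (comb-none rs b e) (sym (comb-none rs b′ e)))
    ... | just j = trans (at above r) (trans (local-sign rs e above above′) (sym (at above′ r′)))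
      where
      at : ∀ {b} → Above (length rs) b w → just (sⁿ (length rs) b) <∞ V (total rs) a →
           sign (a + comb rs b) ≡ sign (local rs b w)
      at {b} ab@(b∈ , _) r = trans (cong sign (trans (shift b) (+-comm _ _))) (sign-dom _ _
        (subst₂ _<∞_ (sym (local-v rs e ab)) (sym vc)
          (≤-<∞ (V (total rs) a) (sⁿ-monoˡ b∈ (proj₂ (lead-bounds rs e))) r)))

  -- Normal forms of terms in a variable from Ψ.

  module _ {Var : Set} where

    Center Form : Set
    Center = Scalar × Tm Var × ℕ
    Form = Tm Var × List Scalar

    center : Center → Env Var → Γ∞
    center (q , a , _) ρ = V∞ q (eval a ρ)

    Sim : List Center → Env Var → Γ → Γ → Set ℓ
    Sim C ρ b b′ = InΨ b × InΨ b′ × (∀ {d} → d ∈ C → SameSide (center d ρ) (proj₂ (proj₂ d)) b b′)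

    Sim-⊆ : ∀ {C C′ ρ b b′} → (∀ {d} → d ∈ C′ → d ∈ C) → Sim C ρ b b′ → Sim C′ ρ b b′
    Sim-⊆ f (p , q , r) = p , q , λ i → r (f i)

    raise : ℕ → List Center → List Center
    raise n = map λ (q , a , m) → q , a , n ℕ.+ m

    Sim-raise : ∀ n {C ρ b b′} → Sim (raise n C) ρ b b′ → Sim C ρ (sⁿ n b) (sⁿ n b′)
    Sim-raise n {b = b} {b′} (b∈ , b′∈ , r) = sⁿ∈Ψ n b∈ , sⁿ∈Ψ n b′∈ , λ {d} d∈ → up d (r (∈-map⁺ _ d∈))
      where
      up : ∀ d {D} → SameSide D (n ℕ.+ proj₂ (proj₂ d)) b b′ → SameSide D (proj₂ (proj₂ d)) (sⁿ n b) (sⁿ n b′)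
      up d (inj₁ (p , p′)) = inj₁ (O∞.≤-trans p (just-≤ (≤-sⁿ n b∈)) , O∞.≤-trans p′ (just-≤ (≤-sⁿ n b′∈)))
      up (_ , _ , m) {D} (inj₂ (p , p′)) = inj₂ (subst (λ z → just z <∞ D) (sⁿ-+ n m b) p ,
                                                subst (λ z → just z <∞ D) (sⁿ-+ n m b′) p′)

    form : Form → Env Var → Γ → Γ∞
    form (a , rs) ρ b = add∞ (eval a ρ) (just (comb rs b))

    SameForm : List Form → Env Var → Γ → Γ → Γ∞ → Γ∞ → Set ℓ
    SameForm F ρ b b′ x x′ = ∃ λ f → f ∈ F × x ≡ form f ρ b × x′ ≡ form f ρ b′

    -- The variable is set to `sⁿ K b`, so that `K` predecessors can be taken without leaving `Ψ`.
    -- Which form occurs may depend on `b`, but it is the same for two points on the same side of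
    -- all centers.
    FormsAt : Tm (⊤ ⊎ Var) → ℕ → Set ℓ
    FormsAt t K = Σ (List Center) λ C → Σ (List Form) λ F → ∀ {ρ b b′} → Sim C ρ b b′ →
      SameForm F ρ b b′ (eval t [ const (just (sⁿ K b)) , ρ ]′) (eval t [ const (just (sⁿ K b′)) , ρ ]′)

    const-form : ∀ a ρ b → eval a ρ ≡ form (a , []) ρ b
    const-form a ρ b = sym (add∞-identityʳ _)

    comb-0∷ : ∀ rs b → comb (0ˢ ∷ rs) b ≡ comb rs (s b)
    comb-0∷ rs b = trans (cong (_+ comb rs (s b)) (·-zero 0ˢ b refl)) (+-identityˡ (comb rs (s b)))

    shiftForm : ℕ → Form → Form
    shiftForm n (a , rs) = a , zeros n
      where
      zeros : ℕ → List Scalar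
      zeros zero = rs
      zeros (suc n) = 0ˢ ∷ zeros n

    shiftForm-correct : ∀ n f ρ b → form (shiftForm n f) ρ b ≡ form f ρ (sⁿ n b)
    shiftForm-correct zero f ρ b = refl
    shiftForm-correct (suc n) f ρ b = trans
      (cong (λ z → add∞ (eval (proj₁ f) ρ) (just z)) (comb-0∷ (proj₂ (shiftForm n f)) b))
      (shiftForm-correct n f ρ (s b))

    raiseForms : ∀ n {t K} → FormsAt t K → FormsAt t (n ℕ.+ K)
    raiseForms n {t} {K} (C , F , h) = raise n C , map (shiftForm n) F , λ {ρ} {b} {b′} sim →
      let f , f∈ , e , e′ = h (Sim-raise n sim) in
      shiftForm n f , ∈-map⁺ _ f∈ , at ρ b f e , at ρ b′ f e′
      where
      at : ∀ ρ b f → eval t [ const (just (sⁿ K (sⁿ n b))) , ρ ]′ ≡ form f ρ (sⁿ n b) →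
           eval t [ const (just (sⁿ (n ℕ.+ K) b)) , ρ ]′ ≡ form (shiftForm n f) ρ b
      at ρ b f e = trans (cong (λ z → eval t [ const (just z) , ρ ]′) (sⁿ-+ n K b))
        (trans e (sym (shiftForm-correct n f ρ b)))

    unitForm : ℕ → List Scalar
    unitForm zero = 1ˢ ∷ []
    unitForm (suc j) = 0ˢ ∷ unitForm j

    comb-unit : ∀ j b → comb (unitForm j) b ≡ sⁿ j b
    comb-unit zero b = trans (+-identityʳ _) (·-1 b)
    comb-unit (suc j) b = trans (comb-0∷ (unitForm j) b) (comb-unit j (s b))

    unit-form : ∀ j ρ b → just (sⁿ j b) ≡ form (0ᵗ , unitForm j) ρ b
    unit-form j ρ b = sym (trans (add∞-identityˡ _) (cong just (comb-unit j b)))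

    Vᵗ : Scalar → Tm Var → Tm Var
    Vᵗ q a with isZero? q
    ... | yes _ = op ψᵒ a
    ... | no _ = op (sᵒ 0) ((-ˢ invˢ q) ⊙ a)

    eval-V : ∀ q a ρ → eval (Vᵗ q a) ρ ≡ V∞ q (eval a ρ)
    eval-V q a ρ with isZero? q
    ... | yes z = lemma (eval a ρ)
      where
      lemma : ∀ x → v∞ x ≡ V∞ q x
      lemma nothing = refl
      lemma (just x) = sym (V-zero q x z)
    ... | no n = lemma (eval a ρ)
      where
      lemma : ∀ x → s∞ ((-ˢ invˢ q) ·∞ x) ≡ V∞ q x
      lemma nothing = refl
      lemma (just x) = sym (V-nonzero q x n)

    predsᵗ : ℕ → Tm Var → Tm Var
    predsᵗ zero t = t
    predsᵗ (suc g) t = predᵗ (predsᵗ g t)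

    eval-preds : ∀ g t ρ → eval (predsᵗ g t) ρ ≡ preds g (eval t ρ)
    eval-preds zero t ρ = refl
    eval-preds (suc g) t ρ = trans (eval-pred (predsᵗ g t) ρ) (cong pred (eval-preds g t ρ))

    -- Applying o can lower the exponents of s in a form by back o.
    back : Op → ℕ
    back ψᵒ = 0
    back χᵒ = 0
    back (sᵒ g) = g

    OpForms : (Γ∞ → Γ∞) → ℕ → Form → Set ℓ
    OpForms h g f = Σ (List Center) λ C → Σ (List Form) λ F → ∀ {ρ b b′} → InΨ b → InΨ b′ →
      Sim C ρ (sⁿ g b) (sⁿ g b′) → SameForm F ρ b b′ (h (form f ρ (sⁿ g b))) (h (form f ρ (sⁿ g b′)))

    -- `V-low`, `V-none` and `V-high` leave two outcomes: a value that does not involve `b`, and a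
    -- single iterate of `s`. Starting at `sⁿ g b` absorbs the `g` predecessors.
    V-forms : ∀ q g f → OpForms (λ x → preds g (V∞ q x)) g f
    V-forms q g (a , rs) = (r , a , length rs) ∷ [] , F , correct
      where
      r : Scalar
      r = q +ˢ total rs
      D : Form
      D = predsᵗ g (Vᵗ r a) , []
      units : Maybe ℕ → List Form
      units nothing = []
      units (just j) = (0ᵗ , unitForm j) ∷ []
      F : List Form
      F = D ∷ units (lead rs)
      eval-D : ∀ ρ → preds g (V∞ r (eval a ρ)) ≡ eval (predsᵗ g (Vᵗ r a)) ρ
      eval-D ρ = sym (trans (eval-preds g (Vᵗ r a) ρ) (cong (preds g) (eval-V r a ρ)))
      isD : ∀ {ρ b b′ x x′} → x ≡ V∞ r (eval a ρ) → x′ ≡ V∞ r (eval a ρ) →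
            SameForm F ρ b b′ (preds g x) (preds g x′)
      isD {ρ} {b} {b′} refl refl = D , here refl , trans (eval-D ρ) (const-form (proj₁ D) ρ b) ,
        trans (eval-D ρ) (const-form (proj₁ D) ρ b′)
      correct : ∀ {ρ b b′} → InΨ b → InΨ b′ → Sim ((r , a , length rs) ∷ []) ρ (sⁿ g b) (sⁿ g b′) →
        SameForm F ρ b b′ (preds g (V∞ q (form (a , rs) ρ (sⁿ g b)))) (preds g (V∞ q (form (a , rs) ρ (sⁿ g b′))))
      correct {ρ} {b} {b′} b∈ b′∈ (c∈ , c′∈ , side) with eval a ρ | isD {ρ} {b} {b′} | side (here refl)
      ... | nothing | k | _ = k refl refl
      ... | just x | k | inj₁ (p , p′) = k (V-low x q rs c∈ p) (V-low x q rs c′∈ p′)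
      ... | just x | k | inj₂ (p , p′) with lead rs in e
      ...   | nothing = k (V-none x q rs _ e) (V-none x q rs _ e)
      ...   | just j = _ , there (here refl) , at b∈ c∈ p , at b′∈ c′∈ p′
        where
        at : ∀ {b} → InΨ b → InΨ (sⁿ g b) → just (sⁿ (length rs) (sⁿ g b)) <∞ V r x →
             preds g (V q (x + comb rs (sⁿ g b))) ≡ form (0ᵗ , unitForm j) ρ b
        at {b} b∈ c∈ p = trans (cong (preds g) (trans (V-high x q rs c∈ e p) (cong just (sym (sⁿ-+ g j b)))))
          (trans (preds-sⁿ g j b∈) (unit-form j ρ b))

    -- χ of a finite form depends only on whether its sign is zero, and `sign-comb` keeps the sign
    -- constant.
    χ-forms : ∀ f → OpForms χ∞ 0 f
    χ-forms (a , rs) = (total rs , a , length rs) ∷ [] , (0ᵗ , []) ∷ (∞ᵗ , []) ∷ [] , correct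
      where
      correct : ∀ {ρ b b′} → InΨ b → InΨ b′ → Sim ((total rs , a , length rs) ∷ []) ρ b b′ →
        SameForm ((0ᵗ , []) ∷ (∞ᵗ , []) ∷ []) ρ b b′ (χ∞ (form (a , rs) ρ b)) (χ∞ (form (a , rs) ρ b′))
      correct {ρ} {b} {b′} b∈ b′∈ (_ , _ , side) with eval a ρ | side (here refl)
      ... | nothing | _ = _ , there (here refl) , χ∞-∞ , χ∞-∞
      ... | just x | sd with sign (x + comb rs b) | signView (x + comb rs b)
                           | sign-view {x + comb rs b′} (sym (sign-comb x rs b∈ b′∈ sd))
      ...   | _ | is-zer p | is-zer p′ = _ , here refl ,
                trans (χ∞-0 p) (const-form 0ᵗ ρ b) , trans (χ∞-0 p′) (const-form 0ᵗ ρ b′)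
      ...   | _ | is-pos p | is-pos p′ = _ , there (here refl) ,
                χ∞-≢0 (λ e → O.<-irrefl (sym e) p) , χ∞-≢0 (λ e → O.<-irrefl (sym e) p′)
      ...   | _ | is-neg p | is-neg p′ = _ , there (here refl) ,
                χ∞-≢0 (λ e → O.<-irrefl e p) , χ∞-≢0 (λ e → O.<-irrefl e p′)

    v∞≡V∞ : ∀ x → v∞ x ≡ V∞ 0ˢ x
    v∞≡V∞ nothing = refl
    v∞≡V∞ (just x) = sym (V-zero 0ˢ x refl)

    s∞≡V∞ : ∀ x → s∞ x ≡ V∞ (-ˢ 1ˢ) x
    s∞≡V∞ nothing = refl
    s∞≡V∞ (just x) = sym (trans (V-nonzero (-ˢ 1ˢ) x (λ ())) (cong (just ∘ s) (·-1 x)))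

    op-forms : ∀ o f → OpForms ⟦ o ⟧ (back o) f
    op-forms ψᵒ f with V-forms 0ˢ 0 f
    ... | C , F , h = C , F , λ {ρ} {b} {b′} b∈ b′∈ sim → let g , g∈ , e , e′ = h b∈ b′∈ sim in
          g , g∈ , trans (v∞≡V∞ (form f ρ b)) e , trans (v∞≡V∞ (form f ρ b′)) e′
    op-forms χᵒ f = χ-forms f
    op-forms (sᵒ k) f with V-forms (-ˢ 1ˢ) k f
    ... | C , F , h = C , F , λ b∈ b′∈ sim → let g , g∈ , e , e′ = h b∈ b′∈ sim in
          g , g∈ , trans (cong (preds k) (s∞≡V∞ _)) e , trans (cong (preds k) (s∞≡V∞ _)) e′

    addCoeffs : List Scalar → List Scalar → List Scalar
    addCoeffs [] rs = rs
    addCoeffs (q ∷ qs) [] = q ∷ qs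
    addCoeffs (q ∷ qs) (r ∷ rs) = (q +ˢ r) ∷ addCoeffs qs rs

    comb-add : ∀ qs rs b → comb (addCoeffs qs rs) b ≡ comb qs b + comb rs b
    comb-add [] rs b = sym (+-identityˡ _)
    comb-add (q ∷ qs) [] b = sym (+-identityʳ _)
    comb-add (q ∷ qs) (r ∷ rs) b = trans (cong₂ _+_ (·-+ q r b) (comb-add qs rs (s b)))
      (interchange (q · b) (r · b) (comb qs (s b)) (comb rs (s b)))

    comb-scale : ∀ q rs b → comb (map (q *ˢ_) rs) b ≡ q · comb rs b
    comb-scale q [] b = sym (·-0 q)
    comb-scale q (r ∷ rs) b = trans (cong₂ _+_ (·-* q r b) (comb-scale q rs (s b))) (sym (·-distrib q _ _))

    forms : ∀ t → Σ ℕ (FormsAt t)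
    forms (var (inj₁ tt)) = 0 , [] , (0ᵗ , unitForm 0) ∷ [] , λ {ρ} {b} {b′} _ →
      _ , here refl , unit-form 0 ρ b , unit-form 0 ρ b′
    forms (var (inj₂ x)) = 0 , [] , (var x , []) ∷ [] , λ {ρ} {b} {b′} _ →
      _ , here refl , const-form (var x) ρ b , const-form (var x) ρ b′
    forms 0ᵗ = 0 , [] , (0ᵗ , []) ∷ [] , λ {ρ} {b} {b′} _ →
      _ , here refl , const-form 0ᵗ ρ b , const-form 0ᵗ ρ b′
    forms ∞ᵗ = 0 , [] , (∞ᵗ , []) ∷ [] , λ _ → _ , here refl , refl , refl
    forms (t ⊕ u) with forms t | forms u
    -- Both delays are raised to `K′ + K`, so that the two forms refer to the same `b`.
    ... | K , T | K′ , U with raiseForms K′ {t} T | subst (FormsAt u) (ℕₚ.+-comm K K′) (raiseForms K {u} U)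
    ...   | C , F , h | C′ , G , h′ = K′ ℕ.+ K , C ++ C′ , concatMap (λ f → map (plus f) G) F , λ {ρ} {b} {b′} sim →
            let f , f∈ , e , e′ = h (Sim-⊆ (∈-++⁺ˡ) sim) ; g , g∈ , d , d′ = h′ (Sim-⊆ (∈-++⁺ʳ C) sim) in
            plus f g , ∈-concatMap _ f∈ (∈-map⁺ _ g∈) ,
            trans (cong₂ add∞ e d) (plus-correct f g ρ b) , trans (cong₂ add∞ e′ d′) (plus-correct f g ρ b′)
      where
      plus : Form → Form → Form
      plus (a , rs) (a′ , rs′) = a ⊕ a′ , addCoeffs rs rs′
      plus-correct : ∀ f g ρ b → add∞ (form f ρ b) (form g ρ b) ≡ form (plus f g) ρ b
      plus-correct (a , rs) (a′ , rs′) ρ b = trans (add∞-interchange (eval a ρ) _ (eval a′ ρ) _)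
        (cong (λ z → add∞ (add∞ (eval a ρ) (eval a′ ρ)) (just z)) (sym (comb-add rs rs′ b)))
    forms (q ⊙ t) with forms t
    ... | K , C , F , h = K , C , map times F , λ {ρ} {b} {b′} sim →
          let f , f∈ , e , e′ = h sim in times f , ∈-map⁺ _ f∈ ,
            trans (cong (q ·∞_) e) (times-correct f ρ b) , trans (cong (q ·∞_) e′) (times-correct f ρ b′)
      where
      times : Form → Form
      times (a , rs) = q ⊙ a , map (q *ˢ_) rs
      times-correct : ∀ f ρ b → q ·∞ form f ρ b ≡ form (times f) ρ b
      times-correct (a , rs) ρ b = trans (·∞-distrib q (eval a ρ) _)
        (cong (λ z → add∞ (q ·∞ eval a ρ) (just z)) (sym (comb-scale q rs b)))
    forms (op o t) with forms t
    ... | K , C , F , h = back o ℕ.+ K , raise (back o) C′ , concatMap (λ f → proj₁ (proj₂ (op-forms o f))) F , correct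
      where
      g : ℕ
      g = back o
      C′ : List Center
      C′ = C ++ concatMap (λ f → proj₁ (op-forms o f)) F
      correct : ∀ {ρ b b′} → Sim (raise g C′) ρ b b′ → SameForm _ ρ b b′
        (⟦ o ⟧ (eval t [ const (just (sⁿ (g ℕ.+ K) b)) , ρ ]′)) (⟦ o ⟧ (eval t [ const (just (sⁿ (g ℕ.+ K) b′)) , ρ ]′))
      correct {ρ} {b} {b′} sim@(b∈ , b′∈ , _) with h (Sim-⊆ {C = C′} ∈-++⁺ˡ (Sim-raise g sim))
      ... | f , f∈ , e , e′ with proj₂ (proj₂ (op-forms o f)) b∈ b′∈
              (Sim-⊆ {C = C′} (λ i → ∈-++⁺ʳ C (∈-concatMap _ f∈ i)) (Sim-raise g sim))
      ...   | k , k∈ , d , d′ = k , ∈-concatMap _ f∈ k∈ , at b e d , at b′ e′ d′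
        where
        at : ∀ b → eval t [ const (just (sⁿ K (sⁿ g b))) , ρ ]′ ≡ form f ρ (sⁿ g b) →
             ⟦ o ⟧ (form f ρ (sⁿ g b)) ≡ form k ρ b → ⟦ o ⟧ (eval t [ const (just (sⁿ (g ℕ.+ K) b)) , ρ ]′) ≡ form k ρ b
        at b e d = trans (cong (λ z → ⟦ o ⟧ (eval t [ const (just z) , ρ ]′)) (sⁿ-+ g K b))
          (trans (cong ⟦ o ⟧ e) d)

    SignsAt : List (Tm (⊤ ⊎ Var)) → ℕ → Set ℓ
    SignsAt T K = Σ (List Center) λ C → ∀ {ρ b b′} → Sim C ρ b b′ →
      Agree T [ const (just (sⁿ K b)) , ρ ]′ [ const (just (sⁿ K b′)) , ρ ]′

    raiseSigns : ∀ n {T K} → SignsAt T K → SignsAt T (n ℕ.+ K)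
    raiseSigns n {T} {K} (C , h) = raise n C , λ {ρ} {b} {b′} sim {t} t∈ →
      trans (cong (λ z → sgn (eval t [ const (just z) , ρ ]′)) (sⁿ-+ n K b))
        (trans (h (Sim-raise n sim) t∈) (cong (λ z → sgn (eval t [ const (just z) , ρ ]′)) (sym (sⁿ-+ n K b′))))

    signs : ∀ T → Σ ℕ (SignsAt T)
    signs [] = 0 , [] , λ _ ()
    signs (t ∷ T) with forms t | signs T
    ... | K , F₀ | K′ , S with raiseForms K′ {t} F₀ | subst (SignsAt T) (ℕₚ.+-comm K K′) (raiseSigns K {T} S)
    ...   | C , F , h | C′ , h′ = K′ ℕ.+ K , C ++ C′ ++ map signCenter F , correct
      where
      signCenter : Form → Center
      signCenter (a , rs) = total rs , a , length rs
      form-sign : ∀ f {ρ b b′} → Sim (signCenter f ∷ []) ρ b b′ → sgn (form f ρ b) ≡ sgn (form f ρ b′)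
      form-sign (a , rs) {ρ} (b∈ , b′∈ , side) with eval a ρ | side (here refl)
      ... | nothing | _ = refl
      ... | just x | sd = sign-comb x rs b∈ b′∈ sd
      correct : ∀ {ρ b b′} → Sim (C ++ C′ ++ map signCenter F) ρ b b′ →
        Agree (t ∷ T) [ const (just (sⁿ (K′ ℕ.+ K) b)) , ρ ]′ [ const (just (sⁿ (K′ ℕ.+ K) b′)) , ρ ]′
      correct sim (here refl) with h (Sim-⊆ ∈-++⁺ˡ sim)
      ... | f , f∈ , e , e′ = trans (cong sgn e) (trans
        (form-sign f (Sim-⊆ (λ { (here refl) → ∈-++⁺ʳ C (∈-++⁺ʳ C′ (∈-map⁺ signCenter f∈)) }) sim)) (cong sgn (sym e′)))
      correct sim (there t∈) = h′ (Sim-⊆ (λ i → ∈-++⁺ʳ C (∈-++⁺ˡ i)) sim) t∈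

    -- The middle case is the gap left by `SameSide`. Since successors are immediate, an element of
    -- `Ψ` there is an iterate of `b`; so `b` is an iterated predecessor of the center and can be
    -- named exactly.
    position : ∀ n {b} x → InΨ∞ x → InΨ b →
               x ≤∞ just b ⊎ (∃ λ j → j ℕ.≤ n × x ≡ just (sⁿ j b)) ⊎ just (sⁿ n b) <∞ x
    position zero {b} x x∈ b∈ with O∞._<⊎≥_ (just b) x
    ... | inj₁ p = inj₂ (inj₂ p)
    ... | inj₂ p = inj₁ p
    position (suc n) {b} x x∈ b∈ with position n x x∈ (s∈Ψ b)
    ... | inj₂ (inj₂ p) = inj₂ (inj₂ p)
    ... | inj₂ (inj₁ (j , p , e)) = inj₂ (inj₁ (suc j , s≤s p , e))
    position (suc n) {b} (just x) x∈ b∈ | inj₁ p with O∞._<⊎≥_ (just b) (just x)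
    ... | inj₂ q = inj₁ q
    ... | inj₁ q = inj₂ (inj₁ (1 , s≤s z≤n , cong just (O.≤-antisym (≤-just p) (sα-imm b x b∈ x∈ q))))
    position (suc n) {b} nothing x∈ b∈ | inj₁ (inj₁ ())
    position (suc n) {b} nothing x∈ b∈ | inj₁ (inj₂ ())

    -- Only finitely many elements of `Ψ` have fewer than `K` predecessors, and these are given by
    -- closed terms.
    low-or-shifted : ∀ K {w} → InΨ w → (∃ λ j → j ℕ.< K × w ≡ sⁿ j (s 0#)) ⊎ (∃ λ b → InΨ b × w ≡ sⁿ K b)
    low-or-shifted zero {w} w∈ = inj₂ (w , w∈ , refl)
    low-or-shifted (suc K) w∈ with low-or-shifted K w∈
    ... | inj₁ (j , p , e) = inj₁ (j , ℕₚ.m≤n⇒m≤1+n p , e)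
    ... | inj₂ (b , b∈ , e) with s0-least b b∈
    ...   | inj₂ refl = inj₁ (K , ℕₚ.≤-refl , e)
    ...   | inj₁ p with s-onto b b∈ p
    ...     | c , c∈ , refl = inj₂ (c , c∈ , e)

    sⁿᵗ : ℕ → Tm Var → Tm Var
    sⁿᵗ zero t = t
    sⁿᵗ (suc n) t = sⁿᵗ n (op (sᵒ 0) t)

    eval-sⁿ : ∀ n t {ρ b} → eval t ρ ≡ just b → eval (sⁿᵗ n t) ρ ≡ just (sⁿ n b)
    eval-sⁿ zero t e = e
    eval-sⁿ (suc n) t e = eval-sⁿ n (op (sᵒ 0) t) (cong s∞ e)

    s0ᵗ : Tm Var
    s0ᵗ = op (sᵒ 0) 0ᵗ

    centerᵗ : Center → Tm Var
    centerᵗ (q , a , _) = Vᵗ q a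

    -- `b₀` is the largest among `s 0#` and the centers that are at most `b`. Going down also keeps
    -- the centers far above `b` on their side, since iterates of `s` are monotone.
    lower : ∀ (C : List Center) ρ {b} → InΨ b → ∃ λ u → ∃ λ b₀ → u ∈ (s0ᵗ ∷ map centerᵗ C) × eval u ρ ≡ just b₀ ×
            InΨ b₀ × b₀ ≤ b × (∀ {d} → d ∈ C → center d ρ ≤∞ just b → center d ρ ≤∞ just b₀)
    lower [] ρ {b} b∈ = s0ᵗ , s 0# , here refl , refl , s0∈Ψ , s0-least b b∈ , λ ()
    lower (d@(q , a , n) ∷ C) ρ {b} b∈ with lower C ρ b∈
    ... | u , b₀ , u∈ , e , b₀∈ , b₀≤b , m with center d ρ in eq | V∞-InΨ∞ q (eval a ρ)
    ...   | nothing | _ = u , b₀ , ∈-skip u∈ , e , b₀∈ , b₀≤b , λ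
              { (here refl) p → ⊥-elim (O∞.≤⇒≯ (subst (_≤∞ just b) eq p) ⊤ₚ.tt) ; (there i) → m i }
    ...   | just D | D∈ with O._<⊎≥_ b₀ D | O._<⊎≥_ b D
    ...     | inj₁ b₀<D | inj₂ D≤b = centerᵗ d , D , there (here refl) , trans (eval-V q a ρ) eq , D∈ , D≤b , λ
                { (here refl) _ → inj₂ eq ; (there i) p → O∞.≤-trans (m i p) (inj₁ b₀<D) }
    ...     | inj₁ b₀<D | inj₁ b<D = u , b₀ , ∈-skip u∈ , e , b₀∈ , b₀≤b , λ
                { (here refl) p → ⊥-elim (O∞.≤⇒≯ (subst (_≤∞ just b) eq p) b<D) ; (there i) → m i }
    ...     | inj₂ D≤b₀ | _ = u , b₀ , ∈-skip u∈ , e , b₀∈ , b₀≤b , λ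
                { (here refl) p → O∞.≤-trans (inj₂ eq) (just-≤ D≤b₀) ; (there i) → m i }

    classify : ∀ (C : List Center) ρ {b} → InΨ b →
      (∃ λ d → d ∈ C × ∃ λ j → j ℕ.≤ proj₂ (proj₂ d) × center d ρ ≡ just (sⁿ j b)) ⊎
      (∀ {d} → d ∈ C → center d ρ ≤∞ just b ⊎ just (sⁿ (proj₂ (proj₂ d)) b) <∞ center d ρ)
    classify [] ρ b∈ = inj₂ λ ()
    classify (d@(q , a , n) ∷ C) ρ b∈ with classify C ρ b∈ | position n (center d ρ) (V∞-InΨ∞ q (eval a ρ)) b∈
    ... | inj₁ (d′ , i , r) | _ = inj₁ (d′ , there i , r)
    ... | inj₂ f | inj₂ (inj₁ (j , p , e)) = inj₁ (d , here refl , j , p , e)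
    ... | inj₂ f | inj₁ p = inj₂ λ { (here refl) → inj₁ p ; (there i) → f i }
    ... | inj₂ f | inj₂ (inj₂ p) = inj₂ λ { (here refl) → inj₂ p ; (there i) → f i }

    -- ∞ and 0 are the values allowed by `InΨ₀` outside `Ψ`. The other blocks are the elements with
    -- fewer than `K` predecessors, the points reached by moving down, and the exact points in the
    -- gap of a center, where `j` may equal the third component of the center; hence `suc`.
    witnesses : ℕ → List Center → List (Tm Var)
    witnesses K C = ∞ᵗ ∷ 0ᵗ ∷ map (λ j → sⁿᵗ j s0ᵗ) (upTo K) ++
      map (sⁿᵗ K) (s0ᵗ ∷ map centerᵗ C) ++
      concatMap (λ d → map (λ j → sⁿᵗ K (predsᵗ j (centerᵗ d))) (upTo (suc (proj₂ (proj₂ d))))) C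

  -- ψ, `s` and `p` take values in `Ψ` or ∞; 0 is added for the sake of χ.
  InΨ₀ : Γ∞ → Set ℓ
  InΨ₀ x = InΨ∞ x ⊎ x ≡ just 0#

  elimΨ : Elim ⊤ InΨ₀
  elimΨ {Var} T with signs T
  ... | K , C , h = map const (witnesses K C) , λ ρ w w∈ →
      let u , u∈ , a = find ρ (w tt) (w∈ tt) in const u , ∈-map⁺ const u∈ , λ {t} t∈ →
        trans (cong sgn (eval-cong t λ { (inj₁ tt) → refl ; (inj₂ _) → refl })) (a t∈)
    where
    Found : Env Var → Γ∞ → Set
    Found ρ x = ∃ λ u → u ∈ witnesses K C × Agree T [ const x , ρ ]′ [ const (eval u ρ) , ρ ]′

    exact : ∀ {ρ x} u → u ∈ witnesses K C → eval u ρ ≡ x → Found ρ x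
    exact u u∈ refl = u , u∈ , λ _ → refl

    find : ∀ ρ x → InΨ₀ x → Found ρ x
    find ρ x (inj₂ refl) = exact {ρ} 0ᵗ (there (here refl)) refl
    find ρ nothing (inj₁ _) = exact {ρ} ∞ᵗ (here refl) refl
    find ρ (just w) (inj₁ w∈) with low-or-shifted {Var} K w∈
    ... | inj₁ (j , j<K , refl) = exact (sⁿᵗ j s0ᵗ) (there (there (∈-++⁺ˡ (∈-map⁺ _ (∈-upTo⁺ j<K)))))
            (eval-sⁿ j s0ᵗ refl)
    ... | inj₂ (b , b∈ , refl) with classify C ρ b∈
    ...   | inj₁ (d@(q , a , _) , d∈ , j , j≤ , e) = exact (sⁿᵗ K (predsᵗ j (centerᵗ d)))
            (there (there (∈-++⁺ʳ (map (λ j → sⁿᵗ j s0ᵗ) (upTo K)) (∈-++⁺ʳ (map (sⁿᵗ K) (s0ᵗ ∷ map centerᵗ C))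
              (∈-concatMap _ d∈ (∈-map⁺ _ (∈-upTo⁺ (s≤s j≤))))))))
            (eval-sⁿ K (predsᵗ j (centerᵗ d)) (trans (eval-preds j (centerᵗ d) ρ)
              (trans (cong (preds j) (trans (eval-V q a ρ) (trans e (cong (λ k → just (sⁿ k b)) (sym (ℕₚ.+-identityʳ j))))))
                (preds-sⁿ j 0 b∈))))
    ...   | inj₂ f with lower C ρ b∈
    ...     | u , b₀ , u∈ , e , b₀∈ , b₀≤b , m = sⁿᵗ K u ,
              there (there (∈-++⁺ʳ (map (λ j → sⁿᵗ j s0ᵗ) (upTo K)) (∈-++⁺ˡ (∈-map⁺ _ u∈)))) ,
              λ {t} t∈ → trans (h (b∈ , b₀∈ , λ {d} → side d) t∈)
                (cong (λ z → sgn (eval t [ const z , ρ ]′)) (sym (eval-sⁿ K u e)))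
      where
      side : ∀ d → d ∈ C → SameSide (center d ρ) (proj₂ (proj₂ d)) b b₀
      side d d∈ with f d∈
      ... | inj₁ p = inj₁ (p , m d∈ p)
      ... | inj₂ p = inj₂ (p , ≤-<∞ (center d ρ) (sⁿ-mono (proj₂ (proj₂ d)) b₀∈ b∈ b₀≤b) p)

-- Elimination of an arbitrary variable

isZero-* : ∀ q r → ¬ IsZero q → ¬ IsZero r → ¬ IsZero (q *ˢ r)
isZero-* q r nq nr z with ℤₚ.i*j≡0⇒i≡0∨j≡0 (num q) z
... | inj₁ p = nq p
... | inj₂ p = nr p

neg-inv-involutive : ∀ q → ¬ IsZero q → -ˢ invˢ (-ˢ invˢ q) ≡ q
neg-inv-involutive ((ℤ.+ zero) /1+ a) n = ⊥-elim (n refl)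
neg-inv-involutive ((ℤ.+ suc n) /1+ a) _ = refl
neg-inv-involutive (-[1+ n ] /1+ a) _ = refl

module Elimination {ℓ} (M : T0Model ℓ) where

  open PsiElimination M public

  elim-⊥ : ∀ {D} → Elim ⊥ D
  elim-⊥ T = (λ ()) ∷ [] , λ ρ w _ → (λ ()) , here refl , λ {t} _ →
    cong sgn (eval-cong t λ { (inj₁ ()) ; (inj₂ _) → refl })

  -- While the first block is replaced, the second counts as parameters. The second is eliminated
  -- from all results of the first replacement, and its witnesses are put into those of the first
  -- block.
  elim-⊎ : ∀ {W₁ W₂ D} → Elim W₁ D → Elim W₂ D → Elim (W₁ ⊎ W₂) D
  elim-⊎ {W₁} {W₂} {D} E₁ E₂ {V′} T = concatMap (λ w₁ → map (both w₁) Ws₂) Ws₁ , correct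
    where
    reassoc : (W₁ ⊎ W₂) ⊎ V′ → W₁ ⊎ (W₂ ⊎ V′)
    reassoc (inj₁ (inj₁ i)) = inj₁ i
    reassoc (inj₁ (inj₂ i)) = inj₂ (inj₁ i)
    reassoc (inj₂ i) = inj₂ (inj₂ i)
    T₁ : List (Tm (W₁ ⊎ (W₂ ⊎ V′)))
    T₁ = map (ren reassoc) T
    Ws₁ : List (W₁ → Tm (W₂ ⊎ V′))
    Ws₁ = proj₁ (E₁ T₁)
    T₂ : List (Tm (W₂ ⊎ V′))
    T₂ = concatMap (λ w₁ → map (sub [ w₁ , var ]′) T₁) Ws₁
    Ws₂ : List (W₂ → Tm V′)
    Ws₂ = proj₁ (E₂ T₂)
    both : (W₁ → Tm (W₂ ⊎ V′)) → (W₂ → Tm V′) → W₁ ⊎ W₂ → Tm V′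
    both w₁ w₂ (inj₁ i) = sub [ w₂ , var ]′ (w₁ i)
    both w₁ w₂ (inj₂ i) = w₂ i
    correct : ∀ ρ (w : Env (W₁ ⊎ W₂)) → (∀ i → D (w i)) → ∃ λ w′ →
      w′ ∈ concatMap (λ w₁ → map (both w₁) Ws₂) Ws₁ × Agree T [ w , ρ ]′ [ (λ i → eval (w′ i) ρ) , ρ ]′
    correct ρ w d with proj₂ (E₁ T₁) [ w ∘ inj₂ , ρ ]′ (w ∘ inj₁) (d ∘ inj₁) | proj₂ (E₂ T₂) ρ (w ∘ inj₂) (d ∘ inj₂)
    ... | w₁ , w₁∈ , a₁ | w₂ , w₂∈ , a₂ = both w₁ w₂ , ∈-concatMap _ w₁∈ (∈-map⁺ (both w₁) w₂∈) , agree
      where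
      agree : Agree T [ w , ρ ]′ [ (λ i → eval (both w₁ w₂ i) ρ) , ρ ]′
      agree {t} t∈ = begin
        sgn (eval t [ w , ρ ]′)
          ≡⟨ cong sgn (trans (eval-sub _ t _) (eval-cong t λ { (inj₁ (inj₁ i)) → refl ; (inj₁ (inj₂ i)) → refl ; (inj₂ i) → refl })) ⟨
        sgn (eval (ren reassoc t) [ w ∘ inj₁ , [ w ∘ inj₂ , ρ ]′ ]′)
          ≡⟨ a₁ (∈-map⁺ (ren reassoc) t∈) ⟩
        sgn (eval (ren reassoc t) [ (λ i → eval (w₁ i) [ w ∘ inj₂ , ρ ]′) , [ w ∘ inj₂ , ρ ]′ ]′)
          ≡⟨ cong sgn (trans (eval-sub _ (ren reassoc t) _) (eval-cong (ren reassoc t) λ { (inj₁ i) → refl ; (inj₂ i) → refl })) ⟨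
        sgn (eval (sub [ w₁ , var ]′ (ren reassoc t)) [ w ∘ inj₂ , ρ ]′)
          ≡⟨ a₂ (∈-concatMap _ w₁∈ (∈-map⁺ _ (∈-map⁺ (ren reassoc) t∈))) ⟩
        sgn (eval (sub [ w₁ , var ]′ (ren reassoc t)) [ (λ i → eval (w₂ i) ρ) , ρ ]′)
          ≡⟨ cong sgn (trans (eval-sub _ (ren reassoc t) _) (trans (eval-sub _ t _)
              (eval-cong t λ { (inj₁ (inj₁ i)) → trans (eval-cong (w₁ i) λ { (inj₁ _) → refl ; (inj₂ _) → refl })
                                                   (sym (eval-sub _ (w₁ i) ρ))
                             ; (inj₁ (inj₂ i)) → refl ; (inj₂ i) → refl }))) ⟩
        sgn (eval t [ (λ i → eval (both w₁ w₂ i) ρ) , ρ ]′) ∎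
        where open ≡-Reasoning

  -- Terms made linear in `x` by naming auxiliary values.

  data Linear (A : Set) : Set where
    fixed : Tm A → Linear A
    -- stands for q (x − c)
    slope : (q : Scalar) → ¬ IsZero q → Tm A → Linear A

  evalLinear : ∀ {A} → Linear A → Γ → Env A → Γ∞
  evalLinear (fixed c) x ξ = eval c ξ
  evalLinear (slope q _ c) x ξ = q ·∞ (just x -∞ eval c ξ)

  renLinear : ∀ {A B} → (A → B) → Linear A → Linear B
  renLinear f (fixed c) = fixed (ren f c)
  renLinear f (slope q n c) = slope q n (ren f c)

  Extends : ∀ {A B} → (A → B) → Env A → Env B → Set ℓ
  Extends f ξ ξ′ = ∀ i → ξ′ (f i) ≡ ξ i

  eval-ren : ∀ {A B} {f : A → B} {ξ ξ′} c → Extends f ξ ξ′ → eval (ren f c) ξ′ ≡ eval c ξ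
  eval-ren c e = trans (eval-sub _ c _) (eval-cong c e)

  evalLinear-ren : ∀ {A B} {f : A → B} {ξ ξ′} l x → Extends f ξ ξ′ →
                   evalLinear (renLinear f l) x ξ′ ≡ evalLinear l x ξ
  evalLinear-ren (fixed c) x e = eval-ren c e
  evalLinear-ren (slope q _ c) x e = cong (λ z → q ·∞ (just x -∞ z)) (eval-ren c e)

  scale : ∀ {A} → Scalar → Linear A → Linear A
  scale r (fixed c) = fixed (r ⊙ c)
  scale r (slope q n c) with isZero? r
  -- Not `0ᵗ`: the value must stay ∞ when `c` is ∞.
  ... | yes _ = fixed (r ⊙ c)
  ... | no m = slope (r *ˢ q) (isZero-* r q m n) c

  scale-correct : ∀ {A} r (l : Linear A) x ξ → evalLinear (scale r l) x ξ ≡ r ·∞ evalLinear l x ξ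
  scale-correct r (fixed c) x ξ = refl
  scale-correct r (slope q n c) x ξ with isZero? r
  ... | yes z = lemma (eval c ξ)
    where
    lemma : ∀ y → r ·∞ y ≡ r ·∞ (q ·∞ (just x -∞ y))
    lemma nothing = refl
    lemma (just y) = cong just (trans (·-zero r y z) (sym (·-zero r _ z)))
  ... | no m = lemma (eval c ξ)
    where
    lemma : ∀ y → (r *ˢ q) ·∞ (just x -∞ y) ≡ r ·∞ (q ·∞ (just x -∞ y))
    lemma nothing = refl
    lemma (just y) = cong just (·-* r q _)

  plus : ∀ {A} → Linear A → Linear A → Linear A
  plus (fixed c) (fixed d) = fixed (c ⊕ d)
  plus (slope q n c) (fixed d) = slope q n (c ⊖ invˢ q ⊙ d)
  plus (fixed d) (slope q n c) = slope q n (c ⊖ invˢ q ⊙ d)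
  plus (slope q n c) (slope r m d) with isZero? (q +ˢ r)
  ... | yes _ = fixed ((-ˢ q) ⊙ c ⊕ (-ˢ r) ⊙ d)
  ... | no k = slope (q +ˢ r) k (invˢ (q +ˢ r) ⊙ (q ⊙ c ⊕ r ⊙ d))

  private
    slope-fixed : ∀ q x y z → ¬ IsZero q → q ·∞ (just x -∞ (y -∞ invˢ q ·∞ z)) ≡ add∞ (q ·∞ (just x -∞ y)) z
    slope-fixed q x nothing z n = refl
    slope-fixed q x (just y) nothing n = refl
    slope-fixed q x (just y) (just z) n = begin
      q ·∞ (just x -∞ (just y -∞ just (invˢ q · z)))   ≡⟨ cong (λ t → q ·∞ (just x -∞ t)) (just-minus y _) ⟩
      q ·∞ (just x -∞ just (y - invˢ q · z))           ≡⟨ cong (q ·∞_) (just-minus x _) ⟩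
      just (q · (x - (y - invˢ q · z)))                ≡⟨ cong (λ t → just (q · t))
        (solve 3 (λ x y z → (x ⊹ ⊟ (y ⊹ ⊟ z)) ≗ᵍ ((x ⊹ ⊟ y) ⊹ z)) refl x y (invˢ q · z)) ⟩
      just (q · ((x - y) + invˢ q · z))                ≡⟨ cong just (·-distrib q (x - y) _) ⟩
      just (q · (x - y) + q · (invˢ q · z))            ≡⟨ cong₂ (λ t u → just (q · t + u)) (cong (x +_) (sym (-1· y))) (*-inv q z n) ⟩
      add∞ (q ·∞ (just x -∞ just y)) (just z)          ∎
      where open ≡-Reasoning

    slope-slope₀ : ∀ q r x y z → IsZero (q +ˢ r) →
      add∞ ((-ˢ q) ·∞ y) ((-ˢ r) ·∞ z) ≡ add∞ (q ·∞ (just x -∞ y)) (r ·∞ (just x -∞ z))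
    slope-slope₀ q r x nothing z k = refl
    slope-slope₀ q r x (just y) nothing k = refl
    slope-slope₀ q r x (just y) (just z) k = begin
      just ((-ˢ q) · y + (-ˢ r) · z)               ≡⟨ cong₂ (λ a b → just (a + b)) (·-neg q y) (·-neg r z) ⟩
      just (- (q · y) + - (r · z))                 ≡⟨ cong just (+-identityˡ _) ⟨
      just (0# + (- (q · y) + - (r · z)))          ≡⟨ cong (λ t → just (t + (- (q · y) + - (r · z)))) (·-zero (q +ˢ r) x k) ⟨
      just ((q +ˢ r) · x + (- (q · y) + - (r · z))) ≡⟨ cong (λ t → just (t + (- (q · y) + - (r · z)))) (·-+ q r x) ⟩
      just ((q · x + r · x) + (- (q · y) + - (r · z)))
        ≡⟨ cong just (interchange (q · x) (r · x) _ _) ⟩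
      just ((q · x - q · y) + (r · x - r · z))     ≡⟨ cong₂ (λ a b → just (a + b)) (·-minus q x y) (·-minus r x z) ⟨
      just (q · (x - y) + r · (x - z))             ≡⟨ cong₂ (λ a b → just (q · (x + a) + r · (x + b))) (-1· y) (-1· z) ⟨
      add∞ (q ·∞ (just x -∞ just y)) (r ·∞ (just x -∞ just z)) ∎
      where open ≡-Reasoning

    slope-slope : ∀ q r x y z → ¬ IsZero (q +ˢ r) →
      (q +ˢ r) ·∞ (just x -∞ (invˢ (q +ˢ r) ·∞ add∞ (q ·∞ y) (r ·∞ z))) ≡
      add∞ (q ·∞ (just x -∞ y)) (r ·∞ (just x -∞ z))
    slope-slope q r x nothing z k = refl
    slope-slope q r x (just y) nothing k = refl
    slope-slope q r x (just y) (just z) k = begin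
      (q +ˢ r) ·∞ (just x -∞ just (invˢ (q +ˢ r) · (q · y + r · z)))
        ≡⟨ cong ((q +ˢ r) ·∞_) (just-minus x _) ⟩
      just ((q +ˢ r) · (x - invˢ (q +ˢ r) · (q · y + r · z)))
        ≡⟨ cong just (·-minus (q +ˢ r) x _) ⟩
      just ((q +ˢ r) · x - (q +ˢ r) · (invˢ (q +ˢ r) · (q · y + r · z)))
        ≡⟨ cong₂ (λ a b → just (a - b)) (·-+ q r x) (*-inv (q +ˢ r) _ k) ⟩
      just ((q · x + r · x) - (q · y + r · z))
        ≡⟨ cong just (solve 4 (λ a b c d → ((a ⊹ b) ⊹ ⊟ (c ⊹ d)) ≗ᵍ ((a ⊹ ⊟ c) ⊹ (b ⊹ ⊟ d))) refl (q · x) (r · x) (q · y) (r · z)) ⟩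
      just ((q · x - q · y) + (r · x - r · z))     ≡⟨ cong₂ (λ a b → just (a + b)) (·-minus q x y) (·-minus r x z) ⟨
      just (q · (x - y) + r · (x - z))             ≡⟨ cong₂ (λ a b → just (q · (x + a) + r · (x + b))) (-1· y) (-1· z) ⟨
      add∞ (q ·∞ (just x -∞ just y)) (r ·∞ (just x -∞ just z)) ∎
      where open ≡-Reasoning

  plus-correct : ∀ {A} (l m : Linear A) x ξ → evalLinear (plus l m) x ξ ≡ add∞ (evalLinear l x ξ) (evalLinear m x ξ)
  plus-correct (fixed c) (fixed d) x ξ = refl
  plus-correct (slope q n c) (fixed d) x ξ = slope-fixed q x (eval c ξ) (eval d ξ) n
  plus-correct (fixed d) (slope q n c) x ξ = trans (slope-fixed q x (eval c ξ) (eval d ξ) n) (add∞-comm _ (eval d ξ))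
  plus-correct (slope q n c) (slope r m d) x ξ with isZero? (q +ˢ r)
  ... | yes k = slope-slope₀ q r x (eval c ξ) (eval d ξ) k
  ... | no k = slope-slope q r x (eval c ξ) (eval d ξ) k

  -- A constraint on x: to preserve V q (x − c), the value of the term name,
  -- and if q = 0 also the sign of x − c.
  record Constraint (A : Set) : Set where
    constructor constraint
    field
      center′ : Tm A
      coeff   : Scalar
      name    : Tm A

  open Constraint

  renConstraint : ∀ {A B} → (A → B) → Constraint A → Constraint B
  renConstraint f (constraint c q n) = constraint (ren f c) q (ren f n)

  key : ∀ {A} → Constraint A → Γ → Env A → Γ∞
  key κ x ξ = V∞ (coeff κ) (just x -∞ eval (center′ κ) ξ)

  Preserved : ∀ {A} → Constraint A → Γ → Γ → Env A → Set ℓ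
  Preserved κ x x′ ξ = key κ x′ ξ ≡ key κ x ξ ×
    (IsZero (coeff κ) → sgn (just x′ -∞ eval (center′ κ) ξ) ≡ sgn (just x -∞ eval (center′ κ) ξ))

  AllPreserved : ∀ {A} → List (Constraint A) → Γ → Γ → Env A → Set ℓ
  AllPreserved cs x x′ ξ = ∀ {κ} → κ ∈ cs → Preserved κ x x′ ξ

  key-ren : ∀ {A B} {f : A → B} {ξ ξ′} κ x → Extends f ξ ξ′ → key (renConstraint f κ) x ξ′ ≡ key κ x ξ
  key-ren (constraint c q n) x e = cong (λ z → V∞ q (just x -∞ z)) (eval-ren c e)

  preserved-ren : ∀ {A B} {f : A → B} {ξ ξ′} cs {x x′} → Extends f ξ ξ′ →
                  AllPreserved (map (renConstraint f) cs) x x′ ξ′ → AllPreserved cs x x′ ξ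
  preserved-ren {f = f} {ξ} {ξ′} cs {x} {x′} e p {κ} κ∈ with p (∈-map⁺ (renConstraint f) κ∈)
  ... | k , σ = trans (sym (key-ren κ x′ e)) (trans k (key-ren κ x e)) , λ z →
    subst (λ y → sgn (just x′ -∞ y) ≡ sgn (just x -∞ y)) (eval-ren (center′ κ) e) (σ z)

  module _ {Var : Set} where

    -- Auxiliary values, determined by x and ρ, that do not change when x moves
    -- subject to the constraints cs.
    record System : Set (lsuc Level.zero ⊔ ℓ) where
      field
        Aux    : Set
        elim   : Elim Aux InΨ₀
        cs     : List (Constraint (Aux ⊎ Var))
        aux    : Γ → Env Var → Env Aux
        aux∈   : ∀ x ρ i → InΨ₀ (aux x ρ i)
      env : Γ → Env Var → Env (Aux ⊎ Var)
      env x ρ = [ aux x ρ , ρ ]′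
      -- The centers are evaluated at the auxiliary values of `x`; that `x′` has the same ones is
      -- concluded in `stable`, not assumed.
      Moves : Env Var → Γ → Γ → Set ℓ
      Moves ρ x x′ = AllPreserved cs x x′ (env x ρ)
      field
        named  : ∀ x ρ {κ} → κ ∈ cs → eval (name κ) (env x ρ) ≡ key κ x (env x ρ)
        stable : ∀ {ρ x x′} → Moves ρ x x′ → ∀ i → aux x′ ρ i ≡ aux x ρ i

      env-stable : ∀ {ρ x x′} → Moves ρ x x′ → ∀ i → env x′ ρ i ≡ env x ρ i
      env-stable m (inj₁ i) = stable m i
      env-stable m (inj₂ i) = refl

    open System

    empty : System
    empty = record { Aux = ⊥ ; elim = elim-⊥ {InΨ₀} ; cs = [] ; aux = λ _ _ () ; aux∈ = λ _ _ ()
                   ; named = λ _ _ () ; stable = λ _ () }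

    module Join (S T : System) where
      left : Aux S ⊎ Var → (Aux S ⊎ Aux T) ⊎ Var
      left = [ inj₁ ∘ inj₁ , inj₂ ]′
      right : Aux T ⊎ Var → (Aux S ⊎ Aux T) ⊎ Var
      right = [ inj₁ ∘ inj₂ , inj₂ ]′
      aux⊎ : Γ → Env Var → Env (Aux S ⊎ Aux T)
      aux⊎ x ρ = [ aux S x ρ , aux T x ρ ]′
      left-extends : ∀ x ρ → Extends left (env S x ρ) [ aux⊎ x ρ , ρ ]′
      left-extends x ρ (inj₁ _) = refl
      left-extends x ρ (inj₂ _) = refl
      right-extends : ∀ x ρ → Extends right (env T x ρ) [ aux⊎ x ρ , ρ ]′
      right-extends x ρ (inj₁ _) = refl
      right-extends x ρ (inj₂ _) = refl
      csS csT : List (Constraint ((Aux S ⊎ Aux T) ⊎ Var))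
      csS = map (renConstraint left) (cs S)
      csT = map (renConstraint right) (cs T)
      movesS : ∀ {ρ x x′} → AllPreserved (csS ++ csT) x x′ [ aux⊎ x ρ , ρ ]′ → Moves S ρ x x′
      movesS {ρ} {x} p = preserved-ren (cs S) (left-extends x ρ) (λ i → p (∈-++⁺ˡ i))
      movesT : ∀ {ρ x x′} → AllPreserved (csS ++ csT) x x′ [ aux⊎ x ρ , ρ ]′ → Moves T ρ x x′
      movesT {ρ} {x} p = preserved-ren (cs T) (right-extends x ρ) (λ i → p (∈-++⁺ʳ csS i))

      join : System
      join = record
        { Aux = Aux S ⊎ Aux T
        ; elim = elim-⊎ {D = InΨ₀} (elim S) (elim T)
        ; cs = csS ++ csT
        ; aux = aux⊎
        ; aux∈ = λ { x ρ (inj₁ i) → aux∈ S x ρ i ; x ρ (inj₂ i) → aux∈ T x ρ i }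
        ; named = named⊎
        ; stable = λ { p (inj₁ i) → stable S (movesS p) i ; p (inj₂ i) → stable T (movesT p) i }
        }
        where
        named⊎ : ∀ x ρ {κ} → κ ∈ csS ++ csT → eval (name κ) [ aux⊎ x ρ , ρ ]′ ≡ key κ x [ aux⊎ x ρ , ρ ]′
        named⊎ x ρ κ∈ with ∈-++⁻ csS κ∈
        ... | inj₁ i with ∈-map⁻ (renConstraint left) i
        ...   | κ , κ∈S , refl = trans (eval-ren (name κ) (left-extends x ρ))
                  (trans (named S x ρ κ∈S) (sym (key-ren κ x (left-extends x ρ))))
        named⊎ x ρ κ∈ | inj₂ i with ∈-map⁻ (renConstraint right) i
        ...   | κ , κ∈T , refl = trans (eval-ren (name κ) (right-extends x ρ))
                  (trans (named T x ρ κ∈T) (sym (key-ren κ x (right-extends x ρ))))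

    -- Names `V q (x - c)` and requires it to be preserved; the name lets witnesses mention this
    -- value by a term.
    module AddKey (S : System) (c : Tm (Aux S ⊎ Var)) (q : Scalar) where
      lift : Aux S ⊎ Var → (⊤ ⊎ Aux S) ⊎ Var
      lift = [ inj₁ ∘ inj₂ , inj₂ ]′
      value : Γ → Env Var → Γ∞
      value x ρ = V∞ q (just x -∞ eval c (env S x ρ))
      aux′ : Γ → Env Var → Env (⊤ ⊎ Aux S)
      aux′ x ρ = [ const (value x ρ) , aux S x ρ ]′
      extends : ∀ x ρ → Extends lift (env S x ρ) [ aux′ x ρ , ρ ]′
      extends x ρ (inj₁ _) = refl
      extends x ρ (inj₂ _) = refl
      new : Constraint ((⊤ ⊎ Aux S) ⊎ Var)
      new = constraint (ren lift c) q (var (inj₁ (inj₁ tt)))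
      cs′ : List (Constraint ((⊤ ⊎ Aux S) ⊎ Var))
      cs′ = new ∷ map (renConstraint lift) (cs S)
      moves : ∀ {ρ x x′} → AllPreserved cs′ x x′ [ aux′ x ρ , ρ ]′ → Moves S ρ x x′
      moves {ρ} {x} p = preserved-ren (cs S) (extends x ρ) (λ i → p (there i))
      preserved : ∀ {ρ x x′} → AllPreserved cs′ x x′ [ aux′ x ρ , ρ ]′ →
        Preserved (constraint c q c) x x′ (env S x ρ)
      preserved {ρ} {x} {x′} p with p (here refl)
      ... | k , σ = trans (sym (at x′)) (trans k (at x)) , λ z →
          subst (λ y → sgn (just x′ -∞ y) ≡ sgn (just x -∞ y)) (eval-ren c (extends x ρ)) (σ z)
        where
        at : ∀ y → V∞ q (just y -∞ eval (ren lift c) [ aux′ x ρ , ρ ]′) ≡ V∞ q (just y -∞ eval c (env S x ρ))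
        at y = cong (λ z → V∞ q (just y -∞ z)) (eval-ren c (extends x ρ))

      addKey : System
      addKey = record
        { Aux = ⊤ ⊎ Aux S
        ; elim = elim-⊎ {D = InΨ₀} elimΨ (elim S)
        ; cs = cs′
        ; aux = aux′
        ; aux∈ = λ { x ρ (inj₁ tt) → inj₁ (V∞-InΨ∞ q (just x -∞ eval c (env S x ρ))) ; x ρ (inj₂ i) → aux∈ S x ρ i }
        ; named = named′
        ; stable = stable′
        }
        where
        named′ : ∀ x ρ {κ} → κ ∈ cs′ → eval (name κ) [ aux′ x ρ , ρ ]′ ≡ key κ x [ aux′ x ρ , ρ ]′
        named′ x ρ (here refl) = cong (λ z → V∞ q (just x -∞ z)) (sym (eval-ren c (extends x ρ)))
        named′ x ρ (there i) with ∈-map⁻ (renConstraint lift) i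
        ... | κ , κ∈ , refl = trans (eval-ren (name κ) (extends x ρ))
                (trans (named S x ρ κ∈) (sym (key-ren κ x (extends x ρ))))
        stable′ : ∀ {ρ x x′} → AllPreserved cs′ x x′ [ aux′ x ρ , ρ ]′ → ∀ i → aux′ x′ ρ i ≡ aux′ x ρ i
        stable′ {ρ} {x} {x′} p (inj₁ tt) = trans
          (cong (λ z → V∞ q (just x′ -∞ z)) (eval-cong c (env-stable S {ρ} {x} {x′} (moves p))))
          (proj₁ (preserved p))
        stable′ p (inj₂ i) = stable S (moves p) i

    -- Names a value that the present constraints already keep fixed, so no constraint is added.
    module AddValue (S : System) (value : Γ → Env Var → Γ∞) (value∈ : ∀ x ρ → InΨ₀ (value x ρ))
             (value-stable : ∀ {ρ x x′} → Moves S ρ x x′ → value x′ ρ ≡ value x ρ) where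
      lift : Aux S ⊎ Var → (⊤ ⊎ Aux S) ⊎ Var
      lift = [ inj₁ ∘ inj₂ , inj₂ ]′
      aux′ : Γ → Env Var → Env (⊤ ⊎ Aux S)
      aux′ x ρ = [ const (value x ρ) , aux S x ρ ]′
      extends : ∀ x ρ → Extends lift (env S x ρ) [ aux′ x ρ , ρ ]′
      extends x ρ (inj₁ _) = refl
      extends x ρ (inj₂ _) = refl
      moves : ∀ {ρ x x′} → AllPreserved (map (renConstraint lift) (cs S)) x x′ [ aux′ x ρ , ρ ]′ → Moves S ρ x x′
      moves {ρ} {x} p = preserved-ren (cs S) (extends x ρ) p

      addValue : System
      addValue = record
        { Aux = ⊤ ⊎ Aux S
        ; elim = elim-⊎ {D = InΨ₀} elimΨ (elim S)
        ; cs = map (renConstraint lift) (cs S)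
        ; aux = aux′
        ; aux∈ = λ { x ρ (inj₁ tt) → value∈ x ρ ; x ρ (inj₂ i) → aux∈ S x ρ i }
        ; named = named′
        ; stable = λ { p (inj₁ tt) → value-stable (moves p) ; p (inj₂ i) → stable S (moves p) i }
        }
        where
        named′ : ∀ x ρ {κ} → κ ∈ map (renConstraint lift) (cs S) → eval (name κ) [ aux′ x ρ , ρ ]′ ≡ key κ x [ aux′ x ρ , ρ ]′
        named′ x ρ i with ∈-map⁻ (renConstraint lift) i
        ... | κ , κ∈ , refl = trans (eval-ren (name κ) (extends x ρ))
                (trans (named S x ρ κ∈) (sym (key-ren κ x (extends x ρ))))

    Flat : Tm (⊤ ⊎ Var) → Set (lsuc Level.zero ⊔ ℓ)
    Flat t = Σ System λ S → Σ (Linear (Aux S ⊎ Var)) λ l →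
      ∀ x ρ → eval t [ const (just x) , ρ ]′ ≡ evalLinear l x (env S x ρ)

    -- o (q (x − c)) is a function of V (opCoeff o q) (x − c).
    opCoeff : Op → Scalar → Scalar
    opCoeff ψᵒ q = 0ˢ
    opCoeff χᵒ q = 0ˢ
    opCoeff (sᵒ _) q = -ˢ invˢ q

    -- `s (q · y)` is the distance from `q · y` to λ; dividing by `q` turns it into the valuation of
    -- `y - λ / q`, which is `V (-ˢ invˢ q) y`. χ is read from `v`, which is ∞ only at 0.
    opCoeff-correct : ∀ o q y y′ → ¬ IsZero q → V (opCoeff o q) y′ ≡ V (opCoeff o q) y →
                      ⟦ o ⟧ (just (q · y′)) ≡ ⟦ o ⟧ (just (q · y))
    opCoeff-correct ψᵒ q y y′ n e = trans (v-· q y′ n) (trans (sym (V-zero 0ˢ y′ refl))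
      (trans e (trans (V-zero 0ˢ y refl) (sym (v-· q y n)))))
    opCoeff-correct χᵒ q y y′ n e with y O.≟ 0# | y′ O.≟ 0#
    ... | yes refl | yes refl = refl
    ... | no p | no p′ = trans (χ∞-≢0 (·-nonzero q n p′)) (sym (χ∞-≢0 (·-nonzero q n p)))
    ... | yes refl | no p = ⊥-elim (p (v-nothing (trans (sym (V-zero 0ˢ y′ refl)) (trans e (trans (V-zero 0ˢ 0# refl) v-0)))))
    ... | no p | yes refl = ⊥-elim (p (v-nothing (trans (sym (V-zero 0ˢ y refl)) (trans (sym e) (trans (V-zero 0ˢ 0# refl) v-0)))))
    opCoeff-correct (sᵒ g) q y y′ n e = cong (preds g) (trans (sym (at y′)) (trans e (at y)))
      where
      at : ∀ y → V (-ˢ invˢ q) y ≡ just (s (q · y))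
      at y = trans (V-nonzero (-ˢ invˢ q) y (λ z → n (isZero-inv q (isZero-neg (invˢ q) z))))
        (cong (λ r → just (s (r · y))) (neg-inv-involutive q n))

    op-InΨ₀ : ∀ o x → InΨ₀ (⟦ o ⟧ x)
    op-InΨ₀ ψᵒ nothing = inj₁ ⊤ₚ.tt
    op-InΨ₀ ψᵒ (just x) with v x in e
    ... | nothing = inj₁ ⊤ₚ.tt
    ... | just u = inj₁ (v-InΨ e)
    op-InΨ₀ χᵒ nothing = inj₁ (subst InΨ∞ (sym χ∞-∞) ⊤ₚ.tt)
    op-InΨ₀ χᵒ (just x) with x O.≟ 0#
    ... | yes p = inj₂ (χ∞-0 p)
    ... | no p = inj₁ (subst InΨ∞ (sym (χ∞-≢0 p)) ⊤ₚ.tt)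
    op-InΨ₀ (sᵒ zero) nothing = inj₁ ⊤ₚ.tt
    op-InΨ₀ (sᵒ zero) (just x) = inj₁ (s∈Ψ x)
    op-InΨ₀ (sᵒ (suc g)) x = inj₁ (pred-InΨ∞ (preds g (s∞ x)))

    -- An operation applied to `q (x - c)` becomes a variable: the key `V (opCoeff o q) (x - c)` is
    -- named and constrained, which fixes the value of the operation, and this value gets a name as
    -- well. So `x` itself occurs only linearly.
    flat : ∀ t → Flat t
    flat (var (inj₁ tt)) = empty , slope 1ˢ (λ ()) 0ᵗ , λ x ρ →
      cong just (sym (trans (·-1 _) (trans (cong (x +_) (·-0 (-ˢ 1ˢ))) (+-identityʳ x))))
    flat (var (inj₂ i)) = empty , fixed (var (inj₂ i)) , λ _ _ → refl
    flat 0ᵗ = empty , fixed 0ᵗ , λ _ _ → refl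
    flat ∞ᵗ = empty , fixed ∞ᵗ , λ _ _ → refl
    flat (t ⊕ u) with flat t | flat u
    ... | S , l , h | T , m , k = join , plus (renLinear left l) (renLinear right m) , λ x ρ →
      trans (cong₂ add∞ (trans (h x ρ) (sym (evalLinear-ren l x (left-extends x ρ))))
                        (trans (k x ρ) (sym (evalLinear-ren m x (right-extends x ρ)))))
        (sym (plus-correct (renLinear left l) (renLinear right m) x (env join x ρ)))
      where open Join S T
    flat (q ⊙ t) with flat t
    ... | S , l , h = S , scale q l , λ x ρ →
      trans (cong (q ·∞_) (h x ρ)) (sym (scale-correct q l x (env S x ρ)))
    flat (op o t) with flat t
    ... | S , fixed c , h = S , fixed (op o c) , λ x ρ → cong ⟦ o ⟧ (h x ρ)
    ... | S , slope q n c , h = addValue , fixed (var (inj₁ (inj₁ tt))) , λ x ρ → refl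
      where
      open AddKey S c (opCoeff o q)
      value′ : Γ → Env Var → Γ∞
      value′ x ρ = ⟦ o ⟧ (eval t [ const (just x) , ρ ]′)
      stable′ : ∀ {ρ x x′} → Moves addKey ρ x x′ → value′ x′ ρ ≡ value′ x ρ
      stable′ {ρ} {x} {x′} p = trans (cong ⟦ o ⟧ (trans (h x′ ρ)
          (cong (λ z → q ·∞ (just x′ -∞ z)) (eval-cong c (env-stable S {ρ} {x} {x′} (moves p))))))
        (trans (same (eval c (env S x ρ)) (proj₁ (preserved p))) (cong ⟦ o ⟧ (sym (h x ρ))))
        where
        same : ∀ y → V∞ (opCoeff o q) (just x′ -∞ y) ≡ V∞ (opCoeff o q) (just x -∞ y) →
               ⟦ o ⟧ (q ·∞ (just x′ -∞ y)) ≡ ⟦ o ⟧ (q ·∞ (just x -∞ y))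
        same nothing e = refl
        same (just y) e = opCoeff-correct o q _ _ n e
      open AddValue addKey value′ (λ x ρ → op-InΨ₀ o (eval t [ const (just x) , ρ ]′)) stable′ using (addValue)

    FlatList : List (Tm (⊤ ⊎ Var)) → Set (lsuc Level.zero ⊔ ℓ)
    FlatList T = Σ System λ S → ∀ {ρ x x′} → Moves S ρ x x′ →
      Agree T [ const (just x) , ρ ]′ [ const (just x′) , ρ ]′

    flatList : ∀ T → FlatList T
    flatList [] = empty , λ _ ()
    flatList (t ∷ T) with flat t | flatList T
    ... | S , fixed c , h | R , k = join , λ
        { {ρ} {x} {x′} p (here refl) → cong sgn (trans (h x ρ) (trans
            (sym (eval-cong c (env-stable S {ρ} {x} {x′} (movesS p)))) (sym (h x′ ρ))))
        ; p (there t∈) → k (movesT p) t∈ }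
      where open Join S R
    ... | S , slope q n c , h | R , k = join , λ
        { {ρ} {x} {x′} p (here refl) → trans (cong sgn (h x ρ)) (trans
            (same (eval c (env S x ρ)) (proj₂ (preserved (movesS p)) refl))
            (cong sgn (trans (cong (λ z → q ·∞ (just x′ -∞ z))
              (sym (eval-cong c (env-stable S {ρ} {x} {x′} (moves (movesS p)))))) (sym (h x′ ρ)))))
        ; p (there t∈) → k (movesT p) t∈ }
      where
      -- With coefficient 0 the constraint also protects the sign of `x - c`.
      open AddKey S c 0ˢ
      open Join addKey R
      same : ∀ {x x′} y → sgn (just x′ -∞ y) ≡ sgn (just x -∞ y) →
             sgn (q ·∞ (just x -∞ y)) ≡ sgn (q ·∞ (just x′ -∞ y))
      same nothing e = refl
      same (just y) e = sign-· q (sym e)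

-- Witnesses in the gaps between finitely many points.

module Witnesses {ℓ} (M : T0Model ℓ) where

  open Elimination M public
  open Constraint

  v-≥-minus : ∀ {w} x a b → just w ≤∞ v (x - a) → just w ≤∞ v (x - b) → just w ≤∞ v (a - b)
  v-≥-minus x a b p q = subst (λ z → _ ≤∞ v z)
    (solve 3 (λ x a b → ((x ⊹ ⊟ b) ⊹ ⊟ (x ⊹ ⊟ a)) ≗ᵍ (a ⊹ ⊟ b)) refl x a b)
    (v-ultra- (x - b) (x - a) q p)

  -- Points at valuation w from x: moving x to the middle of its gap, or by e
  -- beyond the last point, changes neither valuations nor signs.
  module Gap {k} {N : Fin k → Set ℓ} (N? : ∀ i → Dec (N i)) (pt : Fin k → Γ) (x w e : Γ)
             (0<e : 0# < e) (ve : v e ≡ just w) (near : ∀ i → N i → v (x - pt i) ≡ just w)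
             (base : ∃ N) where

    data Choice : Γ → Set ℓ where
      mid  : ∀ i j → N i → N j → Choice (½ˢ · (pt i + pt j))
      up   : ∀ i → N i → Choice (pt i + e)
      down : ∀ i → N i → Choice (pt i - e)

    Goal : Γ → Set ℓ
    Goal x′ = ∀ i → N i → v (x′ - pt i) ≡ just w × sign (x′ - pt i) ≡ sign (x - pt i)

    _<?_ : ∀ a b → Dec (a < b)
    a <? b with O._<⊎≥_ a b
    ... | inj₁ p = yes p
    ... | inj₂ p = no (O.≤⇒≯ p)

    dist : ∀ i j → N i → N j → just w ≤∞ v (pt i - pt j)
    dist i j ni nj = v-≥-minus x (pt i) (pt j) (inj₂ (sym (near i ni))) (inj₂ (sym (near j nj)))

    Lower Upper : Γ → Set ℓ
    Lower x′ = ∀ i → N i → pt i < x → pt i < x′ × v (x′ - pt i) ≤∞ just w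
    Upper x′ = ∀ i → N i → x < pt i → x′ < pt i × v (x′ - pt i) ≤∞ just w

    -- The point `l` and the ultrametric inequality bound all valuations from below by `w`; `Lower`
    -- and `Upper` bound them from above and keep `x′` on the right side of each point.
    finish : ∀ x′ l → N l → just w ≤∞ v (x′ - pt l) → Lower x′ → Upper x′ → Goal x′
    finish x′ l nl p lo hi i ni = go (O.compare (pt i) x)
      where
      ≥w : just w ≤∞ v (x′ - pt i)
      ≥w = subst (λ z → just w ≤∞ v z)
        (solve 3 (λ x a b → ((x ⊹ ⊟ a) ⊹ (a ⊹ ⊟ b)) ≗ᵍ (x ⊹ ⊟ b)) refl x′ (pt l) (pt i))
        (v-ultra (x′ - pt l) (pt l - pt i) p (dist l i nl ni))
      minus-neg : ∀ {a b} → a < b → sign (a - b) ≡ neg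
      minus-neg {b = b} r = sign-neg (<-cong refl (+-inverseʳ b) (+-mono-< (- b) r))
      go : Tri (pt i < x) (pt i ≡ x) (x < pt i) → v (x′ - pt i) ≡ just w × sign (x′ - pt i) ≡ sign (x - pt i)
      go (tri< q _ _) with lo i ni q
      ... | r , ≤w = O∞.≤-antisym ≤w ≥w , trans (sign-pos (<⇒0<- r)) (sym (sign-pos (<⇒0<- q)))
      go (tri> _ _ q) with hi i ni q
      ... | r , ≤w = O∞.≤-antisym ≤w ≥w , trans (minus-neg r) (sym (minus-neg q))
      go (tri≈ _ q _) with () ← trans (sym (near i ni)) (v-≡0 (trans (cong (λ z → x - z) q) (+-inverseʳ x)))

    -- `pt l` is the closest point from below, so `x′ - pt i` is at least `x′ - pt l` and convexity
    -- bounds its valuation.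
    lower-bound : ∀ x′ l → 0# < x′ - pt l → v (x′ - pt l) ≤∞ just w →
            (∀ i → N i → pt i < x → pt i ≤ pt l) → Lower x′
    lower-bound x′ l 0<d d≤w m i ni p = O.≤-<-trans (m i ni p) (0<-⇒< 0<d) ,
      O∞.≤-trans (v-conv 0<d (+-monoʳ-≤ x′ (neg-mono-≤ (m i ni p)))) d≤w

    upper-bound : ∀ x′ l → 0# < pt l - x′ → v (pt l - x′) ≤∞ just w →
            (∀ i → N i → x < pt i → pt l ≤ pt i) → Upper x′
    upper-bound x′ l 0<d d≤w m i ni p = O.<-≤-trans (0<-⇒< 0<d) (m i ni p) ,
      subst (_≤∞ just w) (v-minus-comm (pt i) x′) (O∞.≤-trans (v-conv 0<d (+-monoˡ-≤ (- x′) (m i ni p))) d≤w)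

    -- No point equals `x`, since its valuation would be ∞. Between two neighbours the midpoint
    -- works: their difference is larger than that from the lower one to `x`, so its valuation is at
    -- most `w`, and it is at least `w` by `dist`.
    choose-gap : ∃ λ x′ → Choice x′ × Goal x′
    choose-gap with maximal (λ i → N? i ×-dec (pt i <? x)) (λ i → just (pt i))
                  -- Negated keys select the smallest point above `x`.
                  | maximal (λ i → N? i ×-dec (x <? pt i)) (λ i → just (- pt i))
    ... | inj₁ none | inj₁ none′ = ⊥-elim (contra (O.compare (pt i₀) x))
      where
      i₀ = proj₁ base
      contra : ¬ Tri (pt i₀ < x) (pt i₀ ≡ x) (x < pt i₀)
      contra (tri< p _ _) = none i₀ (proj₂ base , p)
      contra (tri> _ _ p) = none′ i₀ (proj₂ base , p)
      contra (tri≈ _ q _) with () ← trans (sym (near i₀ (proj₂ base))) (v-≡0 (trans (cong (λ z → x - z) q) (+-inverseʳ x)))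
    ... | inj₂ (l , (nl , l<x) , m) | inj₁ none = pt l + e , up l nl ,
          finish (pt l + e) l nl (inj₂ (sym vd))
            (lower-bound (pt l + e) l (<-cong refl (sym d≡e) 0<e) (inj₂ vd) (λ i ni p → ≤-just (m i (ni , p))))
            (λ i ni p → ⊥-elim (none i (ni , p)))
      where
      d≡e : (pt l + e) - pt l ≡ e
      d≡e = solve 2 (λ a e → ((a ⊹ e) ⊹ ⊟ a) ≗ᵍ e) refl (pt l) e
      vd : v ((pt l + e) - pt l) ≡ just w
      vd = trans (cong v d≡e) ve
    ... | inj₁ none | inj₂ (u , (nu , x<u) , m) = pt u - e , down u nu ,
          finish (pt u - e) u nu (inj₂ (sym (trans (v-minus-comm _ (pt u)) vd)))
            (λ i ni p → ⊥-elim (none i (ni , p)))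
            (upper-bound (pt u - e) u (<-cong refl (sym d≡e) 0<e) (inj₂ vd) (λ i ni p → neg-cancel-≤ (≤-just (m i (ni , p)))))
      where
      d≡e : pt u - (pt u - e) ≡ e
      d≡e = solve 2 (λ a e → (a ⊹ ⊟ (a ⊹ ⊟ e)) ≗ᵍ e) refl (pt u) e
      vd : v (pt u - (pt u - e)) ≡ just w
      vd = trans (cong v d≡e) ve
    ... | inj₂ (l , (nl , l<x) , m) | inj₂ (u , (nu , x<u) , m′) = x′ , mid l u nl nu ,
          finish x′ l nl (subst (just w ≤∞_) (sym (trans (cong v left) (v-· ½ˢ _ (λ ())))) (dist u l nu nl))
            (lower-bound x′ l (<-cong refl (sym left) (half-pos 0<u-l)) (O∞.≤-trans (inj₂ (trans (cong v left) (v-· ½ˢ _ (λ ())))) u-l≤w)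
              (λ i ni p → ≤-just (m i (ni , p))))
            (upper-bound x′ u (<-cong refl (sym right) (half-pos 0<u-l)) (O∞.≤-trans (inj₂ (trans (cong v right) (v-· ½ˢ _ (λ ())))) u-l≤w)
              (λ i ni p → neg-cancel-≤ (≤-just (m′ i (ni , p)))))
      where
      x′ : Γ
      x′ = ½ˢ · (pt l + pt u)
      0<u-l : 0# < pt u - pt l
      0<u-l = <⇒0<- (O.<-trans l<x x<u)
      u-l≤w : v (pt u - pt l) ≤∞ just w
      u-l≤w = O∞.≤-trans (v-conv (<⇒0<- l<x) (inj₁ (+-mono-< (- pt l) x<u))) (inj₂ (near l nl))
      left : x′ - pt l ≡ ½ˢ · (pt u - pt l)
      left = begin
        x′ - pt l                                       ≡⟨ cong (λ z → x′ - z) (half-+-half (pt l)) ⟨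
        x′ - (½ˢ · pt l + ½ˢ · pt l)                    ≡⟨ cong (λ z → z - (½ˢ · pt l + ½ˢ · pt l)) (·-distrib ½ˢ (pt l) (pt u)) ⟩
        (½ˢ · pt l + ½ˢ · pt u) - (½ˢ · pt l + ½ˢ · pt l)
          ≡⟨ solve 2 (λ a b → ((a ⊹ b) ⊹ ⊟ (a ⊹ a)) ≗ᵍ (b ⊹ ⊟ a)) refl (½ˢ · pt l) (½ˢ · pt u) ⟩
        ½ˢ · pt u - ½ˢ · pt l                           ≡⟨ ·-minus ½ˢ (pt u) (pt l) ⟨
        ½ˢ · (pt u - pt l)                              ∎
        where open ≡-Reasoning
      right : pt u - x′ ≡ ½ˢ · (pt u - pt l)
      right = begin
        pt u - x′                                       ≡⟨ cong (λ z → z - x′) (half-+-half (pt u)) ⟨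
        (½ˢ · pt u + ½ˢ · pt u) - x′                    ≡⟨ cong (λ z → (½ˢ · pt u + ½ˢ · pt u) - z) (·-distrib ½ˢ (pt l) (pt u)) ⟩
        (½ˢ · pt u + ½ˢ · pt u) - (½ˢ · pt l + ½ˢ · pt u)
          ≡⟨ solve 2 (λ a b → ((b ⊹ b) ⊹ ⊟ (a ⊹ b)) ≗ᵍ (b ⊹ ⊟ a)) refl (½ˢ · pt l) (½ˢ · pt u) ⟩
        ½ˢ · pt u - ½ˢ · pt l                           ≡⟨ ·-minus ½ˢ (pt u) (pt l) ⟨
        ½ˢ · (pt u - pt l)                              ∎
        where open ≡-Reasoning

  -- `y′ + q λ` is `y + q λ` plus an element of larger valuation; a dominating `u` stands for λ in
  -- the computation.
  V-close : ∀ q y y′ {w} → V q y <∞ just w → just w ≤∞ v (y′ - y) →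
            V q y′ ≡ V q y × (IsZero q → sign y′ ≡ sign y)
  V-close q y y′ {w} p r with dominating q y
  ... | u , u∈ , d = value , λ z → trans (cong sign y′-split) (sign-dom y (y′ - y)
          (subst (_<∞ v (y′ - y)) (V-zero q y z) lt))
    where
    lt : V q y <∞ v (y′ - y)
    lt = O∞.<-≤-trans {x = V q y} p r
    y′-split : y′ ≡ y + (y′ - y)
    y′-split = solve 2 (λ a b → b ≗ᵍ (a ⊹ (b ⊹ ⊟ a))) refl y y′
    eq : v (y′ + q · u) ≡ V q y
    eq = trans (cong v (solve 3 (λ a b c → (b ⊹ c) ≗ᵍ ((a ⊹ c) ⊹ (b ⊹ ⊟ a))) refl y y′ (q · u)))
      (trans (v-<ˡ _ _ (subst (_<∞ v (y′ - y)) (sym (V⇒v q y u∈ d)) lt)) (V⇒v q y u∈ d))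
    value′ : Dominates u q y → V q y′ ≡ V q y
    value′ (inj₁ z) = trans (V-zero q y′ z) (trans (cong v (sym (trans (cong (y′ +_) (·-zero q u z)) (+-identityʳ y′)))) eq)
    value′ (inj₂ ≤u) = trans (v⇒V q y′ u∈ (subst (_≤∞ just u) (sym eq) ≤u)) eq
    value : V q y′ ≡ V q y
    value = value′ d

  -- If `V q (x - c)` is `w`, then `w` itself can stand for λ: `x - c + q w` has valuation `w`, that
  -- is, `x` lies at valuation `w` from the ordinary point `c - q w`.
  point : ∀ {A} → Constraint A → Tm A → Tm A
  point κ w = center′ κ ⊖ coeff κ ⊙ w

  middle : ∀ {A} → Tm A → Constraint A → Constraint A → Tm A
  middle w κ κ′ = ½ˢ ⊙ (point κ w ⊕ point κ′ w)

  -- The steps have valuation `w`: `w` itself if it is `s 0#`, and `w` minus its predecessor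
  -- otherwise. Both are listed because the case depends on the assignment.
  beyond : ∀ {A} → Tm A → Constraint A → List (Tm A)
  beyond w κ = (c ⊕ w) ∷ (c ⊖ w) ∷ (c ⊕ (w ⊖ predᵗ w)) ∷ (c ⊖ (w ⊖ predᵗ w)) ∷ []
    where c = point κ w

  around : ∀ {A} → List (Constraint A) → Tm A → Constraint A → List (Tm A)
  around cs w κ = map (middle w κ) cs ++ beyond w κ

  candidatesAt : ∀ {A} → List (Constraint A) → Tm A → List (Tm A)
  candidatesAt cs w = concatMap (around cs w) cs

  -- 0 serves when all centers are ∞, and a center when its key is ∞, as `x` then equals it. The
  -- rest is for the largest key; which constraint attains it is not known in advance, so all names
  -- are tried.
  candidates : ∀ {A} → List (Constraint A) → List (Tm A)
  candidates cs = 0ᵗ ∷ map center′ cs ++ concatMap (candidatesAt cs ∘ name) cs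

  module _ {A : Set} (cs : List (Constraint A)) (ξ : Env A) (x : Γ)
           (named : ∀ {κ} → κ ∈ cs → eval (name κ) ξ ≡ key κ x ξ) where

    private
      κ : Fin (length cs) → Constraint A
      κ = lookup cs

      κ∈ : ∀ i → κ i ∈ cs
      κ∈ i = ∈-lookup {xs = cs} i

      c : Fin (length cs) → Γ∞
      c i = eval (center′ (κ i)) ξ

      Result : Set ℓ
      Result = ∃ λ u → u ∈ candidates cs × ∃ λ x′ → eval u ξ ≡ just x′ × AllPreserved cs x x′ ξ

      fromIndex : ∀ {x′} → (∀ i → Preserved (κ i) x x′ ξ) → AllPreserved cs x x′ ξ
      fromIndex {x′} p {k} k∈ = subst (λ k → Preserved k x x′ ξ) (sym (lookup-index k∈)) (p (Any.index k∈))

      ∞-preserved : ∀ k {x′} → eval (center′ k) ξ ≡ nothing → Preserved k x x′ ξ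
      ∞-preserved k {x′} e rewrite e = refl , λ _ → refl

      V-just-InΨ : ∀ {q y w} → V∞ q y ≡ just w → InΨ w
      V-just-InΨ {q} {y} e = subst InΨ∞ e (V∞-InΨ∞ q y)

      -- `w` is the largest key. The constraints with key `w` become the points of `Gap`; those with
      -- smaller key survive by `V-close`, because `x` moves by an element of valuation at least
      -- `w`.
      module AtMaximum (j : Fin (length cs)) (a w : Γ) (c-j : c j ≡ just a) (key-j : key (κ j) x ξ ≡ just w)
                       (max : ∀ i → c i ≢ nothing → key (κ i) x ξ ≤∞ just w) where

        w∈ : InΨ w
        w∈ = V-just-InΨ {coeff (κ j)} {just x -∞ c j} key-j

        nameⱼ : Tm A
        nameⱼ = name (κ j)

        eval-name : eval nameⱼ ξ ≡ just w
        eval-name = trans (named (κ∈ j)) key-j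

        ctr : Γ∞ → Γ
        ctr nothing = 0#
        ctr (just y) = y

        pt : Fin (length cs) → Γ
        pt i = ctr (c i) - coeff (κ i) · w

        N : Fin (length cs) → Set ℓ
        N i = c i ≢ nothing × key (κ i) x ξ ≡ just w

        N? : ∀ i → Dec (N i)
        N? i with finite? (c i) | key (κ i) x ξ O∞.≟ just w
        ... | yes p | yes e = yes (p , e)
        ... | no n | _ = no λ (p , _) → n p
        ... | _ | no n = no λ (_ , e) → n e

        key-just : ∀ i y {z} → c i ≡ just y → key (κ i) z ξ ≡ V (coeff (κ i)) (z - y)
        key-just i y {z} e = trans (cong (λ t → V∞ (coeff (κ i)) (just z -∞ t)) e) (cong (V∞ (coeff (κ i))) (just-minus z y))

        sgn-just : ∀ i y {z} → c i ≡ just y → sgn (just z -∞ c i) ≡ sign (z - y)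
        sgn-just i y {z} e = trans (cong (λ t → sgn (just z -∞ t)) e) (cong sgn (just-minus z y))

        N-just : ∀ i → N i → ∃ λ y → c i ≡ just y
        N-just i (n , _) with c i
        ... | nothing = ⊥-elim (n refl)
        ... | just y = y , refl

        pt-just : ∀ i y z → c i ≡ just y → z - pt i ≡ (z - y) + coeff (κ i) · w
        pt-just i y z e = trans (cong (λ t → z - (ctr t - coeff (κ i) · w)) e)
          (solve 3 (λ z y t → (z ⊹ ⊟ (y ⊹ ⊟ t)) ≗ᵍ ((z ⊹ ⊟ y) ⊹ t)) refl z y (coeff (κ i) · w))

        near : ∀ i → N i → v (x - pt i) ≡ just w
        near i ni@(_ , e) with N-just i ni
        ... | y , cy = trans (cong v (pt-just i y x cy))
          (trans (V⇒v (coeff (κ i)) (x - y) w∈ (inj₂ (inj₂ eq))) eq)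
          where
          eq : V (coeff (κ i)) (x - y) ≡ just w
          eq = trans (sym (key-just i y cy)) e

        Nj : N j
        Nj = (λ e → just≢nothing (trans (sym c-j) e)) , key-j

        step : ∃ λ (t : Tm A) → ∃ λ e → (t ≡ nameⱼ ⊎ t ≡ nameⱼ ⊖ predᵗ nameⱼ) × eval t ξ ≡ just e × 0# < e × v e ≡ just w
        step with s0-least w w∈
        ... | inj₂ refl = nameⱼ , w , inj₁ refl , eval-name , s0>0 , v-s0
        ... | inj₁ p with s-onto w w∈ p
        ...   | b , b∈ , refl = nameⱼ ⊖ predᵗ nameⱼ , s b - b , inj₂ refl ,
                trans (cong₂ _-∞_ eval-name (trans (eval-pred nameⱼ ξ) (trans (cong pred eval-name) (pred-s b∈))))
                  (just-minus (s b) b) ,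
                <⇒0<- (α<sα b b∈) , v-u-pred b∈

        e : Γ
        e = proj₁ (proj₂ step)

        open Gap N? pt x w e (proj₁ (proj₂ (proj₂ (proj₂ (proj₂ step))))) (proj₂ (proj₂ (proj₂ (proj₂ (proj₂ step))))) near (j , Nj)

        pointᵗ : Fin (length cs) → Tm A
        pointᵗ i = point (κ i) nameⱼ

        eval-point : ∀ i → N i → eval (pointᵗ i) ξ ≡ just (pt i)
        eval-point i ni with N-just i ni
        ... | y , cy = trans (cong₂ (λ a b → a -∞ coeff (κ i) ·∞ b) cy eval-name)
          (trans (just-minus y _) (cong (λ t → just (ctr t - coeff (κ i) · w)) (sym cy)))

        ∈-candidates : ∀ {u} → u ∈ candidatesAt cs nameⱼ → u ∈ candidates cs
        ∈-candidates u∈ = there (∈-++⁺ʳ (map center′ cs) (∈-concatMap (candidatesAt cs ∘ name) (κ∈ j) u∈))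

        ∈-steps : ∀ i {u} → u ∈ beyond nameⱼ (κ i) → u ∈ candidates cs
        ∈-steps i u∈ = ∈-candidates (∈-concatMap (around cs nameⱼ) (κ∈ i) (∈-++⁺ʳ (map (middle nameⱼ (κ i)) cs) u∈))

        candidate : ∀ {x′} → Choice x′ → ∃ λ u → u ∈ candidates cs × eval u ξ ≡ just x′
        candidate (mid i i′ ni ni′) = ½ˢ ⊙ (pointᵗ i ⊕ pointᵗ i′) ,
          ∈-candidates (∈-concatMap (around cs nameⱼ) (κ∈ i) (∈-++⁺ˡ (∈-map⁺ (middle nameⱼ (κ i)) (κ∈ i′)))) ,
          cong (½ˢ ·∞_) (cong₂ add∞ (eval-point i ni) (eval-point i′ ni′))
        candidate (up i ni) with step
        ... | t , d , inj₁ refl , ev , _ = _ , ∈-steps i (here refl) , cong₂ add∞ (eval-point i ni) ev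
        ... | t , d , inj₂ refl , ev , _ = _ , ∈-steps i (there (there (here refl))) , cong₂ add∞ (eval-point i ni) ev
        candidate (down i ni) with step
        ... | t , d , inj₁ refl , ev , _ = _ , ∈-steps i (there (here refl)) ,
              trans (cong₂ _-∞_ (eval-point i ni) ev) (just-minus (pt i) d)
        ... | t , d , inj₂ refl , ev , _ = _ , ∈-steps i (there (there (there (here refl)))) ,
              trans (cong₂ _-∞_ (eval-point i ni) ev) (just-minus (pt i) d)

        result : Result
        result with choose-gap
        ... | x′ , ch , goal with candidate ch
        ...   | u , u∈ , ev = u , u∈ , x′ , ev , fromIndex pres
          where
          close : just w ≤∞ v (x′ - x)
          close = subst (λ z → just w ≤∞ v z)
            (solve 3 (λ x x′ a → ((x′ ⊹ ⊟ a) ⊹ ⊟ (x ⊹ ⊟ a)) ≗ᵍ (x′ ⊹ ⊟ x)) refl x x′ (pt j))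
            (v-ultra- (x′ - pt j) (x - pt j) (inj₂ (sym (proj₁ (goal j Nj)))) (inj₂ (sym (near j Nj))))

          pres-just : ∀ i y → c i ≡ just y → key (κ i) x ξ ≤∞ just w → Preserved (κ i) x x′ ξ
          pres-just i y cy (inj₁ p) with V-close (coeff (κ i)) (x - y) (x′ - y)
              (subst (_<∞ just w) (key-just i y cy) p)
              (subst (λ z → just w ≤∞ v z) (solve 3 (λ x x′ a → (x′ ⊹ ⊟ x) ≗ᵍ ((x′ ⊹ ⊟ a) ⊹ ⊟ (x ⊹ ⊟ a))) refl x x′ y) close)
          ... | k , σ = trans (key-just i y cy) (trans k (sym (key-just i y cy))) ,
                λ z → trans (sgn-just i y cy) (trans (σ z) (sym (sgn-just i y cy)))
          pres-just i y cy (inj₂ p) = trans key′ (sym p) , λ z →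
              trans (sgn-just i y cy) (trans (cong sign (sym (pt-zero x′ z)))
                (trans (proj₂ (goal i ni)) (trans (cong sign (pt-zero x z)) (sym (sgn-just i y cy)))))
            where
            ni : N i
            ni = (λ n → just≢nothing (trans (sym cy) n)) , p
            pt-zero : ∀ z → IsZero (coeff (κ i)) → z - pt i ≡ z - y
            pt-zero z q0 = trans (pt-just i y z cy) (trans (cong ((z - y) +_) (·-zero (coeff (κ i)) w q0)) (+-identityʳ _))
            at-w : v ((x′ - y) + coeff (κ i) · w) ≡ just w
            at-w = trans (cong v (sym (pt-just i y x′ cy))) (proj₁ (goal i ni))
            key′ : key (κ i) x′ ξ ≡ just w
            key′ = trans (key-just i y cy) (trans (v⇒V (coeff (κ i)) (x′ - y) w∈ (inj₂ at-w)) at-w)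

          pres : ∀ i → Preserved (κ i) x x′ ξ
          pres i with finite? (c i)
          ... | no n = ∞-preserved (κ i) (¬finite (c i) n)
          ... | yes f = pres-just i (ctr (c i)) (lemma (c i) f) (max i f)
            where
            lemma : ∀ y → y ≢ nothing → y ≡ just (ctr y)
            lemma nothing n = ⊥-elim (n refl)
            lemma (just y) _ = refl

    move : Result
    move with maximal (λ i → finite? (c i)) (λ i → key (κ i) x ξ)
    ... | inj₁ none = 0ᵗ , here refl , 0# , refl , fromIndex λ i → ∞-preserved (κ i) (¬finite (c i) (none i))
    ... | inj₂ (j , fin , max) = at-maximum j (c j) refl (key (κ j) x ξ) refl fin max
      where
      V-∞ : ∀ q y → V q y ≡ nothing → y ≡ 0#
      V-∞ q y e with isZero? q
      ... | yes z = v-nothing (trans (sym (V-zero q y z)) e)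
      ... | no n with () ← trans (sym (V-nonzero q y n)) e
      at-maximum : ∀ j y → c j ≡ y → ∀ k → key (κ j) x ξ ≡ k → c j ≢ nothing →
                   (∀ i → c i ≢ nothing → key (κ i) x ξ ≤∞ key (κ j) x ξ) → Result
      at-maximum j nothing c-j _ _ fin _ = ⊥-elim (fin c-j)
      at-maximum j (just a) c-j (just w) key-j _ max =
        AtMaximum.result j a w c-j key-j (λ i f → subst (key (κ i) x ξ ≤∞_) key-j (max i f))
      -- `V q y` is ∞ only if `y` is 0, so `x` is the center itself and is not moved.
      at-maximum j (just a) c-j nothing key-j _ _ =
        center′ (κ j) , there (∈-++⁺ˡ (∈-map⁺ center′ (κ∈ j))) , x ,
        trans c-j (cong just (sym x≡a)) , λ _ → refl , λ _ → refl
        where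
        x≡a : x ≡ a
        x≡a = x-y≡0⇒x≡y (V-∞ (coeff (κ j)) (x - a) (trans (sym (trans
          (cong (λ t → V∞ (coeff (κ j)) (just x -∞ t)) c-j) (cong (V∞ (coeff (κ j))) (just-minus x a)))) key-j))

  -- `x` is replaced by a candidate over the auxiliary names, and the names, whose values satisfy
  -- `InΨ₀`, are eliminated from the resulting terms `T′`. Their replacements need not be the true
  -- auxiliary values; only the signs of `T′` are carried over.
  elimination : Elim ⊤ (λ _ → ⊤ₚ.⊤)
  elimination {Var} T with flatList T
  ... | S , moves = map const (∞ᵗ ∷ concatMap (λ u → map (resolve u) Ws) Cs) , correct
    where
    open System S
    Cs : List (Tm (Aux ⊎ Var))
    Cs = candidates cs
    at : Tm (Aux ⊎ Var) → Tm (⊤ ⊎ Var) → Tm (Aux ⊎ Var)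
    at u = sub [ const u , (λ i → var (inj₂ i)) ]′
    T′ : List (Tm (Aux ⊎ Var))
    T′ = concatMap (λ u → map (at u) T) Cs
    Ws : List (Aux → Tm Var)
    Ws = proj₁ (elim T′)
    resolve : Tm (Aux ⊎ Var) → (Aux → Tm Var) → Tm Var
    resolve u w = sub [ w , var ]′ u
    eval-at : ∀ u t {a ρ y} → eval u [ a , ρ ]′ ≡ y → eval (at u t) [ a , ρ ]′ ≡ eval t [ const y , ρ ]′
    eval-at u t e = trans (eval-sub _ t _) (eval-cong t λ { (inj₁ tt) → e ; (inj₂ _) → refl })
    correct : ∀ ρ (w : Env ⊤) → (∀ i → ⊤ₚ.⊤) → ∃ λ w′ →
      w′ ∈ map const (∞ᵗ ∷ concatMap (λ u → map (resolve u) Ws) Cs) ×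
      Agree T [ w , ρ ]′ [ (λ i → eval (w′ i) ρ) , ρ ]′
    correct ρ w _ with w tt in e
    ... | nothing = const ∞ᵗ , here refl , λ {t} _ →
          cong sgn (eval-cong t λ { (inj₁ tt) → e ; (inj₂ _) → refl })
    ... | just x with move cs (env x ρ) x (λ κ∈ → named x ρ κ∈)
    ...   | u , u∈ , x′ , ev , pres with proj₂ (elim T′) ρ (aux x ρ) (aux∈ x ρ)
    ...     | w′ , w′∈ , a = const (resolve u w′) ,
              ∈-map⁺ const (there (∈-concatMap (λ u → map (resolve u) Ws) u∈ (∈-map⁺ (resolve u) w′∈))) , agree
      where
      agree : Agree T [ w , ρ ]′ [ const (eval (resolve u w′) ρ) , ρ ]′
      agree {t} t∈ = begin
        sgn (eval t [ w , ρ ]′)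
          ≡⟨ cong sgn (eval-cong t λ { (inj₁ tt) → e ; (inj₂ _) → refl }) ⟩
        sgn (eval t [ const (just x) , ρ ]′)
          ≡⟨ moves {ρ} {x} {x′} pres t∈ ⟩
        sgn (eval t [ const (just x′) , ρ ]′)
          ≡⟨ cong sgn (eval-at u t ev) ⟨
        sgn (eval (at u t) [ aux x ρ , ρ ]′)
          ≡⟨ a (∈-concatMap (λ u → map (at u) T) u∈ (∈-map⁺ (at u) t∈)) ⟩
        sgn (eval (at u t) [ (λ i → eval (w′ i) ρ) , ρ ]′)
          ≡⟨ cong sgn (eval-at u t refl) ⟩
        sgn (eval t [ const (eval u [ (λ i → eval (w′ i) ρ) , ρ ]′) , ρ ]′)
          ≡⟨ cong sgn (eval-cong t λ { (inj₁ tt) → trans (eval-sub _ u ρ) (eval-cong u λ { (inj₁ _) → refl ; (inj₂ _) → refl })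
                                     ; (inj₂ _) → refl }) ⟨
        sgn (eval t [ const (eval (resolve u w′) ρ) , ρ ]′) ∎
        where open ≡-Reasoning

theorem6p1 : ∀ {ℓ : Level} → NIP-T0 ℓ × NIP-Tlog ℓ
theorem6p1 = (λ M → Witnesses.no-IP M (Witnesses.elimination M) {AC} ⊤ₚ.tt) ,
             (λ M E → Witnesses.no-IP M (Witnesses.elimination M) {Log} E)
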